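{- Let $\mathbb F$ be an algebraically closed field, $G$ a Cayley bigraph on a finite group $\mathcal G$, $L$ a subgraph of $G$, $1\le k\le\rho(L)$, and let $L'$ be obtained from $L$ by removing a single edge. Then the generic maximum excess of $(L',G,\mathcal G,\mathbb F,k-1)$ is at least the generic maximum excess of $(L,G,\mathcal G,\mathbb F,k)$.
   Context: Cayley bigraph on $\mathcal G$ with generators $g_1,g_2$: $V_G=\mathcal G$, $E_G=\mathcal G\times\{1,2\}$, edge $(g,i)$ has tail $g$, head $g_ig$. For $x\in\mathcal G$ and a subgraph $L$, $Lx$ is the image of $L$ under $g\mapsto gx$, $(g,i)\mapsto(gx,i)$; for $P\in V_G\sqcup E_G$, $\mathcal G_L(P)=\{x\in\mathcal G:P\in Lx\}$. For $k\ge0$ and $M\in\mathbb F^{k\times\mathcal G}$ with columns $m^x$, $M$ is $L$-surjective if for every $P$ the columns $m^x$, $x\in\mathcal G_L(P)$, span $\mathbb F^k$; then $\mathcal K_M(L)$ is the sheaf on $G$ with $\mathcal K_M(L)(P)=\{a\in\mathbb F^{\mathcal G}:a_x=0\ \forall x\notin\mathcal G_L(P),\ \sum_xa_xm^x=0\}$ and restriction maps the inclusions. The generic maximum excess of $(L,G,\mathcal G,\mathbb F,k)$ (for $k\le\rho(L)$) is the largest integer $m$ such that the set of $L$-surjective $M\in\mathbb F^{k\times\mathcal G}$ with ${\rm m.e.}(\mathcal K_M(L))\ge m$ is Zariski dense in $\mathbb F^{k\times\mathcal G}$. Maximum excess of a sheaf $\mathcal F$: with $\mathcal F(V)=\bigoplus_v\mathcal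 F(v)$, $d_h,d_t$ sending $\mathcal F(e)$ into $\mathcal F(he)$, $\mathcal F(te)$ by the restriction maps, $\Gamma_{\rm ht}(U)=\bigoplus_e\{w\in\mathcal F(e):d_hw,d_tw\in U\}$ and ${\rm m.e.}(\mathcal F)=\max_{U\subset\mathcal F(V)}(\dim\Gamma_{\rm ht}(U)-\dim U)$. $\rho(L)=\sum_X\max(0,|E_X|-|V_X|)$ over connected components $X$ of $L$ as an undirected graph (note $\rho(L')\ge\rho(L)-1$). -}

module Defs where

open import Level using (_⊔_; 0ℓ) renaming (suc to lsuc)
open import Algebra.Apartness.Bundles using (HeytingField; HeytingCommutativeRing)
open import Algebra.Bundles using (CommutativeRing)
open import Algebra.Module.Bundles using (LeftModule)
import Algebra.Module.Construct.TensorUnit as TensorUnit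
open import Algebra.Module.Morphism.Structures using (module LeftModuleMorphisms)
import Algebra.Properties.CommutativeMonoid.Sum as CommutativeMonoidSum
import Algebra.Properties.Group as GroupProperties
import Algebra.Properties.Semiring.Exp as SemiringExp
import Algebra.Properties.Semiring.Sum as SemiringSum
open import Algebra.Structures using (IsGroup)
open import Axiom.ExcludedMiddle using (ExcludedMiddle)
open import Data.Bool.Base using (Bool; T; not; _∧_)
open import Data.Bool.Properties using (T?; T-∧)
open import Data.Fin.Base using (Fin; fromℕ; toℕ)
open import Data.Fin.Properties using (inj⇒≟; *↔×)
open import Data.Integer.Base as ℤ using (ℤ; _⊖_)
open import Data.List.Base using (List; allFin; deduplicate; filter; length; map)
open import Data.Nat.Base as ℕ using (ℕ; suc; _∸_)
open import Data.Nat.ListAction using (sum)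
open import Data.Product.Base using (Σ; ∃; ∃-syntax; _×_; _,_; proj₁; proj₂)
open import Data.Product.Function.NonDependent.Propositional using (_×-↔_)
open import Data.Sum.Base using (_⊎_; inj₁; inj₂; [_,_]′)
open import Function.Base using (_∘_)
open import Function.Bundles using (_↔_; Inverse; Equivalence)
open import Function.Construct.Composition using (_↔-∘_)
open import Function.Construct.Identity using (↔-id)
open import Function.Construct.Symmetry using (↔-sym)
open import Function.Properties.Inverse using (↔⇒↣)
open import Relation.Binary.Construct.Closure.Equivalence using (EqClosure)
open import Relation.Binary.Core using (Rel)
open import Relation.Binary.Definitions using (Decidable; DecidableEquality; _Respects_)
open import Relation.Binary.PropositionalEquality using (_≡_; refl; cong)
open import Relation.Nullary.Decidable using (⌊_⌋; yes; no; _×-dec_)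
open import Relation.Nullary.Negation using (¬_)
open import Relation.Unary using (Pred; _∈_; _∉_; _⊆_)

Finite : Set → Set
Finite A = ∃[ n ] (A ↔ Fin n)

module _ {A : Set} (fin : Finite A) where

  element : Fin (proj₁ fin) → A
  element = Inverse.from (proj₂ fin)

  elements : List A
  elements = map element (allFin (proj₁ fin))

  decEq : DecidableEquality A
  decEq = inj⇒≟ (↔⇒↣ (proj₂ fin))

IsLargest : ∀ {p} → Pred ℤ p → Pred ℤ p
IsLargest P m = P m × (∀ n → P n → n ℤ.≤ m)

record Graph : Set₁ where
  field
    V E       : Set
    V-finite  : Finite V
    E-finite  : Finite E
    head tail : E → V

module _ (G : Graph) where

  open Graph G

  record Subgraph : Set where
    field
      hasV   : V → Bool
      hasE   : E → Bool
      head∈  : ∀ e → T (hasE e) → T (hasV (head e))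
      tail∈  : ∀ e → T (hasE e) → T (hasV (tail e))

module _ {G : Graph} where

  open Graph G
  open Subgraph

  ⟦_⟧ : Subgraph G → Pred (V ⊎ E) 0ℓ
  ⟦ L ⟧ = [ T ∘ hasV L , T ∘ hasE L ]′

  removeEdge : Subgraph G → E → Subgraph G
  removeEdge L e = record
    { hasV  = hasV L
    ; hasE  = λ f → hasE L f ∧ not ⌊ decEq E-finite f e ⌋
    ; head∈ = λ f → head∈ L f ∘ proj₁ ∘ Equivalence.to T-∧
    ; tail∈ = λ f → tail∈ L f ∘ proj₁ ∘ Equivalence.to T-∧
    }

  Connected : Subgraph G → Rel V 0ℓ
  Connected L = EqClosure λ u v → ∃[ e ] (T (hasE L e) × tail e ≡ u × head e ≡ v)

  module _ (em : ExcludedMiddle 0ℓ) (L : Subgraph G) where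

    connected? : Decidable (Connected L)
    connected? u v = em {Connected L u v}

    componentVertices : V → List V
    componentVertices r = filter (λ v → T? (hasV L v) ×-dec connected? r v) (elements V-finite)

    componentEdges : V → List E
    componentEdges r = filter (λ e → T? (hasE L e) ×-dec connected? r (tail e)) (elements E-finite)

    -- One vertex from each connected component of L.
    representatives : List V
    representatives =
      deduplicate connected? (filter (λ v → T? (hasV L v)) (elements V-finite))

    -- max(0, m - n) is m ∸ n.
    ρ : ℕ
    ρ = sum (map (λ r → length (componentEdges r) ∸ length (componentVertices r)) representatives)

record FiniteGroup : Set₁ where
  infixl 7 _∙_
  infix  8 _⁻¹
  field
    Carrier : Set
    _∙_     : Carrier → Carrier → Carrier
    ε       : Carrier
    _⁻¹     : Carrier → Carrier
    isGroup : IsGroup _≡_ _∙_ ε _⁻¹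
    finite  : Finite Carrier

  open IsGroup isGroup public using (assoc; identityˡ; identityʳ; inverseˡ; inverseʳ)

module _ (𝒢 : FiniteGroup) where

  open FiniteGroup 𝒢

  -- The two elements need be neither distinct nor generators of the whole group.
  cayleyBigraph : (Fin 2 → Carrier) → Graph
  cayleyBigraph gen = record
    { V        = Carrier
    ; E        = Carrier × Fin 2
    ; V-finite = finite
    ; E-finite = _ , ↔-sym *↔× ↔-∘ (proj₂ finite ×-↔ ↔-id (Fin 2))
    ; head     = λ (g , i) → gen i ∙ g
    ; tail     = proj₁
    }

module _ (𝒢 : FiniteGroup) (gen : Fin 2 → FiniteGroup.Carrier 𝒢) where

  open FiniteGroup 𝒢
  open Graph (cayleyBigraph 𝒢 gen)

  translate : Carrier → V ⊎ E → V ⊎ E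
  translate x (inj₁ g)       = inj₁ (g ∙ x)
  translate x (inj₂ (g , i)) = inj₂ (g ∙ x , i)

  -- This is 𝒢_L(P): membership of P in the translate Lx, as a predicate in x.
  Translators : Subgraph (cayleyBigraph 𝒢 gen) → V ⊎ E → Pred Carrier 0ℓ
  Translators L P x = ∃[ Q ] (Q ∈ ⟦ L ⟧ × translate x Q ≡ P)

  translators-head : ∀ L e → Translators L (inj₂ e) ⊆ Translators L (inj₁ (head e))
  translators-head L e {x} (inj₂ (g , i) , Q∈L , refl) =
    inj₁ (gen i ∙ g) , Subgraph.head∈ L (g , i) Q∈L , cong inj₁ (assoc (gen i) g x)

  translators-tail : ∀ L e → Translators L (inj₂ e) ⊆ Translators L (inj₁ (tail e))
  translators-tail L e {x} (inj₂ (g , i) , Q∈L , refl) =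
    inj₁ g , Subgraph.tail∈ L (g , i) Q∈L , refl

module _ {c ℓ} (R : CommutativeRing c ℓ) where

  open CommutativeRing R using (ring; 0#; 1#; -_; -‿inverseˡ)
    renaming (Carrier to F; _≈_ to _≈F_)

  VectorSpace : ∀ m ℓm → Set (c ⊔ ℓ ⊔ lsuc (m ⊔ ℓm))
  VectorSpace = LeftModule ring

  record Subspace {m ℓm} (W : VectorSpace m ℓm) p : Set (c ⊔ m ⊔ ℓm ⊔ lsuc p) where
    open LeftModule W
    field
      Member  : Pred Carrierᴹ p
      resp    : Member Respects _≈ᴹ_
      0-mem   : Member 0ᴹ
      +-mem   : ∀ {v w} → Member v → Member w → Member (v +ᴹ w)
      *ₗ-mem  : ∀ a {v} → Member v → Member (a *ₗ v)

  module _ {m ℓm} (W : VectorSpace m ℓm) where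

    open LeftModule W

    neg-as-scalar : ∀ v → (- 1# *ₗ v) ≈ᴹ (-ᴹ v)
    neg-as-scalar v = GroupProperties.inverseˡ-unique +ᴹ-group (- 1# *ₗ v) v
      (≈ᴹ-trans (+ᴹ-congˡ (≈ᴹ-sym (*ₗ-identityˡ v)))
      (≈ᴹ-trans (≈ᴹ-sym (*ₗ-distribʳ v (- 1#) 1#))
      (≈ᴹ-trans (*ₗ-cong (-‿inverseˡ 1#) ≈ᴹ-refl) (*ₗ-zeroˡ v))))

  asSpace : ∀ {m ℓm p} {W : VectorSpace m ℓm} → Subspace W p → VectorSpace (m ⊔ p) ℓm
  asSpace {W = W} U = record
    { Carrierᴹ = ∃ Member
    ; _≈ᴹ_ = λ v w → proj₁ v ≈ᴹ proj₁ w
    ; _+ᴹ_ = λ (v , v∈) (w , w∈) → v +ᴹ w , +-mem v∈ w∈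
    ; _*ₗ_ = λ a (v , v∈) → a *ₗ v , *ₗ-mem a v∈
    ; 0ᴹ   = 0ᴹ , 0-mem
    ; -ᴹ_  = λ (v , v∈) → -ᴹ v , resp (neg-as-scalar W v) (*ₗ-mem (- 1#) v∈)
    ; isLeftModule = record
      { isLeftSemimodule = record
        { +ᴹ-isCommutativeMonoid = record
          { isMonoid = record
            { isSemigroup = record
              { isMagma = record
                { isEquivalence = record { refl = ≈ᴹ-refl ; sym = ≈ᴹ-sym ; trans = ≈ᴹ-trans }
                ; ∙-cong = +ᴹ-cong
                }
              ; assoc = λ _ _ _ → +ᴹ-assoc _ _ _
              }
            ; identity = (λ _ → +ᴹ-identityˡ _) , (λ _ → +ᴹ-identityʳ _)
            }
          ; comm = λ _ _ → +ᴹ-comm _ _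
          }
        ; isPreleftSemimodule = record
          { *ₗ-cong      = *ₗ-cong
          ; *ₗ-zeroˡ     = λ _ → *ₗ-zeroˡ _
          ; *ₗ-distribʳ  = λ _ _ _ → *ₗ-distribʳ _ _ _
          ; *ₗ-identityˡ = λ _ → *ₗ-identityˡ _
          ; *ₗ-assoc     = λ _ _ _ → *ₗ-assoc _ _ _
          ; *ₗ-zeroʳ     = λ _ → *ₗ-zeroʳ _
          ; *ₗ-distribˡ  = λ _ _ _ → *ₗ-distribˡ _ _ _
          }
        }
      ; -ᴹ‿cong    = -ᴹ‿cong
      ; -ᴹ‿inverse = (λ _ → proj₁ -ᴹ‿inverse _) , (λ _ → proj₂ -ᴹ‿inverse _)
      }
    }
    where
    open LeftModule W
    open Subspace U

  -- Direct sums are only ever taken over a finite index type, so they are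
  -- the same as direct products.
  ⨁ : ∀ {m ℓm} (I : Set) → (I → VectorSpace m ℓm) → VectorSpace m ℓm
  ⨁ I W = record
    { Carrierᴹ = ∀ i → Carrierᴹ i
    ; _≈ᴹ_ = λ v w → ∀ i → _≈ᴹ_ i (v i) (w i)
    ; _+ᴹ_ = λ v w i → _+ᴹ_ i (v i) (w i)
    ; _*ₗ_ = λ a v i → _*ₗ_ i a (v i)
    ; 0ᴹ   = λ i → 0ᴹ i
    ; -ᴹ_  = λ v i → -ᴹ_ i (v i)
    ; isLeftModule = record
      { isLeftSemimodule = record
        { +ᴹ-isCommutativeMonoid = record
          { isMonoid = record
            { isSemigroup = record
              { isMagma = record
                { isEquivalence = record
                  { refl  = λ i → ≈ᴹ-refl i
                  ; sym   = λ p i → ≈ᴹ-sym i (p i)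
                  ; trans = λ p q i → ≈ᴹ-trans i (p i) (q i)
                  }
                ; ∙-cong = λ p q i → +ᴹ-cong i (p i) (q i)
                }
              ; assoc = λ _ _ _ i → +ᴹ-assoc i _ _ _
              }
            ; identity = (λ _ i → +ᴹ-identityˡ i _) , (λ _ i → +ᴹ-identityʳ i _)
            }
          ; comm = λ _ _ i → +ᴹ-comm i _ _
          }
        ; isPreleftSemimodule = record
          { *ₗ-cong      = λ p q i → *ₗ-cong i p (q i)
          ; *ₗ-zeroˡ     = λ _ i → *ₗ-zeroˡ i _
          ; *ₗ-distribʳ  = λ _ _ _ i → *ₗ-distribʳ i _ _ _
          ; *ₗ-identityˡ = λ _ i → *ₗ-identityˡ i _
          ; *ₗ-assoc     = λ _ _ _ i → *ₗ-assoc i _ _ _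
          ; *ₗ-zeroʳ     = λ _ i → *ₗ-zeroʳ i _
          ; *ₗ-distribˡ  = λ _ _ _ i → *ₗ-distribˡ i _ _ _
          }
        }
      ; -ᴹ‿cong    = λ p i → -ᴹ‿cong i (p i)
      ; -ᴹ‿inverse = (λ _ i → proj₁ (-ᴹ‿inverse i) _) , (λ _ i → proj₂ (-ᴹ‿inverse i) _)
      }
    }
    where
    module Summand (i : I) = LeftModule (W i)
    open Summand

  module _ {m ℓm} {I : Set} (_≟_ : DecidableEquality I) (W : I → VectorSpace m ℓm) where

    private module Summand (i : I) = LeftModule (W i)
    open Summand

    inject : ∀ i → Carrierᴹ i → (∀ j → Carrierᴹ j)
    inject i w j with i ≟ j
    ... | yes refl = w
    ... | no  _    = 0ᴹ j

    inject-cong : ∀ i {v w} → _≈ᴹ_ i v w → ∀ j → _≈ᴹ_ j (inject i v j) (inject i w j)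
    inject-cong i v≈w j with i ≟ j
    ... | yes refl = v≈w
    ... | no  _    = ≈ᴹ-refl j

    inject-0 : ∀ i j → _≈ᴹ_ j (0ᴹ j) (inject i (0ᴹ i) j)
    inject-0 i j with i ≟ j
    ... | yes refl = ≈ᴹ-refl j
    ... | no  _    = ≈ᴹ-refl j

    inject-+ : ∀ i v w j →
               _≈ᴹ_ j (_+ᴹ_ j (inject i v j) (inject i w j)) (inject i (_+ᴹ_ i v w) j)
    inject-+ i v w j with i ≟ j
    ... | yes refl = ≈ᴹ-refl j
    ... | no  _    = +ᴹ-identityˡ j _

    inject-*ₗ : ∀ i a v j → _≈ᴹ_ j (_*ₗ_ j a (inject i v j)) (inject i (_*ₗ_ i a v) j)
    inject-*ₗ i a v j with i ≟ j
    ... | yes refl = ≈ᴹ-refl j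
    ... | no  _    = *ₗ-zeroʳ j a

  module _ {m ℓm} (W : VectorSpace m ℓm) where

    open LeftModule W

    linComb : ∀ {d} → (Fin d → F) → (Fin d → Carrierᴹ) → Carrierᴹ
    linComb a b = CommutativeMonoidSum.sum +ᴹ-commutativeMonoid (λ i → a i *ₗ b i)

    HasDimension : ℕ → Set (c ⊔ ℓ ⊔ m ⊔ ℓm)
    HasDimension d = ∃[ b ]
        (∀ v → ∃[ a ] (linComb a b ≈ᴹ v))
      × (∀ (a : Fin d → F) → linComb a b ≈ᴹ 0ᴹ → ∀ i → a i ≈F 0#)

  record LinearMap {m ℓm n ℓn} (W : VectorSpace m ℓm) (W′ : VectorSpace n ℓn)
                   : Set (c ⊔ m ⊔ ℓm ⊔ n ⊔ ℓn) where
    private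
      module W  = LeftModule W
      module W′ = LeftModule W′
    open LeftModuleMorphisms W.rawLeftModule W′.rawLeftModule
    field
      apply  : W.Carrierᴹ → W′.Carrierᴹ
      isHomo : IsLeftModuleHomomorphism apply
    open IsLeftModuleHomomorphism isHomo public

module _ {c ℓ} (R : CommutativeRing c ℓ) where

  record Sheaf (G : Graph) m ℓm : Set (c ⊔ ℓ ⊔ lsuc (m ⊔ ℓm)) where
    open Graph G
    field
      stalk   : V ⊎ E → VectorSpace R m ℓm
      resHead : ∀ e → LinearMap R (stalk (inj₂ e)) (stalk (inj₁ (head e)))
      resTail : ∀ e → LinearMap R (stalk (inj₂ e)) (stalk (inj₁ (tail e)))

module _ {c ℓ m ℓm} {R : CommutativeRing c ℓ} {G : Graph} (ℱ : Sheaf R G m ℓm) where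

  open Graph G
  open Sheaf ℱ
  open LinearMap using (apply; ⟦⟧-cong; 0ᴹ-homo; +ᴹ-homo; *ₗ-homo)

  vertexSpace : VectorSpace R m ℓm
  vertexSpace = ⨁ R V (stalk ∘ inj₁)

  edgeSpace : VectorSpace R m ℓm
  edgeSpace = ⨁ R E (stalk ∘ inj₂)

  ι = inject R (decEq V-finite) (stalk ∘ inj₁)

  private
    module St (P : V ⊎ E) = LeftModule (stalk P)

  -- d_h and d_t restricted to the summand ℱ(e).
  dHead dTail : ∀ e → St.Carrierᴹ (inj₂ e) → LeftModule.Carrierᴹ vertexSpace
  dHead e w = ι (head e) (apply (resHead e) w)
  dTail e w = ι (tail e) (apply (resTail e) w)

  Γht : ∀ {p} → Subspace R vertexSpace p → Subspace R edgeSpace p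
  Γht U = record
    { Member = λ w → ∀ e → Member (dHead e (w e)) × Member (dTail e (w e))
    ; resp   = λ v≈w v∈ e →
        pull (head e) (resHead e) (v≈w e) (proj₁ (v∈ e)) ,
        pull (tail e) (resTail e) (v≈w e) (proj₂ (v∈ e))
    ; 0-mem  = λ e → zeroIn (head e) (resHead e) , zeroIn (tail e) (resTail e)
    ; +-mem  = λ v∈ w∈ e →
        plusIn (head e) (resHead e) (proj₁ (v∈ e)) (proj₁ (w∈ e)) ,
        plusIn (tail e) (resTail e) (proj₂ (v∈ e)) (proj₂ (w∈ e))
    ; *ₗ-mem = λ a v∈ e →
        timesIn (head e) (resHead e) a (proj₁ (v∈ e)) ,
        timesIn (tail e) (resTail e) a (proj₂ (v∈ e))
    }
    where
    open Subspace U
    open LeftModule vertexSpace using (≈ᴹ-sym; ≈ᴹ-trans)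

    _≟_ = decEq V-finite
    S   = λ v → stalk (inj₁ v)

    module _ {e : E} (u : V) (f : LinearMap R (stalk (inj₂ e)) (stalk (inj₁ u))) where

      pull : ∀ {v w} → St._≈ᴹ_ (inj₂ e) v w → Member (ι u (apply f v)) → Member (ι u (apply f w))
      pull v≈w = resp (inject-cong R _≟_ S u (⟦⟧-cong f v≈w))

      zeroIn : Member (ι u (apply f (St.0ᴹ (inj₂ e))))
      zeroIn = resp (≈ᴹ-trans (inject-0 R _≟_ S u)
                      (inject-cong R _≟_ S u (St.≈ᴹ-sym (inj₁ u) (0ᴹ-homo f)))) 0-mem

      plusIn : ∀ {v w} → Member (ι u (apply f v)) → Member (ι u (apply f w)) →
               Member (ι u (apply f (St._+ᴹ_ (inj₂ e) v w)))
      plusIn {v} {w} v∈ w∈ = resp (≈ᴹ-trans (inject-+ R _≟_ S u _ _)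
                      (inject-cong R _≟_ S u (St.≈ᴹ-sym (inj₁ u) (+ᴹ-homo f v w)))) (+-mem v∈ w∈)

      timesIn : ∀ a {v} → Member (ι u (apply f v)) →
                Member (ι u (apply f (St._*ₗ_ (inj₂ e) a v)))
      timesIn a {v} v∈ = resp (≈ᴹ-trans (inject-*ₗ R _≟_ S u a _)
                      (inject-cong R _≟_ S u (St.≈ᴹ-sym (inj₁ u) (*ₗ-homo f a v)))) (*ₗ-mem a v∈)

  -- U ranges over the subspaces that have a dimension; classically these are
  -- all of them when the stalks are finite-dimensional.  The level of U is large
  -- enough to contain the span of any finite family.
  IsExcess : ℤ → Set _
  IsExcess n = Σ (Subspace R vertexSpace (c ⊔ ℓ ⊔ m ⊔ ℓm)) λ U → ∃[ d₁ ] ∃[ d₀ ]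
      HasDimension R (asSpace R (Γht U)) d₁
    × HasDimension R (asSpace R U) d₀
    × n ≡ d₁ ⊖ d₀

  IsMaximumExcess : ℤ → Set _
  IsMaximumExcess = IsLargest IsExcess

-- Polynomial expressions: only their values on 𝔽^X matter for closed sets.
data Polynomial {c} (F : Set c) (X : Set) : Set c where
  con       : F → Polynomial F X
  var       : X → Polynomial F X
  _:+_ _:*_ : Polynomial F X → Polynomial F X → Polynomial F X

module _ {c ℓ} (R : CommutativeRing c ℓ) where

  open CommutativeRing R using (_≈_; _+_; _*_; 0#; semiring) renaming (Carrier to F)
  open SemiringExp semiring using (_^_)
  open SemiringSum semiring using () renaming (sum to ∑)

  IsAlgebraicallyClosed : Set (c ⊔ ℓ)
  IsAlgebraicallyClosed = ∀ n (a : Fin (2 ℕ.+ n) → F) → ¬ (a (fromℕ (suc n)) ≈ 0#) →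
    ∃[ x ] (∑ (λ i → a i * x ^ toℕ i) ≈ 0#)

  eval : ∀ {X} → Polynomial F X → (X → F) → F
  eval (con a)  x = a
  eval (var i)  x = x i
  eval (p :+ q) x = eval p x + eval q x
  eval (p :* q) x = eval p x * eval q x

  ZeroLocus : ∀ {X t} → Pred (Polynomial F X) t → Pred (X → F) (c ⊔ ℓ ⊔ t)
  ZeroLocus T x = ∀ p → p ∈ T → eval p x ≈ 0#

  ZariskiDense : ∀ {X p} → Pred (X → F) p → Set (lsuc c ⊔ ℓ ⊔ p)
  ZariskiDense {X} S = ∀ (T : Pred (Polynomial F X) c) →
    S ⊆ ZeroLocus T → ∀ x → x ∈ ZeroLocus T

module _ {c ℓ} (R : CommutativeRing c ℓ) (𝒢 : FiniteGroup)
         (gen : Fin 2 → FiniteGroup.Carrier 𝒢)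
         (L : Subgraph (cayleyBigraph 𝒢 gen)) where

  open CommutativeRing R hiding (zero)
    renaming (Carrier to F; refl to ≈-refl; sym to ≈-sym; trans to ≈-trans)
  open FiniteGroup 𝒢 using (finite) renaming (Carrier to Elt)
  open Graph (cayleyBigraph 𝒢 gen)
  open SemiringSum semiring using (sum-cong-≋; ∑-distrib-+; *-distribˡ-sum)
    renaming (sum to ∑)

  SupportedAt : V ⊎ E → (Elt → F) → Set ℓ
  SupportedAt P a = ∀ x → x ∉ Translators 𝒢 gen L P → a x ≈ 0#

  module _ {k : ℕ} (M : Fin k → Elt → F) where

    -- ∑ₓ aₓ mˣ
    columnComb : (Elt → F) → Fin k → F
    columnComb a i = ∑ (λ j → a (element finite j) * M i (element finite j))

    IsSurjective : Set (c ⊔ ℓ)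
    IsSurjective = ∀ P (b : Fin k → F) → ∃[ a ] (SupportedAt P a × (∀ i → columnComb a i ≈ b i))

    coordinates : VectorSpace R c ℓ
    coordinates = ⨁ R Elt (λ _ → TensorUnit.leftModule)

    private
      term : (Elt → F) → Fin k → Fin (proj₁ finite) → F
      term a i j = a (element finite j) * M i (element finite j)

    columnComb-cong : ∀ {a b} → (∀ x → a x ≈ b x) → ∀ i → columnComb a i ≈ columnComb b i
    columnComb-cong {a} {b} a≈b i =
      sum-cong-≋ {x = term a i} {y = term b i} λ j → *-congʳ (a≈b (element finite j))

    columnComb-*ₗ : ∀ r a i → columnComb (λ x → r * a x) i ≈ r * columnComb a i
    columnComb-*ₗ r a i = ≈-trans
      (sum-cong-≋ {x = term (λ x → r * a x) i} {y = λ j → r * term a i j} λ j → *-assoc _ _ _)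
      (≈-sym (*-distribˡ-sum r (term a i)))

    columnComb-0 : ∀ i → columnComb (λ _ → 0#) i ≈ 0#
    columnComb-0 i = ≈-trans (columnComb-cong (λ _ → ≈-sym (zeroˡ 0#)) i)
      (≈-trans (columnComb-*ₗ 0# (λ _ → 0#) i) (zeroˡ _))

    columnComb-+ : ∀ a b i → columnComb (λ x → a x + b x) i ≈ columnComb a i + columnComb b i
    columnComb-+ a b i = ≈-trans
      (sum-cong-≋ {x = term (λ x → a x + b x) i} {y = λ j → term a i j + term b i j}
        λ j → distribʳ _ _ _)
      (∑-distrib-+ (term a i) (term b i))

    relations : V ⊎ E → Subspace R coordinates ℓ
    relations P = record
      { Member = λ a → SupportedAt P a × (∀ i → columnComb a i ≈ 0#)
      ; resp   = λ {a} {b} a≈b (s , z) →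
          (λ x x∉ → ≈-trans (≈-sym (a≈b x)) (s x x∉)) ,
          (λ i → ≈-trans (columnComb-cong {b} {a} (λ x → ≈-sym (a≈b x)) i) (z i))
      ; 0-mem  = (λ _ _ → ≈-refl) , columnComb-0
      ; +-mem  = λ {a} {b} (s , z) (s′ , z′) →
          (λ x x∉ → ≈-trans (+-cong (s x x∉) (s′ x x∉)) (+-identityˡ 0#)) ,
          (λ i → ≈-trans (columnComb-+ a b i)
            (≈-trans (+-cong (z i) (z′ i)) (+-identityˡ 0#)))
      ; *ₗ-mem = λ r {a} (s , z) →
          (λ x x∉ → ≈-trans (*-congˡ (s x x∉)) (zeroʳ r)) ,
          (λ i → ≈-trans (columnComb-*ₗ r a i) (≈-trans (*-congˡ (z i)) (zeroʳ r)))
      }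

    inclusion : ∀ P Q → Translators 𝒢 gen L P ⊆ Translators 𝒢 gen L Q →
                LinearMap R (asSpace R (relations P)) (asSpace R (relations Q))
    inclusion P Q P⊆Q = record
      { apply  = λ (a , s , z) → a , (λ x x∉ → s x (x∉ ∘ P⊆Q)) , z
      ; isHomo = record
        { +ᴹ-isGroupHomomorphism = record
          { isMonoidHomomorphism = record
            { isMagmaHomomorphism = record
              { isRelHomomorphism = record { cong = λ p → p }
              ; homo              = λ _ _ _ → ≈-refl
              }
            ; ε-homo = λ _ → ≈-refl
            }
          ; ⁻¹-homo = λ _ _ → ≈-refl
          }
        ; *ₗ-homo = λ _ _ _ → ≈-refl
        }
      }

    𝒦 : Sheaf R (cayleyBigraph 𝒢 gen) (c ⊔ ℓ) ℓ
    𝒦 = record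
      { stalk   = λ P → asSpace R (relations P)
      ; resHead = λ e → inclusion (inj₂ e) (inj₁ (head e)) (translators-head 𝒢 gen L e)
      ; resTail = λ e → inclusion (inj₂ e) (inj₁ (tail e)) (translators-tail 𝒢 gen L e)
      }

  -- Matrices are points of the affine space with coordinates Fin k × 𝒢.
  IsGenericMaximumExcess : ℕ → ℤ → Set _
  IsGenericMaximumExcess k = IsLargest λ n →
    ZariskiDense R {X = Fin k × Elt} λ x → let M = λ i g → x (i , g) in
      IsSurjective M × ∃[ e ] (IsMaximumExcess (𝒦 M) e × n ℤ.≤ e)

-- Granted excluded middle, a Heyting field is a field in the usual sense
-- (tightness makes # the negation of ≈, and 0# ≈ 1# contradicts invertible⇒#).
fieldRing : ∀ {c ℓ₁ ℓ₂} → HeytingField c ℓ₁ ℓ₂ → CommutativeRing c ℓ₁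
fieldRing 𝔽 = HeytingCommutativeRing.commutativeRing (HeytingField.heytingCommutativeRing 𝔽)

{-# OPTIONS --safe #-}

-- Write the excess of 𝒦_M(L) on a family of subspaces U_v ⊆ 𝔽^𝒢 as Σ dim Γ_e(U) - Σ dim U_v.  It is supermodular,
-- so there is a least maximizer, contained in all others.  For prescribed dimensions the matrices that admit a
-- family U form a constructible set (quantifier elimination over an algebraically closed field), and a constructible
-- set either contains a nonempty open set or misses one.  Hence a generic matrix M admits the same dimensions as its
-- translates by 𝒢, the dimensions of its least maximizer are constant along 𝒢, and the generic maximum excess is
-- divisible by |𝒢|.
--
-- Let M′ be a generic M without one of its rows.  Removing an edge of L costs at most |𝒢| in excess, as one
-- edge at each tail loses one translator.  So the claim holds if the maximum excess for (L , M′) is at least m + |𝒢|.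
-- Otherwise divisibility forces it to be m, as for M.  The least maximizer for M′ is then contained in every maximizer
-- for (M′ , r) with r a generic row, so it is orthogonal to every generic r and vanishes; thus m = 0, and the claim
-- is trivial.

module Submission where

open import Defs
open import Level using (Level; _⊔_; 0ℓ) renaming (suc to lsuc)
open import Algebra.Apartness.Bundles using (HeytingField)
open import Algebra.Bundles using (CommutativeMonoid; CommutativeRing; RawRing)
open import Algebra.Module.Bundles using (LeftModule)
import Algebra.Module.Construct.TensorUnit as TensorUnit
import Algebra.Properties.CommutativeMonoid.Sum as CommutativeMonoidSum
import Algebra.Properties.Ring as RingProperties
import Algebra.Properties.Semiring.Exp as SemiringExp
import Algebra.Properties.Semiring.Mult as SemiringMult
import Algebra.Properties.Semiring.Sum as SemiringSum
import Algebra.Solver.Ring as RingSolver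
open import Algebra.Solver.Ring.AlmostCommutativeRing
  using (fromCommutativeRing; _-Raw-AlmostCommutative⟶_)
open import Axiom.ExcludedMiddle using (ExcludedMiddle)
open import Data.Bool.Base using (T)
open import Data.Bool.Properties using (T-∧)
open import Data.Empty using (⊥; ⊥-elim)
open import Data.Fin.Base as Fin using (Fin; zero; suc; toℕ)
import Data.Fin.Properties as Fin
open import Data.Integer.Base as ℤ using (ℤ; _⊖_)
import Data.Integer.Properties as ℤ
open import Data.List.Base as List using (List; []; _∷_; _++_; length; map; allFin; tabulate; _∷ʳ_; reverse; take)
import Data.List.Properties as List
open import Data.List.Membership.Propositional using () renaming (_∈_ to _∈ˡ_)
import Data.List.Membership.Propositional.Properties as ∈ˡ
open import Data.List.Relation.Unary.All as All using (All; []; _∷_)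
import Data.List.Relation.Unary.All.Properties as All
open import Data.List.Relation.Unary.Any as Any using (Any; here; there)
import Data.List.Relation.Unary.Any.Properties as Any
open import Data.List.Relation.Unary.AllPairs using ([]; _∷_)
open import Data.List.Relation.Unary.Unique.Propositional using (Unique)
open import Data.Maybe.Base using (Maybe; just; nothing)
open import Data.Nat.Base as ℕ using (ℕ; zero; suc; _∸_; z≤n; s≤s)
import Data.Nat.Properties as ℕ
open import Data.Nat.ListAction using (sum)
open import Data.Product.Base using (Σ; ∃; ∃-syntax; _×_; _,_; proj₁; proj₂)
open import Data.Sum.Base as Sum using (_⊎_; inj₁; inj₂; [_,_]′)
open import Data.Unit.Polymorphic.Base using (⊤; tt)
open import Function.Base using (_∘_; id; case_of_)
open import Function.Bundles using (_↔_; Inverse; Equivalence; mk↔ₛ′)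
open import Relation.Binary.Definitions using (_Respects_)
open import Relation.Binary.PropositionalEquality as ≡ using (_≡_)
import Relation.Binary.Reasoning.Setoid as SetoidReasoning
open import Relation.Nullary.Decidable using (Dec; yes; no)
open import Relation.Nullary.Negation using (¬_)
open import Relation.Unary using (Pred; _∈_; _∉_; _⊆_)

-- Dense sets need not meet, but the argument imposes several conditions on one matrix. Density is
-- therefore traded for containing the nonvanishing locus of a nonzero polynomial, a property stable
-- under finite intersections because affine space is irreducible. The trade is made for
-- constructible sets, so the quantifier over families of subspaces has to become one over boundedly
-- many field elements: spanning vectors at the vertices and independent vectors at the edges. The
-- number |𝒢| enters twice, and the two uses match: it bounds the loss of excess when an edge is
-- removed, and it is the modulus of the excess. Hence an excess for M′ that is larger than m at all
-- is large enough to pay for the loss. Maximizers for (M′ , r) and for M′ can be compared because a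
-- further row only adds a condition on the family. Surjectivity is a separate obstacle: deleting a
-- row may not compensate for a lost column. It is reached by another map from k rows to k - 1 rows,
-- the projection of the columns along the lost one.

-- A solver for identities in commutative rings

module DifferenceSolver {c ℓ} (R : CommutativeRing c ℓ) where

  private
    ACR = fromCommutativeRing R

  open CommutativeRing R
  open SemiringMult semiring using (×-homo-+; ×1-homo-*) renaming (_×_ to _·_)
  open RingProperties ring using (-‿distribˡ-*; -‿distribʳ-*; -‿involutive; -0#≈0#)
  open import Algebra.Properties.AbelianGroup +-abelianGroup using (⁻¹-∙-comm; ⁻¹-anti-homo‿-)
  open SetoidReasoning setoid
  open import Algebra.Properties.CommutativeSemigroup +-commutativeSemigroup using (interchange)

  private
    ⟪_⟫ : ℕ → Carrier
    ⟪ n ⟫ = n · 1#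

    -- A pair (m , n) of naturals denotes the integer m - n.
    differences : RawRing 0ℓ 0ℓ
    differences = record
      { Carrier = ℕ × ℕ
      ; _≈_ = λ (a , b) (a′ , b′) → a ℕ.+ b′ ≡ a′ ℕ.+ b
      ; _+_ = λ (a , b) (a′ , b′) → a ℕ.+ a′ , b ℕ.+ b′
      ; _*_ = λ (a , b) (a′ , b′) → a ℕ.* a′ ℕ.+ b ℕ.* b′ , a ℕ.* b′ ℕ.+ b ℕ.* a′
      ; -_  = λ (a , b) → b , a
      ; 0#  = 0 , 0
      ; 1#  = 1 , 0
      }

    difference-+ : ∀ x y z w → (x + y) - (z + w) ≈ (x - z) + (y - w)
    difference-+ x y z w = trans (+-congˡ (sym (⁻¹-∙-comm z w))) (interchange x y (- z) (- w))

    difference-* : ∀ x y z w → (x * z + y * w) - (x * w + y * z) ≈ (x - y) * (z - w)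
    difference-* x y z w = begin
      (x * z + y * w) - (x * w + y * z)             ≈⟨ difference-+ _ _ _ _ ⟩
      (x * z - x * w) + (y * w - y * z)
        ≈⟨ +-cong (+-congˡ (-‿distribʳ-* x w)) (+-cong (sym (-‿involutive _)) (-‿distribˡ-* y z)) ⟩
      (x * z + x * - w) + (- - (y * w) + - y * z)
        ≈⟨ +-congˡ (+-congʳ (trans (-‿cong (-‿distribˡ-* y w)) (-‿distribʳ-* (- y) w))) ⟩
      (x * z + x * - w) + (- y * - w + - y * z)     ≈⟨ +-cong (sym (distribˡ x z (- w))) (+-comm _ _) ⟩
      x * (z - w) + (- y * z + - y * - w)           ≈⟨ +-congˡ (sym (distribˡ (- y) z (- w))) ⟩
      x * (z - w) + - y * (z - w)                   ≈⟨ sym (distribʳ (z - w) x (- y)) ⟩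
      (x - y) * (z - w)                             ∎

    ⟪+⟫ : ∀ m n → ⟪ m ℕ.+ n ⟫ ≈ ⟪ m ⟫ + ⟪ n ⟫
    ⟪+⟫ = ×-homo-+ 1#

    ⟪*+*⟫ : ∀ a b a′ b′ → ⟪ a ℕ.* a′ ℕ.+ b ℕ.* b′ ⟫ ≈ ⟪ a ⟫ * ⟪ a′ ⟫ + ⟪ b ⟫ * ⟪ b′ ⟫
    ⟪*+*⟫ a b a′ b′ = trans (⟪+⟫ (a ℕ.* a′) (b ℕ.* b′)) (+-cong (×1-homo-* a a′) (×1-homo-* b b′))

    minus-0 : ∀ x → x - 0# ≈ x
    minus-0 x = trans (+-congˡ -0#≈0#) (+-identityʳ x)

    -- The first two clauses make the literals 0 and 1 denote 0# and 1# definitionally.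
    value : ℕ × ℕ → Carrier
    value (0 , 0) = 0#
    value (1 , 0) = 1#
    value (a , b) = ⟪ a ⟫ - ⟪ b ⟫

    unfold : ∀ a b → value (a , b) ≈ ⟪ a ⟫ - ⟪ b ⟫
    unfold 0             0       = sym (minus-0 0#)
    unfold 1             0       = sym (trans (minus-0 _) (+-identityʳ 1#))
    unfold (suc (suc a)) 0       = refl
    unfold 0             (suc b) = refl
    unfold 1             (suc b) = refl
    unfold (suc (suc a)) (suc b) = refl

    homo : differences -Raw-AlmostCommutative⟶ ACR
    homo = record
      { ⟦_⟧    = value
      ; +-homo = λ (a , b) (a′ , b′) → trans (unfold (a ℕ.+ a′) (b ℕ.+ b′))
          (trans (+-cong (⟪+⟫ a a′) (-‿cong (⟪+⟫ b b′)))
          (trans (difference-+ _ _ _ _) (sym (+-cong (unfold a b) (unfold a′ b′)))))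
      ; *-homo = λ (a , b) (a′ , b′) → trans (unfold (a ℕ.* a′ ℕ.+ b ℕ.* b′) (a ℕ.* b′ ℕ.+ b ℕ.* a′))
          (trans (+-cong (⟪*+*⟫ a b a′ b′) (-‿cong (⟪*+*⟫ a b b′ a′)))
          (trans (difference-* _ _ _ _) (sym (*-cong (unfold a b) (unfold a′ b′)))))
      ; -‿homo = λ (a , b) → trans (unfold b a) (trans (sym (⁻¹-anti-homo‿- _ _)) (-‿cong (sym (unfold a b))))
      ; 0-homo = refl
      ; 1-homo = refl
      }

    -- Equal integers have equal images in every characteristic. Different integers may still have
    -- equal images, hence `nothing` instead of a refutation.
    equal? : ∀ p q → Maybe (value p ≈ value q)
    equal? (a , b) (a′ , b′) with a ℕ.+ b′ ℕ.≟ a′ ℕ.+ b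
    ... | no  _  = nothing
    ... | yes eq = just (begin
      value (a , b)                                ≈⟨ unfold a b ⟩
      ⟪ a ⟫ - ⟪ b ⟫                            ≈⟨ sym (+-identityʳ _) ⟩
      (⟪ a ⟫ - ⟪ b ⟫) + 0#                     ≈⟨ +-congˡ (sym (-‿inverseʳ ⟪ b′ ⟫)) ⟩
      (⟪ a ⟫ - ⟪ b ⟫) + (⟪ b′ ⟫ - ⟪ b′ ⟫)      ≈⟨ sym (difference-+ _ _ _ _) ⟩
      (⟪ a ⟫ + ⟪ b′ ⟫) - (⟪ b ⟫ + ⟪ b′ ⟫)
        ≈⟨ +-cong (trans (sym (⟪+⟫ a b′)) (trans (reflexive (≡.cong ⟪_⟫ eq)) (⟪+⟫ a′ b)))
                  (-‿cong (+-comm _ _)) ⟩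
      (⟪ a′ ⟫ + ⟪ b ⟫) - (⟪ b′ ⟫ + ⟪ b ⟫)      ≈⟨ difference-+ _ _ _ _ ⟩
      (⟪ a′ ⟫ - ⟪ b′ ⟫) + (⟪ b ⟫ - ⟪ b ⟫)      ≈⟨ +-congˡ (-‿inverseʳ ⟪ b ⟫) ⟩
      (⟪ a′ ⟫ - ⟪ b′ ⟫) + 0#                   ≈⟨ +-identityʳ _ ⟩
      ⟪ a′ ⟫ - ⟪ b′ ⟫                          ≈⟨ unfold a′ b′ ⟨
      value (a′ , b′)                              ∎)

  open RingSolver differences ACR homo equal? public
    using (solve; _:=_; con; _:+_; _:*_; :-_; _:-_) renaming (Polynomial to Term)

-- Fields

record IsField {c ℓ} (R : CommutativeRing c ℓ) : Set (c ⊔ ℓ) where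
  open CommutativeRing R
  field
    inverse : ∀ {x} → ¬ (x ≈ 0#) → ∃[ y ] (y * x ≈ 1#)
    1≉0     : ¬ (1# ≈ 0#)

-- A Heyting field inverts the difference of two apart elements, so it is applied to `x` and `0#`;
-- tightness and excluded middle turn inequality into apartness.
fieldRing-isField : (em : ∀ {a} → ExcludedMiddle a) → ∀ {c ℓ₁ ℓ₂} (𝔽 : HeytingField c ℓ₁ ℓ₂) → IsField (fieldRing 𝔽)
fieldRing-isField em 𝔽 = record { inverse = inverse ; 1≉0 = 1≉0 }
  where
  open HeytingField 𝔽
  open RingProperties (CommutativeRing.ring (fieldRing 𝔽)) using (-0#≈0#)

  minus-0 : ∀ x → x - 0# ≈ x
  minus-0 x = trans (+-congˡ -0#≈0#) (+-identityʳ x)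

  inverse : ∀ {x} → ¬ (x ≈ 0#) → ∃[ y ] (y * x ≈ 1#)
  inverse {x} x≉0 with em {P = x # 0#}
  ... | no ¬x#0 = ⊥-elim (x≉0 (proj₁ (tight x 0#) ¬x#0))
  ... | yes x#0 with #⇒invertible x#0
  ...   | y , y*x≈1 , _ = y , trans (*-congˡ (sym (minus-0 x))) y*x≈1

  1≉0 : ¬ (1# ≈ 0#)
  1≉0 1≈0 = proj₂ (tight 1# 0#) 1≈0
    (invertible⇒# (1# , trans (*-identityˡ _) (minus-0 1#) , trans (*-identityʳ _) (minus-0 1#)))

module FieldTheory (em : ∀ {a} → ExcludedMiddle a) {c ℓ₁} (R : CommutativeRing c ℓ₁) (isField : IsField R) where

  open CommutativeRing R hiding (zero) renaming (Carrier to F)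
  open IsField isField public

  byContradiction : ∀ {a} {P : Set a} → (¬ P → ⊥) → P
  byContradiction {P = P} ¬¬p with em {P = P}
  ... | yes p = p
  ... | no ¬p = ⊥-elim (¬¬p ¬p)

  *-≉0 : ∀ {x y} → ¬ (x ≈ 0#) → ¬ (y ≈ 0#) → ¬ (x * y ≈ 0#)
  *-≉0 {x} {y} x≉0 y≉0 xy≈0 with inverse x≉0
  ... | z , zx≈1 = y≉0 (trans (sym (*-identityˡ y)) (trans (*-congʳ (sym zx≈1))
        (trans (*-assoc z x y) (trans (*-congˡ xy≈0) (zeroʳ z)))))

  *-≈0 : ∀ {x y} → x * y ≈ 0# → (x ≈ 0#) ⊎ (y ≈ 0#)
  *-≈0 {x} {y} xy≈0 with em {P = x ≈ 0#}
  ... | yes x≈0 = inj₁ x≈0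
  ... | no  x≉0 = inj₂ (byContradiction λ y≉0 → *-≉0 x≉0 y≉0 xy≈0)


-- Linear algebra modulo a subspace: span, independence, dimension

module LinearAlgebra (em : ∀ {a} → ExcludedMiddle a) {c ℓ₁} (R : CommutativeRing c ℓ₁) (isField : IsField R)
                     {m ℓm} (W : VectorSpace R m ℓm) where


  open CommutativeRing R using (0#; 1#; -_; -‿inverseʳ) renaming (Carrier to F; _≈_ to _≈F_; _+_ to _+F_; _*_ to _*F_)
  open FieldTheory em R isField
  open LeftModule W
  open import Algebra.Properties.CommutativeSemigroup
    (CommutativeMonoid.commutativeSemigroup +ᴹ-commutativeMonoid)
    using (interchange)
  open SetoidReasoning (CommutativeMonoid.setoid +ᴹ-commutativeMonoid)
  open Subspace

  *ₗ-cancel : ∀ a v w → (a *ₗ v +ᴹ (w +ᴹ (- a) *ₗ v)) ≈ᴹ w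
  *ₗ-cancel a v w = begin
    a *ₗ v +ᴹ (w +ᴹ (- a) *ₗ v)     ≈⟨ +ᴹ-congˡ (+ᴹ-comm w _) ⟩
    a *ₗ v +ᴹ ((- a) *ₗ v +ᴹ w)     ≈⟨ +ᴹ-assoc _ _ w ⟨
    a *ₗ v +ᴹ (- a) *ₗ v +ᴹ w       ≈⟨ +ᴹ-congʳ (*ₗ-distribʳ v a (- a)) ⟨
    (a +F - a) *ₗ v +ᴹ w            ≈⟨ +ᴹ-congʳ (*ₗ-congʳ (-‿inverseʳ a)) ⟩
    0# *ₗ v +ᴹ w                    ≈⟨ +ᴹ-congʳ (*ₗ-zeroˡ v) ⟩
    0ᴹ +ᴹ w                         ≈⟨ +ᴹ-identityˡ w ⟩
    w                               ∎

  private variable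
    p q r : Level
    v w : Carrierᴹ
    us vs ws : List Carrierᴹ

  Zero : Subspace R W ℓm
  Zero = record
    { Member = λ w → w ≈ᴹ 0ᴹ
    ; resp   = λ v≈w v≈0 → ≈ᴹ-trans (≈ᴹ-sym v≈w) v≈0
    ; 0-mem  = ≈ᴹ-refl
    ; +-mem  = λ v≈0 w≈0 → ≈ᴹ-trans (+ᴹ-cong v≈0 w≈0) (+ᴹ-identityˡ 0ᴹ)
    ; *ₗ-mem = λ a v≈0 → ≈ᴹ-trans (*ₗ-congˡ v≈0) (*ₗ-zeroʳ a)
    }

  Zero-least : (S : Subspace R W p) → Member Zero ⊆ Member S
  Zero-least S w≈0 = resp S (≈ᴹ-sym w≈0) (0-mem S)

  -- Span modulo the subspace `K`. Keeping `K` as a parameter allows computations in a quotient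
  -- without forming it, so that bases can be assembled along chains of subspaces.
  data Spanned (K : Pred Carrierᴹ p) : List Carrierᴹ → Pred Carrierᴹ (c ⊔ m ⊔ ℓm ⊔ p) where
    base : K w → Spanned K [] w
    step : ∀ a {u} → Spanned K vs u → w ≈ᴹ a *ₗ v +ᴹ u → Spanned K (v ∷ vs) w

  Span : Subspace R W p → List Carrierᴹ → Subspace R W (c ⊔ m ⊔ ℓm ⊔ p)
  Span {p} K vs = record
    { Member = Spanned (Member K) vs
    ; resp   = resp′
    ; 0-mem  = zero′ vs
    ; +-mem  = plus′
    ; *ₗ-mem = λ a → scale′ a
    }
    where
    resp′ : Spanned (Member K) us Respects _≈ᴹ_
    resp′ v≈w (base k)     = base (resp K v≈w k)
    resp′ v≈w (step a s eq) = step a s (≈ᴹ-trans (≈ᴹ-sym v≈w) eq)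

    zero′ : ∀ us → Spanned (Member K) us 0ᴹ
    zero′ []       = base (0-mem K)
    zero′ (u ∷ us) = step 0# (zero′ us) (≈ᴹ-sym (≈ᴹ-trans (+ᴹ-congʳ (*ₗ-zeroˡ u)) (+ᴹ-identityˡ 0ᴹ)))

    plus′ : Spanned (Member K) us v → Spanned (Member K) us w → Spanned (Member K) us (v +ᴹ w)
    plus′ (base k) (base k′) = base (+-mem K k k′)
    plus′ (step {v = x} a {u} s eq) (step b {u′} s′ eq′) = step (a +F b) (plus′ s s′)
      (≈ᴹ-trans (+ᴹ-cong eq eq′) (≈ᴹ-trans (interchange (a *ₗ x) u (b *ₗ x) u′) (+ᴹ-congʳ (≈ᴹ-sym (*ₗ-distribʳ x a b)))))

    scale′ : ∀ a → Spanned (Member K) us v → Spanned (Member K) us (a *ₗ v)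
    scale′ a (base k) = base (*ₗ-mem K a k)
    scale′ a (step {v = x} b {u} s eq) = step (a *F b) (scale′ a s)
      (≈ᴹ-trans (*ₗ-congˡ eq) (≈ᴹ-trans (*ₗ-distribˡ a (b *ₗ x) u) (+ᴹ-congʳ (≈ᴹ-sym (*ₗ-assoc a b x)))))

  span-weaken : (K : Subspace R W p) → Spanned (Member K) vs ⊆ Spanned (Member K) (v ∷ vs)
  span-weaken {v = v} K s = step 0# s (≈ᴹ-sym (≈ᴹ-trans (+ᴹ-congʳ (*ₗ-zeroˡ v)) (+ᴹ-identityˡ _)))

  span-base : (K : Subspace R W p) → ∀ vs → Member K ⊆ Spanned (Member K) vs
  span-base K []       k = base k
  span-base K (v ∷ vs) k = span-weaken K (span-base K vs k)

  span-head : (K : Subspace R W p) → ∀ v vs → Spanned (Member K) (v ∷ vs) v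
  span-head K v vs = step 1# (0-mem (Span K vs)) (≈ᴹ-sym (≈ᴹ-trans (+ᴹ-identityʳ _) (*ₗ-identityˡ v)))

  span-generators : (K : Subspace R W p) → ∀ vs → All (Spanned (Member K) vs) vs
  span-generators K []       = []
  span-generators K (v ∷ vs) = span-head K v vs ∷ All.map (span-weaken K) (span-generators K vs)

  span-least : (K : Subspace R W p) (S : Subspace R W q) →
               Member K ⊆ Member S → All (Member S) vs → Spanned (Member K) vs ⊆ Member S
  span-least K S K⊆S _          (base k)     = K⊆S k
  span-least K S K⊆S (v∈ ∷ vs∈) (step a s eq) =
    resp S (≈ᴹ-sym eq) (+-mem S (*ₗ-mem S a v∈) (span-least K S K⊆S vs∈ s))

  span-mono : (K : Subspace R W p) (K′ : Subspace R W q) → Member K ⊆ Member K′ →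
              ∀ vs → Spanned (Member K) vs ⊆ Spanned (Member K′) vs
  span-mono K K′ K⊆K′ vs =
    span-least K (Span K′ vs) (λ k → span-base K′ vs (K⊆K′ k)) (span-generators K′ vs)

  span-++⁺ : (K : Subspace R W p) → Spanned (Spanned (Member K) us) vs ⊆ Spanned (Member K) (vs ++ us)
  span-++⁺ K (base s)      = s
  span-++⁺ K (step a s eq) = step a (span-++⁺ K s) eq

  span-++⁻ : (K : Subspace R W p) → ∀ vs → Spanned (Member K) (vs ++ us) ⊆ Spanned (Spanned (Member K) us) vs
  span-++⁻ K []       s             = base s
  span-++⁻ K (v ∷ vs) (step a s eq) = step a (span-++⁻ K vs s) eq

  -- Prepares the induction of `steinitz`, where spanning vectors are absorbed one at a time into
  -- the base subspace.
  span-rotate⁺ : (K : Subspace R W p) → Spanned (Spanned (Member K) (w ∷ [])) vs ⊆ Spanned (Member K) (w ∷ vs)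
  span-rotate⁺ {w = w} {vs} K = span-least (Span K (w ∷ [])) (Span K (w ∷ vs))
    (span-least K (Span K (w ∷ vs)) (span-base K (w ∷ vs)) (span-head K w vs ∷ []))
    (All.map (span-weaken K) (span-generators K vs))

  span-rotate⁻ : (K : Subspace R W p) → Spanned (Member K) (w ∷ vs) ⊆ Spanned (Spanned (Member K) (w ∷ [])) vs
  span-rotate⁻ {w = w} {vs} K = span-least K (Span K+w vs)
    (λ k → span-base K+w vs (span-base K (w ∷ []) k))
    (span-base K+w vs (span-head K w []) ∷ span-generators K+w vs)
    where K+w = Span K (w ∷ [])

  solve-head : ∀ {a b u} → b *F a ≈F 1# → v ≈ᴹ a *ₗ w +ᴹ u → w ≈ᴹ b *ₗ v +ᴹ (- b) *ₗ u
  solve-head {v = v} {w} {a} {b} {u} ba≈1 eq = ≈ᴹ-sym (begin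
    b *ₗ v +ᴹ (- b) *ₗ u                       ≈⟨ +ᴹ-congʳ (*ₗ-congˡ eq) ⟩
    b *ₗ (a *ₗ w +ᴹ u) +ᴹ (- b) *ₗ u           ≈⟨ +ᴹ-congʳ (*ₗ-distribˡ b _ u) ⟩
    b *ₗ a *ₗ w +ᴹ b *ₗ u +ᴹ (- b) *ₗ u        ≈⟨ +ᴹ-assoc _ _ _ ⟩
    b *ₗ a *ₗ w +ᴹ (b *ₗ u +ᴹ (- b) *ₗ u)      ≈⟨ +ᴹ-cong (≈ᴹ-sym (*ₗ-assoc b a w)) (≈ᴹ-sym (*ₗ-distribʳ u b (- b))) ⟩
    (b *F a) *ₗ w +ᴹ (b +F - b) *ₗ u           ≈⟨ +ᴹ-cong (*ₗ-congʳ ba≈1) (*ₗ-congʳ (-‿inverseʳ b)) ⟩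
    1# *ₗ w +ᴹ 0# *ₗ u                         ≈⟨ +ᴹ-cong (*ₗ-identityˡ w) (*ₗ-zeroˡ u) ⟩
    w +ᴹ 0ᴹ                                    ≈⟨ +ᴹ-identityʳ w ⟩
    w                                          ∎)

  span-exchange : (K : Subspace R W p) →
                  Spanned (Member K) (w ∷ vs) v → ¬ Spanned (Member K) vs v → Spanned (Member K) (v ∷ vs) w
  span-exchange {w = w} {v = v} K (step a {u} s eq) v∉ with em {P = a ≈F 0#}
  ... | yes a≈0 = ⊥-elim (v∉ (resp (Span K _)
          (≈ᴹ-sym (≈ᴹ-trans eq (≈ᴹ-trans (+ᴹ-congʳ (≈ᴹ-trans (*ₗ-congʳ a≈0) (*ₗ-zeroˡ w))) (+ᴹ-identityˡ u)))) s))
  ... | no a≉0 with inverse a≉0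
  ...   | b , ba≈1 = step b (*ₗ-mem (Span K _) (- b) s) (solve-head ba≈1 eq)

  data Independent (K : Pred Carrierᴹ p) : List Carrierᴹ → Set (c ⊔ m ⊔ ℓm ⊔ p) where
    []  : Independent K []
    _∷_ : ¬ Spanned K vs v → Independent K vs → Independent K (v ∷ vs)

  independent-anti : (K : Subspace R W p) (K′ : Subspace R W q) → Member K ⊆ Member K′ →
                     Independent (Member K′) vs → Independent (Member K) vs
  independent-anti K K′ K⊆K′ []         = []
  independent-anti K K′ K⊆K′ (v∉ ∷ ind) = (λ s → v∉ (span-mono K K′ K⊆K′ _ s)) ∷ independent-anti K K′ K⊆K′ ind

  independent-++ : (K : Subspace R W p) → Independent (Spanned (Member K) us) vs → Independent (Member K) us →
                   Independent (Member K) (vs ++ us)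
  independent-++ K []         ind′ = ind′
  independent-++ K (v∉ ∷ ind) ind′ = (λ s → v∉ (span-++⁻ K _ s)) ∷ independent-++ K ind ind′

  private
    Adjoined : Subspace R W p → Carrierᴹ → List Carrierᴹ → Set _
    Adjoined K w vs = Independent (Spanned (Member K) (w ∷ [])) vs ⊎
      (∃[ vs′ ] (length vs ≡ suc (length vs′)
               × Independent (Spanned (Member K) (w ∷ [])) vs′
               × Spanned (Member K) vs ⊆ Spanned (Spanned (Member K) (w ∷ [])) vs′
               × Spanned (Spanned (Member K) (w ∷ [])) vs′ ⊆ Spanned (Member K) vs))

  -- Enlarging the base by `w` costs at most one vector: the first one, counted from the end of the
  -- list, that becomes dependent. By exchange it may be replaced by `w`, so the span is the same as
  -- before, and this equality keeps all vectors added afterwards independent.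
  independent-adjoin : (K : Subspace R W p) → ∀ w → Independent (Member K) vs → Adjoined K w vs
  independent-adjoin K w [] = inj₁ []
  independent-adjoin {vs = v ∷ vs} K w (v∉ ∷ ind) with independent-adjoin K w ind
  ... | inj₂ (vs′ , eq , ind′ , to , from) = inj₂
        ( v ∷ vs′ , ≡.cong suc eq , (λ s → v∉ (from s)) ∷ ind′
        , (λ { (step a s e) → step a (to s) e }) , (λ { (step a s e) → step a (from s) e }))
  ... | inj₁ ind′ with em {P = Spanned (Spanned (Member K) (w ∷ [])) vs v}
  ...   | no v∉′ = inj₁ (v∉′ ∷ ind′)
  ...   | yes v∈′ = inj₂ (vs , ≡.refl , ind′
        , span-least K (Span K+w vs) (λ k → span-base K+w vs (span-base K (w ∷ []) k)) (v∈′ ∷ span-generators K+w vs)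
        , (λ s → span-least K (Span K (v ∷ vs)) (span-base K (v ∷ vs))
                   (span-exchange K (span-rotate⁺ K v∈′) v∉ ∷ All.map (span-weaken K) (span-generators K vs))
                   (span-rotate⁺ K s)))
    where K+w = Span K (w ∷ [])

  -- Induction on the spanning list: its head moves into the base subspace, and `independent-adjoin`
  -- says that this removes at most one of the independent vectors.
  steinitz : ∀ ws (K : Subspace R W p) → Independent (Member K) vs → All (Spanned (Member K) ws) vs →
             length vs ℕ.≤ length ws
  steinitz [] K [] [] = z≤n
  steinitz [] K (v∉ ∷ _) (base v∈ ∷ _) = ⊥-elim (v∉ (span-base K _ v∈))
  steinitz (w ∷ ws) K ind vs∈ with independent-adjoin K w ind
  ... | inj₁ ind′ = ℕ.m≤n⇒m≤1+n (steinitz ws (Span K (w ∷ [])) ind′ (All.map (span-rotate⁻ K) vs∈))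
  ... | inj₂ (vs′ , eq , ind′ , _ , from) rewrite eq =
        s≤s (steinitz ws (Span K (w ∷ [])) ind′ (All.map within (span-generators (Span K (w ∷ [])) vs′)))
    where
    within : ∀ {v} → Spanned (Spanned (Member K) (w ∷ [])) vs′ v → Spanned (Spanned (Member K) (w ∷ [])) ws v
    within s = span-rotate⁻ K (span-least K (Span K (w ∷ ws)) (span-base K _) vs∈ (from s))

  IsBasis : Pred Carrierᴹ p → Pred Carrierᴹ q → List Carrierᴹ → Set (c ⊔ m ⊔ ℓm ⊔ p ⊔ q)
  IsBasis K S vs = Independent K vs × All S vs × S ⊆ Spanned K vs

  independent-≤-basis : (K : Subspace R W p) (S : Subspace R W q) → IsBasis (Member K) (Member S) vs →
                        Independent (Member K) us → All (Member S) us → length us ℕ.≤ length vs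
  independent-≤-basis K S (_ , _ , spans) ind us∈ = steinitz _ K ind (All.map spans us∈)

  basis-≤-span : (K : Subspace R W p) (S : Subspace R W q) → IsBasis (Member K) (Member S) vs →
                 Member S ⊆ Spanned (Member K) us → length vs ℕ.≤ length us
  basis-≤-span K S (ind , vs∈ , _) S⊆ = steinitz _ K ind (All.map S⊆ vs∈)

  abstract
    basis-exists : (K : Subspace R W p) (S : Subspace R W q) → ∀ ws →
                   Member S ⊆ Spanned (Member K) ws → ∃ (IsBasis (Member K) (Member S))
    -- The fuel bounds the number of vectors that can still be added; an independent list that
    -- outlives it would be longer than `ws`, against `steinitz`.
    basis-exists K S ws S⊆ = grow (suc (length ws)) [] [] [] (ℕ.m≤n⇒m≤n+o 0 ℕ.≤-refl)
      where
      grow : ∀ fuel vs → Independent (Member K) vs → All (Member S) vs →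
             suc (length ws) ℕ.≤ fuel ℕ.+ length vs → ∃ (IsBasis (Member K) (Member S))
      grow fuel vs ind vs∈ enough with em {P = Member S ⊆ Spanned (Member K) vs}
      ... | yes spans = vs , ind , vs∈ , spans
      grow zero vs ind vs∈ enough | no ¬spans =
        ⊥-elim (ℕ.<⇒≱ enough (steinitz ws K ind (All.map S⊆ vs∈)))
      grow (suc fuel) vs ind vs∈ enough | no ¬spans with em {P = ∃[ v ] (Member S v × ¬ Spanned (Member K) vs v)}
      ... | yes (v , v∈ , v∉) = grow fuel (v ∷ vs) (v∉ ∷ ind) (v∈ ∷ vs∈)
              (≡.subst (suc (length ws) ℕ.≤_) (≡.sym (ℕ.+-suc fuel (length vs))) enough)
      ... | no none = ⊥-elim (¬spans λ {v} v∈ → byContradiction λ v∉ → none (v , v∈ , v∉))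

  -- Dimension is additive along the chain `J` ⊆ `K` ⊆ `S`.
  basis-++ : (J : Subspace R W p) (K : Subspace R W q) {S : Pred Carrierᴹ r} →
             Member J ⊆ Member K → Member K ⊆ S →
             IsBasis (Member J) (Member K) us → IsBasis (Member K) S vs → IsBasis (Member J) S (vs ++ us)
  basis-++ {us = us} J K J⊆K K⊆S (indJ , us∈ , spanJ) (ind , vs∈ , spans) =
      independent-++ J (independent-anti (Span J us) K (span-least J K J⊆K us∈) ind) indJ
    , All.++⁺ vs∈ (All.map K⊆S us∈)
    , λ s → span-++⁺ J (span-mono K (Span J us) spanJ _ (spans s))

  infixr 6 _∩ˢ_ _+ˢ_

  _∩ˢ_ : Subspace R W p → Subspace R W q → Subspace R W (p ⊔ q)
  A ∩ˢ B = record
    { Member = λ w → Member A w × Member B w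
    ; resp   = λ v≈w (a , b) → resp A v≈w a , resp B v≈w b
    ; 0-mem  = 0-mem A , 0-mem B
    ; +-mem  = λ (a , b) (a′ , b′) → +-mem A a a′ , +-mem B b b′
    ; *ₗ-mem = λ r (a , b) → *ₗ-mem A r a , *ₗ-mem B r b
    }

  _+ˢ_ : Subspace R W p → Subspace R W q → Subspace R W (m ⊔ ℓm ⊔ p ⊔ q)
  A +ˢ B = record
    { Member = λ w → ∃[ a ] ∃[ b ] (Member A a × Member B b × w ≈ᴹ a +ᴹ b)
    ; resp   = λ v≈w (a , b , a∈ , b∈ , eq) → a , b , a∈ , b∈ , ≈ᴹ-trans (≈ᴹ-sym v≈w) eq
    ; 0-mem  = 0ᴹ , 0ᴹ , 0-mem A , 0-mem B , ≈ᴹ-sym (+ᴹ-identityˡ 0ᴹ)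
    ; +-mem  = λ (a , b , a∈ , b∈ , eq) (a′ , b′ , a∈′ , b∈′ , eq′) →
        a +ᴹ a′ , b +ᴹ b′ , +-mem A a∈ a∈′ , +-mem B b∈ b∈′ , ≈ᴹ-trans (+ᴹ-cong eq eq′) (interchange a b a′ b′)
    ; *ₗ-mem = λ r (a , b , a∈ , b∈ , eq) →
        r *ₗ a , r *ₗ b , *ₗ-mem A r a∈ , *ₗ-mem B r b∈ , ≈ᴹ-trans (*ₗ-congˡ eq) (*ₗ-distribˡ r a b)
    }

  +ˢ-left : (A : Subspace R W p) (B : Subspace R W q) → Member A ⊆ Member (A +ˢ B)
  +ˢ-left A B {a} a∈ = a , 0ᴹ , a∈ , 0-mem B , ≈ᴹ-sym (+ᴹ-identityʳ a)

  +ˢ-right : (A : Subspace R W p) (B : Subspace R W q) → Member B ⊆ Member (A +ˢ B)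
  +ˢ-right A B {b} b∈ = 0ᴹ , b , 0-mem A , b∈ , ≈ᴹ-sym (+ᴹ-identityˡ b)

  -- The second isomorphism theorem on the level of bases: one list serves for A/(A ∩ B) and for (A
  -- + B)/B. Together with `basis-++` this yields the modular law for dimensions.
  basis-second-iso : (A : Subspace R W p) (B : Subspace R W q) →
                     IsBasis (Member (A ∩ˢ B)) (Member A) vs → IsBasis (Member B) (Member (A +ˢ B)) vs
  basis-second-iso {vs = vs} A B (ind , vs∈ , spans) =
      go ind vs∈
    , All.map (+ˢ-left A B) vs∈
    , λ (a , b , a∈ , b∈ , eq) → resp (Span B vs) (≈ᴹ-sym eq)
        (+-mem (Span B vs) (span-mono (A ∩ˢ B) B proj₂ vs (spans a∈)) (span-base B vs b∈))
    where
    cancel : ∀ {v a u} → v ≈ᴹ a +ᴹ u → u ≈ᴹ v +ᴹ (- 1#) *ₗ a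
    cancel {v} {a} {u} eq = ≈ᴹ-sym (begin
      v +ᴹ (- 1#) *ₗ a          ≈⟨ +ᴹ-cong (≈ᴹ-trans eq (+ᴹ-comm a u)) (neg-as-scalar R W a) ⟩
      (u +ᴹ a) +ᴹ (-ᴹ a)        ≈⟨ +ᴹ-assoc u a _ ⟩
      u +ᴹ (a +ᴹ (-ᴹ a))        ≈⟨ +ᴹ-congˡ (proj₂ -ᴹ‿inverse a) ⟩
      u +ᴹ 0ᴹ                   ≈⟨ +ᴹ-identityʳ u ⟩
      u                         ∎)

    -- If a member of `A` is a combination of members of `A` up to an error in `B`, then the error
    -- is a difference of members of `A`.
    back : ∀ {us} → All (Member A) us → Member A v → Spanned (Member B) us v → Spanned (Member (A ∩ˢ B)) us v
    back []         v∈ (base b)      = base (v∈ , b)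
    back (u∈ ∷ us∈) v∈ (step a s eq) = step a
      (back us∈ (resp A (≈ᴹ-sym (cancel eq)) (+-mem A v∈ (*ₗ-mem A (- 1#) (*ₗ-mem A a u∈)))) s) eq

    go : ∀ {us} → Independent (Member (A ∩ˢ B)) us → All (Member A) us → Independent (Member B) us
    go []          []         = []
    go (v∉ ∷ ind′) (u∈ ∷ us∈) = (λ s → v∉ (back us∈ u∈ s)) ∷ go ind′ us∈

  module Dimension (gens : List Carrierᴹ) (generate : ∀ w → Spanned (Member Zero) gens w) where

    basis : (S : Subspace R W p) → ∃ (IsBasis (Member Zero) (Member S))
    basis S = basis-exists Zero S gens (λ {w} _ → generate w)

    dim : Subspace R W p → ℕ
    dim S = length (proj₁ (basis S))

    independent-≤-dim : (S : Subspace R W p) → Independent (Member Zero) vs → All (Member S) vs → length vs ℕ.≤ dim S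
    independent-≤-dim S = independent-≤-basis Zero S (proj₂ (basis S))

    dim-≤-span : (S : Subspace R W p) → Member S ⊆ Spanned (Member Zero) vs → dim S ℕ.≤ length vs
    dim-≤-span S = basis-≤-span Zero S (proj₂ (basis S))

    dim-unique : (S : Subspace R W p) → IsBasis (Member Zero) (Member S) vs → dim S ≡ length vs
    dim-unique S (ind , vs∈ , spans) = ℕ.≤-antisym (dim-≤-span S spans) (independent-≤-dim S ind vs∈)

    dim-mono : (S : Subspace R W p) (S′ : Subspace R W q) → Member S ⊆ Member S′ → dim S ℕ.≤ dim S′
    dim-mono S S′ S⊆S′ with basis S
    ... | vs , ind , vs∈ , _ = independent-≤-dim S′ ind (All.map S⊆S′ vs∈)

    dim-modular : (A : Subspace R W p) (B : Subspace R W q) →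
                  dim (A +ˢ B) ℕ.+ dim (A ∩ˢ B) ≡ dim A ℕ.+ dim B
    dim-modular A B with basis-exists (A ∩ˢ B) A gens
                           (λ {w} _ → span-mono Zero (A ∩ˢ B) (Zero-least (A ∩ˢ B)) gens (generate w))
    ... | vs , vs-basis = ≡.trans (≡.cong₂ ℕ._+_ dim+ ≡.refl)
          (≡.trans (ℕ.+-assoc (length vs) (dim B) (dim (A ∩ˢ B)))
          (≡.trans (≡.cong (length vs ℕ.+_) (ℕ.+-comm (dim B) (dim (A ∩ˢ B))))
          (≡.trans (≡.sym (ℕ.+-assoc (length vs) (dim (A ∩ˢ B)) (dim B)))
                   (≡.cong (ℕ._+ dim B) (≡.sym dimA)))))
      where
      dimA : dim A ≡ length vs ℕ.+ dim (A ∩ˢ B)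
      dimA = ≡.trans (dim-unique A (basis-++ Zero (A ∩ˢ B) (Zero-least (A ∩ˢ B)) proj₁ (proj₂ (basis (A ∩ˢ B))) vs-basis))
                     (List.length-++ vs)

      dim+ : dim (A +ˢ B) ≡ length vs ℕ.+ dim B
      dim+ = ≡.trans (dim-unique (A +ˢ B) (basis-++ Zero B (Zero-least B) (+ˢ-right A B) (proj₂ (basis B)) (basis-second-iso A B vs-basis)))
                     (List.length-++ vs)

    equal-dim : (S : Subspace R W p) (S′ : Subspace R W q) → Member S ⊆ Member S′ → dim S′ ℕ.≤ dim S → Member S′ ⊆ Member S
    equal-dim S S′ S⊆S′ dim≤ {w} w∈ with basis S
    ... | vs , ind , vs∈ , _ = byContradiction λ w∉ → ℕ.<⇒≱
          (independent-≤-dim S′ ((λ s → w∉ (span-least Zero S (Zero-least S) vs∈ s)) ∷ ind) (w∈ ∷ All.map S⊆S′ vs∈)) dim≤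

    dim-hyperplane : (S : Subspace R W p) (S′ : Subspace R W q) → ∀ v →
                     (∀ {w} → Member S w → ∃[ a ] ∃[ u ] (Member S′ u × w ≈ᴹ a *ₗ v +ᴹ u)) → dim S ℕ.≤ suc (dim S′)
    dim-hyperplane S S′ v split with basis S′
    ... | vs , _ , _ , spans = dim-≤-span {vs = v ∷ vs} S λ w∈ →
          let a , u , u∈ , eq = split w∈ in step a (spans u∈) eq

  -- Lists of basis vectors and coordinate bases

  tabulate-spans : ∀ {d} (a : Fin d → F) b → Spanned (Member Zero) (tabulate b) (linComb R W a b)
  tabulate-spans {zero}  a b = base ≈ᴹ-refl
  tabulate-spans {suc d} a b = step (a zero) (tabulate-spans (a ∘ suc) (b ∘ suc)) ≈ᴹ-refl

  spanned-linComb : ∀ {d} (b : Fin d → Carrierᴹ) → Spanned (Member Zero) (tabulate b) w → ∃[ a ] (linComb R W a b ≈ᴹ w)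
  spanned-linComb {d = zero}  b (base w≈0)    = (λ ()) , ≈ᴹ-sym w≈0
  spanned-linComb {d = suc d} b (step x s eq) with spanned-linComb (b ∘ suc) s
  ... | a , eq′ = (λ { zero → x ; (suc i) → a i }) , ≈ᴹ-sym (≈ᴹ-trans eq (+ᴹ-congˡ (≈ᴹ-sym eq′)))

  LinearlyIndependent : ∀ {d} → (Fin d → Carrierᴹ) → Set _
  LinearlyIndependent b = ∀ a → linComb R W a b ≈ᴹ 0ᴹ → ∀ i → a i ≈F 0#

  independent⇒linearlyIndependent : ∀ {d} (b : Fin d → Carrierᴹ) → Independent (Member Zero) (tabulate b) → LinearlyIndependent b
  independent⇒linearlyIndependent {suc d} b (v∉ ∷ ind) a eq = λ where
      zero    → a₀≈0
      (suc i) → independent⇒linearlyIndependent (b ∘ suc) ind (a ∘ suc)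
        (≈ᴹ-trans (≈ᴹ-sym (≈ᴹ-trans (+ᴹ-congʳ (≈ᴹ-trans (*ₗ-congʳ a₀≈0) (*ₗ-zeroˡ _))) (+ᴹ-identityˡ _))) eq) i
    where
    a₀≈0 : a zero ≈F 0#
    a₀≈0 = byContradiction λ a₀≉0 → case inverse a₀≉0 of λ (y , ya≈1) →
      v∉ (resp (Span Zero _) (≈ᴹ-sym (solve-head ya≈1 (≈ᴹ-sym eq)))
           (+-mem (Span Zero _) (*ₗ-mem (Span Zero _) y (0-mem (Span Zero _)))
             (*ₗ-mem (Span Zero _) (- y) (tabulate-spans (a ∘ suc) (b ∘ suc)))))
  independent⇒linearlyIndependent {zero} b ind a eq ()

  linearlyIndependent⇒independent : ∀ {d} (b : Fin d → Carrierᴹ) → LinearlyIndependent b → Independent (Member Zero) (tabulate b)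
  linearlyIndependent⇒independent {zero}  b li = []
  linearlyIndependent⇒independent {suc d} b li =
      -- If the head were a combination of the rest, there would be a relation whose first
      -- coefficient is `- 1#`, and `1#` would vanish.
      (λ s → case spanned-linComb (b ∘ suc) s of λ (a , eq) →
        1≉0 (CommutativeRing.trans R (CommutativeRing.sym R (-‿involutive 1#)) (CommutativeRing.trans R
          (CommutativeRing.-‿cong R (li (λ { zero → - 1# ; (suc i) → a i })
            (≈ᴹ-trans (+ᴹ-cong (neg-as-scalar R W (b zero)) eq) (proj₁ -ᴹ‿inverse (b zero))) zero)) -0#≈0#)))
    ∷ linearlyIndependent⇒independent (b ∘ suc) λ a eq i → li (λ { zero → 0# ; (suc j) → a j })
        (≈ᴹ-trans (+ᴹ-cong (*ₗ-zeroˡ _) eq) (+ᴹ-identityˡ 0ᴹ)) (suc i)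
    where open RingProperties (CommutativeRing.ring R) using (-‿involutive; -0#≈0#)

  module _ (S : Subspace R W p) where

    private
      linComb-asSpace : ∀ {d} (a : Fin d → F) b → proj₁ (linComb R (asSpace R S) a b) ≡ linComb R W a (proj₁ ∘ b)
      linComb-asSpace {zero}  a b = ≡.refl
      linComb-asSpace {suc d} a b = ≡.cong (a zero *ₗ proj₁ (b zero) +ᴹ_) (linComb-asSpace (a ∘ suc) (b ∘ suc))

      linComb-asSpace′ : ∀ {d} (a : Fin d → F) b → proj₁ (linComb R (asSpace R S) a b) ≈ᴹ linComb R W a (proj₁ ∘ b)
      linComb-asSpace′ a b = IsEquivalence.reflexive ≈ᴹ-isEquivalence (linComb-asSpace a b)
        where open import Relation.Binary.Structures using (IsEquivalence)

    dimension⇒basis : ∀ {d} → HasDimension R (asSpace R S) d → ∃[ vs ] (IsBasis (Member Zero) (Member S) vs × length vs ≡ d)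
    dimension⇒basis (b , spans , li) = tabulate (proj₁ ∘ b)
      , ( linearlyIndependent⇒independent (proj₁ ∘ b) (λ a eq → li a (≈ᴹ-trans (linComb-asSpace′ a b) eq))
        , All.tabulate⁺ (proj₂ ∘ b)
        , λ {w} w∈ → case spans (w , w∈) of λ (a , eq) →
            resp (Span Zero _) (≈ᴹ-trans (≈ᴹ-sym (linComb-asSpace′ a b)) eq) (tabulate-spans a (proj₁ ∘ b)))
      , List.length-tabulate (proj₁ ∘ b)

    basis⇒dimension : IsBasis (Member Zero) (Member S) vs → HasDimension R (asSpace R S) (length vs)
    basis⇒dimension {vs = vs} (ind , vs∈ , spans) = b
      , (λ (w , w∈) → case spanned-linComb (proj₁ ∘ b) (≡.subst (λ us → Spanned (Member Zero) us w) (≡.sym eq) (spans w∈)) of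
           λ (a , eq′) → a , ≈ᴹ-trans (linComb-asSpace′ a b) eq′)
      , λ a eq′ → independent⇒linearlyIndependent (proj₁ ∘ b) (≡.subst (Independent (Member Zero)) (≡.sym eq) ind) a
          (≈ᴹ-trans (≈ᴹ-sym (linComb-asSpace′ a b)) eq′)
      where
      b : Fin (length vs) → ∃ (Member S)
      b i = List.lookup vs i , All.lookup vs∈ (∈ˡ.∈-lookup i)

      eq : tabulate (proj₁ ∘ b) ≡ vs
      eq = List.tabulate-lookup vs

-- Bases of direct sums

module DirectSum (em : ∀ {a} → ExcludedMiddle a) {c ℓ₁} (R : CommutativeRing c ℓ₁) (isField : IsField R) {m ℓm p}
                 {I : Set} (_≟_ : (i j : I) → Dec (i ≡ j)) (Ws : I → VectorSpace R m ℓm)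
                 (S : ∀ i → Subspace R (Ws i) p) where

  private
    W = ⨁ R I Ws
    inj = inject R _≟_ Ws
    module Summand (i : I) = LeftModule (Ws i)
    module L (i : I) = LinearAlgebra em R isField (Ws i)
    module ⊕ = LinearAlgebra em R isField W
    module W = LeftModule W
  open Summand
  open Subspace

  inject-same : ∀ i v → _≈ᴹ_ i (inj i v i) v
  inject-same i v with i ≟ i
  ... | yes ≡.refl = ≈ᴹ-refl i
  ... | no  i≢i    = ⊥-elim (i≢i ≡.refl)

  inject-other : ∀ {i j} v → ¬ i ≡ j → _≈ᴹ_ j (inj i v j) (0ᴹ j)
  inject-other {i} {j} v i≢j with i ≟ j
  ... | yes i≡j = ⊥-elim (i≢j i≡j)
  ... | no  _   = ≈ᴹ-refl j

  sumSubspace : Subspace R W p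
  sumSubspace = record
    { Member = λ w → ∀ i → Member (S i) (w i)
    ; resp   = λ v≈w v∈ i → resp (S i) (v≈w i) (v∈ i)
    ; 0-mem  = λ i → 0-mem (S i)
    ; +-mem  = λ v∈ w∈ i → +-mem (S i) (v∈ i) (w∈ i)
    ; *ₗ-mem = λ a v∈ i → *ₗ-mem (S i) a (v∈ i)
    }

  inject-member : ∀ i {v} → Member (S i) v → Member sumSubspace (inj i v)
  inject-member i v∈ j with i ≟ j
  ... | yes ≡.refl = v∈
  ... | no  _      = 0-mem (S j)

  -- These subspaces filter the direct sum; each step adds one summand, and `basis-++` joins the
  -- bases of the steps.
  supportedOn : List I → Subspace R W (p ⊔ ℓm)
  supportedOn is = record
    { Member = λ w → Member sumSubspace w × (∀ i → ¬ i ∈ˡ is → _≈ᴹ_ i (w i) (0ᴹ i))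
    ; resp   = λ v≈w (v∈ , v≈0) → resp sumSubspace v≈w v∈ , λ i i∉ → ≈ᴹ-trans i (≈ᴹ-sym i (v≈w i)) (v≈0 i i∉)
    ; 0-mem  = 0-mem sumSubspace , λ i _ → ≈ᴹ-refl i
    ; +-mem  = λ (v∈ , v≈0) (w∈ , w≈0) → +-mem sumSubspace v∈ w∈ ,
        λ i i∉ → ≈ᴹ-trans i (+ᴹ-cong i (v≈0 i i∉) (w≈0 i i∉)) (+ᴹ-identityˡ i _)
    ; *ₗ-mem = λ a (v∈ , v≈0) → *ₗ-mem sumSubspace a v∈ ,
        λ i i∉ → ≈ᴹ-trans i (*ₗ-congˡ i (v≈0 i i∉)) (*ₗ-zeroʳ i a)
    }

  module _ (vs : ∀ i → List (Carrierᴹ i)) (basis : ∀ i → L.IsBasis i (Member (L.Zero i)) (Member (S i)) (vs i)) where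

    concatenated : List I → List W.Carrierᴹ
    concatenated []       = []
    concatenated (i ∷ is) = map (inj i) (vs i) ++ concatenated is

    length-concatenated : ∀ is → length (concatenated is) ≡ sum (map (length ∘ vs) is)
    length-concatenated []       = ≡.refl
    length-concatenated (i ∷ is) = ≡.trans (List.length-++ (map (inj i) (vs i)))
      (≡.cong₂ ℕ._+_ (List.length-map (inj i) (vs i)) (length-concatenated is))

    concatenated-All : ∀ {q} (Û : Subspace R W q) → (∀ i {v} → Member (S i) v → Member Û (inj i v)) →
                       ∀ is → All (Member Û) (concatenated is)
    concatenated-All Û inj∈ []       = []
    concatenated-All Û inj∈ (i ∷ is) =
      All.++⁺ (All.map⁺ (All.map (inj∈ i) (proj₁ (proj₂ (basis i))))) (concatenated-All Û inj∈ is)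

    private
      component : ∀ i {is us w} → ¬ i ∈ˡ is → ⊕.Spanned (Member (supportedOn is)) (map (inj i) us) w →
                  L.Spanned i (Member (L.Zero i)) us (w i)
      component i {us = []}    i∉ (⊕.base (_ , w≈0)) = L.base (w≈0 i i∉)
      component i {us = u ∷ _} i∉ (⊕.step a s eq) = L.step a (component i i∉ s)
        (≈ᴹ-trans i (eq i) (+ᴹ-congʳ i (*ₗ-congˡ i (inject-same i u))))

      independent : ∀ i {is us} → ¬ i ∈ˡ is → L.Independent i (Member (L.Zero i)) us →
                    ⊕.Independent (Member (supportedOn is)) (map (inj i) us)
      independent i i∉ L.[]         = ⊕.[]
      independent i i∉ (v∉ L.∷ ind) = (λ s → v∉ (L.span-mono i (L.Zero i) (L.Zero i) id _
          (resp (L.Span i (L.Zero i) _) (inject-same i _) (component i i∉ s)))) ⊕.∷ independent i i∉ ind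

      -- The representation of the component `x` at `i` is used term by term: subtracting the
      -- injected terms from `w` leaves a vector whose component at `i` is zero, hence one supported
      -- on `is`.
      spans : ∀ i {is us w x} → All (Member (S i)) us → Member (supportedOn (i ∷ is)) w → _≈ᴹ_ i (w i) x →
              L.Spanned i (Member (L.Zero i)) us x → ⊕.Spanned (Member (supportedOn is)) (map (inj i) us) w
      spans i {is} {w = w} _ (w∈ , w≈0) wi≈x (L.base x≈0) = ⊕.base (w∈ , vanish)
        where
        vanish : ∀ j → ¬ j ∈ˡ is → _≈ᴹ_ j (w j) (0ᴹ j)
        vanish j j∉ with i ≟ j
        ... | yes ≡.refl = ≈ᴹ-trans i wi≈x x≈0
        ... | no  i≢j    = w≈0 j λ { (here j≡i) → i≢j (≡.sym j≡i) ; (there j∈) → j∉ j∈ }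
      spans i {is} {us = u ∷ us} {w} {x} (u∈ ∷ us∈) w∈ wi≈x (L.step a {y} s eq) =
        ⊕.step a (spans i us∈ rest∈ rest≈ s) cancel′
        where
        R- = CommutativeRing.-_ R

        rest : W.Carrierᴹ
        rest = w W.+ᴹ R- a W.*ₗ inj i u

        rest∈ : Member (supportedOn (i ∷ is)) rest
        rest∈ = +-mem (supportedOn (i ∷ is)) w∈ (*ₗ-mem (supportedOn (i ∷ is)) (R- a)
          (inject-member i u∈ , λ j j∉ → inject-other u λ i≡j → j∉ (here (≡.sym i≡j))))

        cancel′ : ∀ j → _≈ᴹ_ j (w j) (_+ᴹ_ j (_*ₗ_ j a (inj i u j)) (rest j))
        cancel′ j = ≈ᴹ-sym j (L.*ₗ-cancel j a (inj i u j) (w j))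

        rest≈ : _≈ᴹ_ i (rest i) y
        rest≈ = ≈ᴹ-trans i (+ᴹ-cong i (≈ᴹ-trans i wi≈x eq) (*ₗ-congˡ i (inject-same i u)))
          (≈ᴹ-trans i (+ᴹ-assoc i _ y _) (L.*ₗ-cancel i a u y))

    basis-supportedOn : ∀ {is} → Unique is → ⊕.IsBasis (Member ⊕.Zero) (Member (supportedOn is)) (concatenated is)
    basis-supportedOn {[]} [] = ⊕.[] , [] , λ (_ , w≈0) → ⊕.base λ i → w≈0 i λ ()
    basis-supportedOn {i ∷ is} (i∉ ∷ uniq) = ⊕.basis-++ ⊕.Zero (supportedOn is) {Member (supportedOn (i ∷ is))}
        (⊕.Zero-least (supportedOn is))
        (λ (w∈ , w≈0) → w∈ , λ j j∉ → w≈0 j (j∉ ∘ there))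
        (basis-supportedOn uniq)
        ( independent i (λ i∈ → All.lookup i∉ i∈ ≡.refl) (proj₁ (basis i))
        , All.map⁺ (All.map (λ u∈ → inject-member i u∈ , λ j j∉ → inject-other _ λ i≡j → j∉ (here (≡.sym i≡j)))
            (proj₁ (proj₂ (basis i))))
        , λ {w} w∈ → spans i (proj₁ (proj₂ (basis i))) w∈ (≈ᴹ-refl i) (proj₂ (proj₂ (basis i)) (proj₁ w∈ i)))

    basis-sum : ∀ {is} → Unique is → (∀ i → i ∈ˡ is) → ⊕.IsBasis (Member ⊕.Zero) (Member sumSubspace) (concatenated is)
    basis-sum uniq all with basis-supportedOn uniq
    ... | ind , vs∈ , sp = ind , All.map proj₁ vs∈ , λ w∈ → sp (w∈ , λ i i∉ → ⊥-elim (i∉ (all i)))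


-- Univariate polynomials over an algebraically closed field

module UnivariatePolynomials (em : ∀ {a} → ExcludedMiddle a) {c ℓ₁} (R : CommutativeRing c ℓ₁) (isField : IsField R)
                             (closed : IsAlgebraicallyClosed R) where


  open CommutativeRing R hiding (zero) renaming (Carrier to F)
  open FieldTheory em R isField
  open SetoidReasoning setoid
  open DifferenceSolver R renaming (_:+_ to _⊹_; _:*_ to _⊛_; con to constant)

  private
    κ : ∀ {n} → ℕ → Term n
    κ k = constant (k , 0)

  open SemiringExp semiring using (_^_)
  open SemiringSum semiring using (sum-cong-≋; sum-init-last) renaming (sum to ∑)

  -- Coefficient lists start with the leading coefficient.
  horner : List F → F → F
  horner []       y = 0#
  horner (a ∷ as) y = a * y ^ length as + horner as y

  horner-∷ʳ : ∀ as a y → horner (as ∷ʳ a) y ≈ y * horner as y + a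
  horner-∷ʳ []       a y = solve 2 (λ a y → a ⊛ κ 1 ⊹ κ 0 := y ⊛ κ 0 ⊹ a) refl a y
  horner-∷ʳ (b ∷ as) a y rewrite List.length-++ as {a ∷ []} | ℕ.+-comm (length as) 1 =
    trans (+-congˡ (horner-∷ʳ as a y))
      (solve 5 (λ a b y p h → b ⊛ (y ⊛ p) ⊹ (y ⊛ h ⊹ a) := y ⊛ (b ⊛ p ⊹ h) ⊹ a) refl
         a b y (y ^ length as) (horner as y))

  private
    coefficient : List F → ℕ → F
    coefficient []       n = 0#
    coefficient (a ∷ as) n with n ℕ.≟ length as
    ... | yes _ = a
    ... | no  _ = coefficient as n

    coefficient-head : ∀ a as {n} → n ≡ length as → coefficient (a ∷ as) n ≡ a
    coefficient-head a as {n} n≡ with n ℕ.≟ length as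
    ... | yes _ = ≡.refl
    ... | no n≢ = ⊥-elim (n≢ n≡)

    coefficient-tail : ∀ a as {n} → n ℕ.< length as → coefficient (a ∷ as) n ≡ coefficient as n
    coefficient-tail a as {n} n< with n ℕ.≟ length as
    ... | yes n≡ = ⊥-elim (ℕ.<⇒≢ n< n≡)
    ... | no _   = ≡.refl

    horner-sum : ∀ as y → ∑ {length as} (λ i → coefficient as (toℕ i) * y ^ toℕ i) ≈ horner as y
    horner-sum []       y = refl
    horner-sum (a ∷ as) y = trans (sum-init-last {length as} (λ i → coefficient (a ∷ as) (toℕ i) * y ^ toℕ i)) (trans (+-comm _ _)
      (+-cong
        (*-cong (reflexive (coefficient-head a as (Fin.toℕ-fromℕ (length as))))
                (reflexive (≡.cong (y ^_) (Fin.toℕ-fromℕ (length as)))))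
        (trans (sum-cong-≋ λ i → *-cong
            (reflexive (≡.trans (coefficient-tail a as (≡.subst (ℕ._< length as) (≡.sym (Fin.toℕ-inject₁ i)) (Fin.toℕ<n i)))
                                (≡.cong (coefficient as) (Fin.toℕ-inject₁ i))))
            (reflexive (≡.cong (y ^_) (Fin.toℕ-inject₁ i))))
          (horner-sum as y))))

  root : ∀ a b bs → ¬ (a ≈ 0#) → ∃[ y ] (horner (a ∷ b ∷ bs) y ≈ 0#)
  root a b bs a≉0 with closed (length bs) (λ i → coefficient (a ∷ b ∷ bs) (toℕ i))
                         (λ ≈0 → a≉0 (trans (sym (reflexive (coefficient-head a (b ∷ bs) (≡.cong suc (Fin.toℕ-fromℕ (length bs)))))) ≈0))
  ... | y , eq = y , trans (sym (horner-sum (a ∷ b ∷ bs) y)) eq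

  private
    decrement : F → List F → List F
    decrement b []        = b - 1# ∷ []
    decrement b (b′ ∷ bs) = b ∷ decrement b′ bs

    length-decrement : ∀ b bs → length (decrement b bs) ≡ suc (length bs)
    length-decrement b []        = ≡.refl
    length-decrement b (b′ ∷ bs) = ≡.cong suc (length-decrement b′ bs)

    horner-decrement : ∀ b bs y → horner (decrement b bs) y ≈ horner (b ∷ bs) y - 1#
    horner-decrement b [] y =
      solve 1 (λ b → (b :- κ 1) ⊛ κ 1 ⊹ κ 0 := b ⊛ κ 1 ⊹ κ 0 :- κ 1) refl b
    horner-decrement b (b′ ∷ bs) y rewrite length-decrement b′ bs =
      trans (+-congˡ (horner-decrement b′ bs y)) (sym (+-assoc _ _ _))

    root′ : ∀ a b bs as → as ≡ decrement b bs → ¬ (a ≈ 0#) → ∃[ y ] (horner (a ∷ as) y ≈ 0#)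
    root′ a b []        _ ≡.refl a≉0 = root a (b - 1#) [] a≉0
    root′ a b (b′ ∷ bs) _ ≡.refl a≉0 = root a b (decrement b′ bs) a≉0

  -- A root of f - 1 is not a root of f.
  non-root : ∀ a as → ¬ (a ≈ 0#) → ∃[ y ] (¬ (horner (a ∷ as) y ≈ 0#))
  non-root a []       a≉0 = 0# , λ eq → a≉0 (trans (sym (trans (+-identityʳ _) (*-identityʳ a))) eq)
  non-root a (b ∷ bs) a≉0 with root′ a b bs (decrement b bs) ≡.refl a≉0
  ... | y , eq = y , λ ≈0 → 1≉0 (trans (sym (solve 1 (λ h → h :- (h :- κ 1) := κ 1) refl (horner (a ∷ b ∷ bs) y)))
                     (trans (+-cong ≈0 (-‿cong (trans (sym decr) eq))) (-‿inverseʳ 0#)))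
    where
    decr : horner (a ∷ decrement b bs) y ≈ horner (a ∷ b ∷ bs) y - 1#
    decr rewrite length-decrement b bs = trans (+-congˡ (horner-decrement b bs y)) (sym (+-assoc _ _ _))

  horner-zeros : ∀ {as} → All (_≈ 0#) as → ∀ y → horner as y ≈ 0#
  horner-zeros []         y = refl
  horner-zeros (a≈0 ∷ zs) y = trans (+-cong (trans (*-congʳ a≈0) (zeroˡ _)) (horner-zeros zs y)) (+-identityˡ 0#)

  horner-drop : ∀ {a} as y → a ≈ 0# → horner (a ∷ as) y ≈ horner as y
  horner-drop as y a≈0 = trans (+-congʳ (trans (*-congʳ a≈0) (zeroˡ _))) (+-identityˡ _)

  -- An algebraically closed field is infinite: `non-root` refutes a nonzero leading coefficient,
  -- and the next coefficient then becomes the leading one.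
  vanishing-zeros : ∀ as → (∀ y → horner as y ≈ 0#) → All (_≈ 0#) as
  vanishing-zeros []       _ = []
  vanishing-zeros (a ∷ as) v = a≈0 ∷ vanishing-zeros as λ y → trans (sym (horner-drop as y a≈0)) (v y)
    where
    a≈0 : a ≈ 0#
    a≈0 = byContradiction λ a≉0 → case non-root a as a≉0 of λ (y , ≉0) → ≉0 (v y)

  private
    -- Synthetic division by `y - α`: the entries are the partial values of the Horner scheme at
    -- `α`, carried in the second argument. The last one is the remainder and is left out.
    quotient : F → F → List F → List F
    quotient α a []       = []
    quotient α a (b ∷ bs) = a ∷ quotient α (b + α * a) bs

    length-quotient : ∀ α a as → length (quotient α a as) ≡ length as
    length-quotient α a []       = ≡.refl
    length-quotient α a (b ∷ bs) = ≡.cong suc (length-quotient α _ bs)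

    horner-quotient : ∀ α a as → ∃[ r ] (∀ y → horner (a ∷ as) y ≈ (y - α) * horner (quotient α a as) y + r)
    horner-quotient α a [] = a , λ y →
      solve 2 (λ a d → a ⊛ κ 1 ⊹ κ 0 := d ⊛ κ 0 ⊹ a) refl a (y - α)
    horner-quotient α a (b ∷ bs) with horner-quotient α (b + α * a) bs
    ... | r , eq = r , λ y → go y (eq y)
      where
      go : ∀ y → horner (b + α * a ∷ bs) y ≈ (y - α) * horner (quotient α (b + α * a) bs) y + r →
           horner (a ∷ b ∷ bs) y ≈ (y - α) * horner (a ∷ quotient α (b + α * a) bs) y + r
      go y eq rewrite length-quotient α (b + α * a) bs =
        trans (solve 6 (λ a b α y p h → a ⊛ (y ⊛ p) ⊹ (b ⊛ p ⊹ h)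
                                      := (y :- α) ⊛ (a ⊛ p) ⊹ ((b ⊹ α ⊛ a) ⊛ p ⊹ h)) refl
                 a b α y (y ^ length bs) (horner bs y))
        (trans (+-congˡ eq) (trans (sym (+-assoc _ _ _)) (+-congʳ (sym (distribˡ _ _ _)))))

  divide-root : ∀ α a as → horner (a ∷ as) α ≈ 0# →
                ∀ y → horner (a ∷ as) y ≈ (y - α) * horner (quotient α a as) y
  divide-root α a as α-root y with horner-quotient α a as
  ... | r , eq = trans (eq y) (trans (+-congˡ r≈0) (+-identityʳ _))
    where
    r≈0 : r ≈ 0#
    r≈0 = trans (sym (trans (+-congʳ (trans (*-congʳ (-‿inverseʳ α)) (zeroˡ _))) (+-identityˡ r))) (trans (sym (eq α)) α-root)

  Π : List F → F → F
  Π []       y = 1#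
  Π (α ∷ αs) y = (y - α) * Π αs y

  Π-++ : ∀ αs βs y → Π (αs ++ βs) y ≈ Π αs y * Π βs y
  Π-++ []       βs y = sym (*-identityˡ _)
  Π-++ (α ∷ αs) βs y = trans (*-congˡ (Π-++ αs βs y)) (sym (*-assoc _ _ _))

  factorise : ∀ a as → ¬ (a ≈ 0#) → ∃[ αs ] (length αs ≡ length as × (∀ y → horner (a ∷ as) y ≈ a * Π αs y))
  factorise a as a≉0 = go (length as) as ≡.refl
    where
    go : ∀ n as → length as ≡ n → ∃[ αs ] (length αs ≡ length as × (∀ y → horner (a ∷ as) y ≈ a * Π αs y))
    go _       []       _ = [] , ≡.refl , λ y → +-identityʳ _
    go (suc n) (b ∷ bs) eq with root a b bs a≉0
    ... | α , α-root with go n (quotient α (b + α * a) bs) (≡.trans (length-quotient α _ bs) (ℕ.suc-injective eq))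
    ...   | αs , len , fac = α ∷ αs , ≡.cong suc (≡.trans len (length-quotient α _ bs)) , λ y →
              trans (divide-root α a (b ∷ bs) α-root y) (trans (*-congˡ (fac y))
                (solve 3 (λ d a p → d ⊛ (a ⊛ p) := a ⊛ (d ⊛ p)) refl (y - α) a (Π αs y)))

  private
    -- The coefficients of `(y - α)` times `a ∷ as` below the leading one, which remains `a`.
    times : F → F → List F → List F
    times α a []       = - (α * a) ∷ []
    times α a (b ∷ bs) = b - α * a ∷ times α b bs

    length-times : ∀ α a as → length (times α a as) ≡ suc (length as)
    length-times α a []       = ≡.refl
    length-times α a (b ∷ bs) = ≡.cong suc (length-times α b bs)

    horner-times : ∀ α a as y → horner (a ∷ times α a as) y ≈ (y - α) * horner (a ∷ as) y
    horner-times α a [] y =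
      solve 3 (λ a α y → a ⊛ (y ⊛ κ 1) ⊹ (:- (α ⊛ a) ⊛ κ 1 ⊹ κ 0)
                       := (y :- α) ⊛ (a ⊛ κ 1 ⊹ κ 0)) refl a α y
    horner-times α a (b ∷ bs) y with horner-times α b bs y
    ... | eq rewrite length-times α b bs =
      trans (solve 6 (λ a b α y p h → a ⊛ (y ⊛ (y ⊛ p)) ⊹ ((b :- α ⊛ a) ⊛ (y ⊛ p) ⊹ h)
                     := (y :- α) ⊛ (a ⊛ (y ⊛ p)) ⊹ (b ⊛ (y ⊛ p) ⊹ h)) refl
               a b α y (y ^ length bs) (horner (times α b bs) y))
      (trans (+-congˡ eq) (sym (distribˡ _ _ _)))

    expand : ∀ αs → ∃[ as ] (∀ y → horner (1# ∷ as) y ≈ Π αs y)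
    expand []       = [] , λ y → trans (+-identityʳ _) (*-identityʳ 1#)
    expand (α ∷ αs) with expand αs
    ... | as , eq = times α 1# as , λ y → trans (horner-times α 1# as y) (*-congˡ (eq y))

  abstract
    -- Expanded, the product has leading coefficient `1#`, so `non-root` applies. This is how
    -- finitely many points are avoided.
    Π-non-root : ∀ αs → ∃[ y ] (¬ (Π αs y ≈ 0#))
    Π-non-root αs with expand αs
    ... | as , eq with non-root 1# as 1≉0
    ...   | y , ≉0 = y , λ ≈0 → ≉0 (trans (eq y) ≈0)

  -- Polynomials in several variables as functions of one of them

  extend : ∀ {X : Set} → (X → F) → F → Maybe X → F
  extend x y nothing  = y
  extend x y (just i) = x i

  private
    module _ {X : Set} where

      -- Here coefficients start with the constant term, so that addition and multiplication of
      -- lists need no alignment of degrees; the order is reversed at the end.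
      low : List (Polynomial F X) → (X → F) → F → F
      low []       x y = 0#
      low (p ∷ ps) x y = eval R p x + y * low ps x y

      _⊞_ : List (Polynomial F X) → List (Polynomial F X) → List (Polynomial F X)
      []       ⊞ qs       = qs
      (p ∷ ps) ⊞ []       = p ∷ ps
      (p ∷ ps) ⊞ (q ∷ qs) = p :+ q ∷ ps ⊞ qs

      _⊠_ : List (Polynomial F X) → List (Polynomial F X) → List (Polynomial F X)
      []       ⊠ qs = []
      (p ∷ ps) ⊠ qs = map (p :*_) qs ⊞ (con 0# ∷ ps ⊠ qs)

      low-⊞ : ∀ ps qs x y → low (ps ⊞ qs) x y ≈ low ps x y + low qs x y
      low-⊞ []       qs       x y = sym (+-identityˡ _)
      low-⊞ (p ∷ ps) []       x y = sym (+-identityʳ _)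
      low-⊞ (p ∷ ps) (q ∷ qs) x y = trans (+-congˡ (*-congˡ (low-⊞ ps qs x y)))
        (solve 5 (λ p q y s t → p ⊹ q ⊹ y ⊛ (s ⊹ t) := (p ⊹ y ⊛ s) ⊹ (q ⊹ y ⊛ t)) refl
           (eval R p x) (eval R q x) y (low ps x y) (low qs x y))

      low-scale : ∀ p qs x y → low (map (p :*_) qs) x y ≈ eval R p x * low qs x y
      low-scale p []       x y = sym (zeroʳ _)
      low-scale p (q ∷ qs) x y = trans (+-congˡ (*-congˡ (low-scale p qs x y)))
        (solve 4 (λ p q y s → p ⊛ q ⊹ y ⊛ (p ⊛ s) := p ⊛ (q ⊹ y ⊛ s)) refl
           (eval R p x) (eval R q x) y (low qs x y))

      low-⊠ : ∀ ps qs x y → low (ps ⊠ qs) x y ≈ low ps x y * low qs x y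
      low-⊠ []       qs x y = sym (zeroˡ _)
      low-⊠ (p ∷ ps) qs x y = trans (low-⊞ (map (p :*_) qs) _ x y)
        (trans (+-cong (low-scale p qs x y) (+-congˡ (*-congˡ (low-⊠ ps qs x y))))
          (solve 4 (λ p y s t → p ⊛ t ⊹ (κ 0 ⊹ y ⊛ (s ⊛ t)) := (p ⊹ y ⊛ s) ⊛ t) refl
             (eval R p x) y (low ps x y) (low qs x y)))

      lowCoefficients : Polynomial F (Maybe X) → List (Polynomial F X)
      lowCoefficients (con a)        = con a ∷ []
      lowCoefficients (var nothing)  = con 0# ∷ con 1# ∷ []
      lowCoefficients (var (just i)) = var i ∷ []
      lowCoefficients (p :+ q)       = lowCoefficients p ⊞ lowCoefficients q
      lowCoefficients (p :* q)       = lowCoefficients p ⊠ lowCoefficients q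

      low-coefficients : ∀ p x y → low (lowCoefficients p) x y ≈ eval R p (extend x y)
      low-coefficients (con a)        x y = solve 2 (λ a y → a ⊹ y ⊛ κ 0 := a) refl a y
      low-coefficients (var nothing)  x y =
        solve 1 (λ y → κ 0 ⊹ y ⊛ (κ 1 ⊹ y ⊛ κ 0) := y) refl y
      low-coefficients (var (just i)) x y = solve 2 (λ a y → a ⊹ y ⊛ κ 0 := a) refl (x i) y
      low-coefficients (p :+ q)       x y =
        trans (low-⊞ (lowCoefficients p) _ x y) (+-cong (low-coefficients p x y) (low-coefficients q x y))
      low-coefficients (p :* q)       x y =
        trans (low-⊠ (lowCoefficients p) _ x y) (*-cong (low-coefficients p x y) (low-coefficients q x y))

      horner-reverse : ∀ ps x y → horner (map (λ p → eval R p x) (reverse ps)) y ≈ low ps x y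
      horner-reverse []       x y = refl
      horner-reverse (p ∷ ps) x y
        rewrite List.unfold-reverse p ps | List.map-++ (λ q → eval R q x) (reverse ps) (p ∷ []) =
        trans (horner-∷ʳ (map (λ q → eval R q x) (reverse ps)) (eval R p x) y)
          (trans (+-comm _ _) (+-congˡ (*-congˡ (horner-reverse ps x y))))

  -- The list is uniform in the point `x`: the entries are polynomials in the remaining variables.
  -- The leading ones may vanish at particular points, so the list bounds the degree without
  -- determining it.
  coefficients : ∀ {X} → Polynomial F (Maybe X) → List (Polynomial F X)
  coefficients p = reverse (lowCoefficients p)

  horner-coefficients : ∀ {X} (p : Polynomial F (Maybe X)) x y →
                        horner (map (λ q → eval R q x) (coefficients p)) y ≈ eval R p (extend x y)
  horner-coefficients p x y = trans (horner-reverse (lowCoefficients p) x y) (low-coefficients p x y)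

  IsPolynomial : (F → F) → Set _
  IsPolynomial f = ∃[ p ] (∀ y → f y ≈ eval R p (extend ⊥-elim y))

  isPolynomial-eval : ∀ {X} (p : Polynomial F (Maybe X)) x → IsPolynomial (λ y → eval R p (extend x y))
  isPolynomial-eval (con a)        x = con a , λ y → refl
  isPolynomial-eval (var nothing)  x = var nothing , λ y → refl
  isPolynomial-eval (var (just i)) x = con (x i) , λ y → refl
  isPolynomial-eval (p :+ q) x with isPolynomial-eval p x | isPolynomial-eval q x
  ... | p′ , p≈ | q′ , q≈ = p′ :+ q′ , λ y → +-cong (p≈ y) (q≈ y)
  isPolynomial-eval (p :* q) x with isPolynomial-eval p x | isPolynomial-eval q x
  ... | p′ , p≈ | q′ , q≈ = p′ :* q′ , λ y → *-cong (p≈ y) (q≈ y)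

  isPolynomial-* : ∀ (f g : F → F) → IsPolynomial f → IsPolynomial g → IsPolynomial (λ y → f y * g y)
  isPolynomial-* f g (p , f≈) (q , g≈) = p :* q , λ y → *-cong (f≈ y) (g≈ y)

  isPolynomial-- : ∀ (f g : F → F) → IsPolynomial f → IsPolynomial g → IsPolynomial (λ y → f y - g y)
  isPolynomial-- f g (p , f≈) (q , g≈) = p :+ (con (- 1#) :* q) , λ y →
    +-cong (f≈ y) (trans (-‿cong (g≈ y)) (solve 1 (λ z → :- z := :- κ 1 ⊛ z) refl _))

  isPolynomial-Π : ∀ αs → IsPolynomial (Π αs)
  isPolynomial-Π []       = con 1# , λ y → refl
  isPolynomial-Π (α ∷ αs) = isPolynomial-* (_- α) (Π αs) (var nothing :+ con (- α) , λ y → refl) (isPolynomial-Π αs)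

  isPolynomial-+ : ∀ (f g : F → F) → IsPolynomial f → IsPolynomial g → IsPolynomial (λ y → f y + g y)
  isPolynomial-+ f g (p , f≈) (q , g≈) = p :+ q , λ y → +-cong (f≈ y) (g≈ y)

  power : ∀ {X} → Polynomial F X → ℕ → Polynomial F X
  power f zero    = con 1#
  power f (suc n) = f :* power f n

  eval-power : ∀ {X} (f : Polynomial F X) n x → eval R (power f n) x ≈ eval R f x ^ n
  eval-power f zero    x = refl
  eval-power f (suc n) x = *-congˡ (eval-power f n x)

  isPolynomial-monomial : ∀ a n → IsPolynomial (λ y → a * y ^ n)
  isPolynomial-monomial a n = con a :* power (var nothing) n , λ y → *-congˡ (sym (eval-power (var nothing) n (extend ⊥-elim y)))

  isPolynomial-horner : ∀ as → IsPolynomial (horner as)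
  isPolynomial-horner []       = con 0# , λ y → refl
  isPolynomial-horner (a ∷ as) =
    isPolynomial-+ (λ y → a * y ^ length as) (horner as) (isPolynomial-monomial a (length as)) (isPolynomial-horner as)

  private
    factorise-horner : ∀ (f : F → F) as → (∀ y → f y ≈ horner as y) → (∃[ y ] (¬ (f y ≈ 0#))) →
                       ∃[ a ] ∃[ αs ] (¬ (a ≈ 0#) × (∀ y → f y ≈ a * Π αs y))
    factorise-horner f [] f≈ (y , ≉0) = ⊥-elim (≉0 (f≈ y))
    factorise-horner f (a ∷ as) f≈ (y , ≉0) with em {P = a ≈ 0#}
    ... | yes a≈0 = factorise-horner f as (λ z → trans (f≈ z) (horner-drop as z a≈0)) (y , ≉0)
    ... | no  a≉0 with factorise a as a≉0
    ...   | αs , _ , eq = a , αs , a≉0 , λ z → trans (f≈ z) (eq z)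

    factorise′ : ∀ (f : F → F) → IsPolynomial f → (∃[ y ] (¬ (f y ≈ 0#))) →
                 ∃[ a ] ∃[ αs ] (¬ (a ≈ 0#) × (∀ y → f y ≈ a * Π αs y))
    factorise′ f (p , f≈) = factorise-horner f (map (λ q → eval R q ⊥-elim) (coefficients p))
      (λ y → trans (f≈ y) (sym (horner-coefficients p ⊥-elim y)))

  abstract
    -- Both functions split into linear factors up to a nonzero constant, and a non-root of the
    -- product of all these factors avoids both sets of roots.
    common-non-root : ∀ (f g : F → F) → IsPolynomial f → IsPolynomial g → (∃[ y ] (¬ (f y ≈ 0#))) → (∃[ y ] (¬ (g y ≈ 0#))) →
                      ∃[ y ] (¬ (f y ≈ 0#) × ¬ (g y ≈ 0#))
    common-non-root f g f-poly g-poly f≉0 g≉0 with factorise′ f f-poly f≉0 | factorise′ g g-poly g≉0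
    ... | a , αs , a≉0 , f≈ | b , βs , b≉0 , g≈ with Π-non-root (αs ++ βs)
    ...   | y , ≉0 = y
          , (λ fy≈0 → [ a≉0 , (λ α≈0 → ≉0 (trans (Π-++ αs βs y) (trans (*-congʳ α≈0) (zeroˡ _)))) ]′ (*-≈0 (trans (sym (f≈ y)) fy≈0)))
          , (λ gy≈0 → [ b≉0 , (λ β≈0 → ≉0 (trans (Π-++ αs βs y) (trans (*-congˡ β≈0) (zeroʳ _)))) ]′ (*-≈0 (trans (sym (g≈ y)) gy≈0)))

  minus-≈0 : ∀ {y z} → y - z ≈ 0# → y ≈ z
  minus-≈0 {y} {z} eq = trans (sym (solve 2 (λ y z → (y :- z) ⊹ z := y) refl y z)) (trans (+-congʳ eq) (+-identityˡ z))

  off-point : ∀ (f : F → F) → IsPolynomial f → (∃[ y ] (¬ (f y ≈ 0#))) → ∀ α → ∃[ y ] (¬ (f y ≈ 0#) × ¬ (y ≈ α))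
  off-point f f-poly f≉0 α with common-non-root f (Π (α ∷ [])) f-poly (isPolynomial-Π (α ∷ [])) f≉0 (Π-non-root (α ∷ []))
  ... | y , ≉0 , y≉α = y , ≉0 , λ y≈α → y≉α (trans (*-identityʳ _) (trans (+-congʳ y≈α) (-‿inverseʳ α)))

  -- Replaces the cancellation of a factor `y - α` from an identity of functions: the identity is
  -- divided at the other points and extends to `α`, since the difference has a non-root away from
  -- `α` unless it vanishes everywhere.
  agree-off-point : ∀ (f g : F → F) → IsPolynomial f → IsPolynomial g → ∀ α →
                    (∀ y → ¬ (y ≈ α) → f y ≈ g y) → ∀ y → f y ≈ g y
  agree-off-point f g f-poly g-poly α agree y = byContradiction λ f≉g →
    case off-point (λ y → f y - g y) (isPolynomial-- f g f-poly g-poly) (y , λ eq → f≉g (minus-≈0 eq)) α of λ (z , ≉0 , z≉α) →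
      ≉0 (trans (+-congʳ (agree z z≉α)) (-‿inverseʳ (g z)))

  abstract
    -- A degree argument: a list of n coefficients has degree below n, while a nonzero multiple of
    -- the product has at least degree `length αs`. Dividing by one linear factor shortens both
    -- lists.
    multiple-vanishes : ∀ αs as (g : F → F) → IsPolynomial g → length as ℕ.≤ length αs →
                        (∀ y → horner as y ≈ Π αs y * g y) → ∀ y → horner as y ≈ 0#
    multiple-vanishes αs [] g g-poly len eq y = refl
    multiple-vanishes (α ∷ αs) (a ∷ as) g g-poly (s≤s len) eq y = trans (division y)
        (trans (*-congˡ (multiple-vanishes αs (quotient α a as) g g-poly
                  (≡.subst (ℕ._≤ length αs) (≡.sym (length-quotient α a as)) len) reduced y)) (zeroʳ _))
      where
      division : ∀ y → horner (a ∷ as) y ≈ (y - α) * horner (quotient α a as) y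
      division = divide-root α a as (trans (eq α) (trans (*-congʳ (trans (*-congʳ (-‿inverseʳ α)) (zeroˡ _))) (zeroˡ _)))

      reduced : ∀ y → horner (quotient α a as) y ≈ Π αs y * g y
      reduced = agree-off-point (horner (quotient α a as)) (λ y → Π αs y * g y)
        (isPolynomial-horner (quotient α a as)) (isPolynomial-* (Π αs) g (isPolynomial-Π αs) g-poly) α
        λ z z≉α → case inverse (λ z-α≈0 → z≉α (minus-≈0 z-α≈0)) of λ (b , b*≈1) → begin
          horner (quotient α a as) z                       ≈⟨ *-identityˡ _ ⟨
          1# * horner (quotient α a as) z                  ≈⟨ *-congʳ b*≈1 ⟨
          b * (z - α) * horner (quotient α a as) z         ≈⟨ *-assoc _ _ _ ⟩
          b * ((z - α) * horner (quotient α a as) z)       ≈⟨ *-congˡ (trans (sym (division z)) (eq z)) ⟩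
          b * ((z - α) * Π αs z * g z)                     ≈⟨ *-congˡ (*-assoc _ _ _) ⟩
          b * ((z - α) * (Π αs z * g z))                   ≈⟨ *-assoc _ _ _ ⟨
          b * (z - α) * (Π αs z * g z)                     ≈⟨ *-congʳ b*≈1 ⟩
          1# * (Π αs z * g z)                              ≈⟨ *-identityˡ _ ⟩
          Π αs z * g z                                     ∎

    -- Every linear factor divides its own copy of `g`. Repeated roots need no care, because the
    -- exponent counts them with multiplicity.
    root-divides-power : ∀ αs (g : F → F) → IsPolynomial g → (∀ y → Π αs y ≈ 0# → g y ≈ 0#) →
                         ∃[ h ] (IsPolynomial h × (∀ y → g y ^ length αs ≈ Π αs y * h y))
    root-divides-power [] g g-poly _ = (λ _ → 1#) , (con 1# , λ y → refl) , λ y → sym (*-identityˡ 1#)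
    root-divides-power (α ∷ αs) g g-poly vanish
      with root-divides-power αs g g-poly (λ y ≈0 → vanish y (trans (*-congˡ ≈0) (zeroʳ _)))
         | divide g g-poly (vanish α (trans (*-congʳ (-‿inverseʳ α)) (zeroˡ _)))
      where
      divide-list : ∀ (g : F → F) as → (∀ y → g y ≈ horner as y) → g α ≈ 0# →
                    ∃[ q ] (IsPolynomial q × (∀ y → g y ≈ (y - α) * q y))
      divide-list g []       g≈ _  = (λ _ → 0#) , (con 0# , λ y → refl) , λ y → trans (g≈ y) (sym (zeroʳ _))
      divide-list g (a ∷ as) g≈ ≈0 = horner (quotient α a as) , isPolynomial-horner (quotient α a as) ,
        λ y → trans (g≈ y) (divide-root α a as (trans (sym (g≈ α)) ≈0) y)

      divide : ∀ (g : F → F) → IsPolynomial g → g α ≈ 0# → ∃[ q ] (IsPolynomial q × (∀ y → g y ≈ (y - α) * q y))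
      divide g (p , g≈) = divide-list g (map (λ q → eval R q ⊥-elim) (coefficients p))
        (λ y → trans (g≈ y) (sym (horner-coefficients p ⊥-elim y)))
    ... | h , h-poly , h≈ | q , q-poly , q≈ = (λ y → q y * h y) , isPolynomial-* q h q-poly h-poly , λ y →
          trans (*-cong (q≈ y) (h≈ y))
            (solve 4 (λ d q p h → (d ⊛ q) ⊛ (p ⊛ h) := (d ⊛ p) ⊛ (q ⊛ h)) refl (y - α) (q y) (Π αs y) (h y))


-- Zariski density and generic properties

module Density (em : ∀ {a} → ExcludedMiddle a) {c ℓ₁} (R : CommutativeRing c ℓ₁) (isField : IsField R)
               (closed : IsAlgebraicallyClosed R) where


  open CommutativeRing R hiding (zero) renaming (Carrier to F)
  open FieldTheory em R isField
  open DifferenceSolver R using (solve; _:=_) renaming (_:+_ to _⊹_; _:*_ to _⊛_; _:-_ to _⊖′_; con to constant)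
  open UnivariatePolynomials em R isField closed

  private variable
    X Y : Set
    p q : Level

  eval-cong : ∀ (f : Polynomial F X) {x y} → (∀ i → x i ≈ y i) → eval R f x ≈ eval R f y
  eval-cong (con a)  x≈y = refl
  eval-cong (var i)  x≈y = x≈y i
  eval-cong (f :+ g) x≈y = +-cong (eval-cong f x≈y) (eval-cong g x≈y)
  eval-cong (f :* g) x≈y = *-cong (eval-cong f x≈y) (eval-cong g x≈y)

  substitute : Polynomial F X → (X → Polynomial F Y) → Polynomial F Y
  substitute (con a)  σ = con a
  substitute (var i)  σ = σ i
  substitute (f :+ g) σ = substitute f σ :+ substitute g σ
  substitute (f :* g) σ = substitute f σ :* substitute g σ

  eval-substitute : ∀ (f : Polynomial F X) (σ : X → Polynomial F Y) y →
                    eval R (substitute f σ) y ≈ eval R f (λ i → eval R (σ i) y)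
  eval-substitute (con a)  σ y = refl
  eval-substitute (var i)  σ y = refl
  eval-substitute (f :+ g) σ y = +-cong (eval-substitute f σ y) (eval-substitute g σ y)
  eval-substitute (f :* g) σ y = *-cong (eval-substitute f σ y) (eval-substitute g σ y)

  Nonzero : Polynomial F X → Pred (X → F) _
  Nonzero f x = ¬ (eval R f x ≈ 0#)

  abstract
    -- Restrict to the line through the two points.
    nonzero-meet : ∀ (f g : Polynomial F X) {x₀ x₁} → Nonzero f x₀ → Nonzero g x₁ → ∃[ x ] (Nonzero f x × Nonzero g x)
    nonzero-meet {X} f g {x₀} {x₁} f≉0 g≉0 =
      let y , fy , gy = common-non-root (on f) (on g) (isPolynomial-eval (substitute f line) ⊥-elim) (isPolynomial-eval (substitute g line) ⊥-elim)
                          (0# , λ ≈0 → f≉0 (trans (sym (at f 0# x₀ at-0)) ≈0))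
                          (1# , λ ≈0 → g≉0 (trans (sym (at g 1# x₁ at-1)) ≈0))
      in  point y , (λ ≈0 → fy (trans (at f y (point y) λ i → refl) ≈0))
                  , (λ ≈0 → gy (trans (at g y (point y) λ i → refl) ≈0))
      where
      line : X → Polynomial F (Maybe ⊥)
      line i = con (x₀ i) :+ (var nothing :* con (x₁ i - x₀ i))

      on : Polynomial F X → F → F
      on h y = eval R (substitute h line) (extend ⊥-elim y)

      point : F → X → F
      point y i = x₀ i + y * (x₁ i - x₀ i)

      at : ∀ h y x → (∀ i → point y i ≈ x i) → on h y ≈ eval R h x
      at h y x eq = trans (eval-substitute h line (extend ⊥-elim y)) (eval-cong h eq)

      at-0 : ∀ i → point 0# i ≈ x₀ i
      at-0 i = trans (+-congˡ (zeroˡ _)) (+-identityʳ _)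

      at-1 : ∀ i → point 1# i ≈ x₁ i
      at-1 i = solve 2 (λ a b → a ⊹ constant (1 , 0) ⊛ (b ⊖′ a) := b) refl (x₀ i) (x₁ i)

  -- Principal open sets form a basis of the Zariski topology, so one nonzero polynomial is enough
  -- to witness a nonempty open subset.
  Generic : Pred (X → F) p → Set _
  Generic S = ∃[ f ] (∃ (Nonzero f) × Nonzero f ⊆ S)

  abstract
    generic-mono : {S : Pred (X → F) p} {T : Pred (X → F) q} → S ⊆ T → Generic S → Generic T
    generic-mono S⊆T (f , f≉0 , f⊆S) = f , f≉0 , λ x → S⊆T (f⊆S x)

    generic-∩ : {S : Pred (X → F) p} {T : Pred (X → F) q} → Generic S → Generic T → Generic (λ x → S x × T x)
    generic-∩ (f , (_ , fx) , f⊆S) (g , (_ , gx) , g⊆T) =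
        f :* g
      , (case nonzero-meet f g fx gx of λ (x , fx , gx) → x , *-≉0 fx gx)
      , λ fg≉0 → f⊆S (λ ≈0 → fg≉0 (trans (*-congʳ ≈0) (zeroˡ _))) , g⊆T (λ ≈0 → fg≉0 (trans (*-congˡ ≈0) (zeroʳ _)))

    generic-always : {S : Pred (X → F) p} → (∀ x → S x) → Generic S
    generic-always S-all = con 1# , ((λ _ → 0#) , 1≉0) , λ {x} _ → S-all x

    generic-point : {S : Pred (X → F) p} → Generic S → ∃ S
    generic-point (f , (x , fx) , f⊆S) = x , f⊆S fx

    generic-Fin : ∀ {n} {S : Fin n → Pred (X → F) p} → (∀ i → Generic (S i)) → Generic (λ x → ∀ i → S i x)
    generic-Fin {n = zero}  gen = generic-always λ x ()
    generic-Fin {n = suc n} gen = generic-mono (λ (s , ss) → λ { zero → s ; (suc i) → ss i })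
      (generic-∩ (gen zero) (generic-Fin (gen ∘ suc)))

    -- Surjectivity of the polynomial map keeps the pulled back polynomial from vanishing
    -- identically.
    generic-pullback : {S : Pred (Y → F) p} (σ : Y → Polynomial F X) →
                       (∀ (y : Y → F) → ∃[ x ] (∀ i → eval R (σ i) x ≈ y i)) →
                       Generic S → Generic (λ x → S (λ i → eval R (σ i) x))
    generic-pullback σ onto (f , (y , fy) , f⊆S) =
        substitute f σ
      , (case onto y of λ (x , eq) → x , λ ≈0 → fy (trans (sym (trans (eval-substitute f σ x) (eval-cong f eq))) ≈0))
      , λ {x} ≉0 → f⊆S λ ≈0 → ≉0 (trans (eval-substitute f σ x) ≈0)

    dense⇒ : {S : Pred (X → F) p} → ZariskiDense R S → ∀ f → (∀ {x} → S x → eval R f x ≈ 0#) → ∀ x → eval R f x ≈ 0#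
    dense⇒ dense f vanish x = dense (f ≡_) (λ {x} s → λ { _ ≡.refl → vanish s }) x f ≡.refl

    dense-mono : {S : Pred (X → F) p} {T : Pred (X → F) q} → S ⊆ T → ZariskiDense R S → ZariskiDense R T
    dense-mono S⊆T dense 𝒯 T⊆ = dense 𝒯 λ s → T⊆ (S⊆T s)

    -- If `h` vanishes on the intersection and `f` defines the open set, then `f :* h` vanishes on
    -- the dense set, hence everywhere; irreducibility leaves only `h` to vanish.
    dense-∩-generic : {S : Pred (X → F) p} {T : Pred (X → F) q} →
                      ZariskiDense R S → Generic T → ZariskiDense R (λ x → S x × T x)
    dense-∩-generic {S = S} {T} dense (f , (x₀ , fx₀) , f⊆T) 𝒯 ⊆𝒯 x h h∈𝒯 = byContradiction λ hx≉0 →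
      case nonzero-meet f h fx₀ hx≉0 of λ (y , fy , hy) →
        *-≉0 fy hy (dense⇒ dense (f :* h) (λ {z} z∈S → product-vanishes z z∈S) y)
      where
      product-vanishes : ∀ z → S z → eval R f z * eval R h z ≈ 0#
      product-vanishes z z∈S with em {P = eval R f z ≈ 0#}
      ... | yes fz≈0 = trans (*-congʳ fz≈0) (zeroˡ _)
      ... | no  fz≉0 = trans (*-congˡ (⊆𝒯 (z∈S , f⊆T fz≉0) h h∈𝒯)) (zeroʳ _)

    dense-meets-generic : {S : Pred (X → F) p} {T : Pred (X → F) q} → ZariskiDense R S → Generic T → ∃[ x ] (S x × T x)
    dense-meets-generic {S = S} {T} dense gen = byContradiction λ none →
      1≉0 (dense⇒ (dense-∩-generic dense gen) (con 1#) (λ {x} x∈ → ⊥-elim (none (x , x∈))) (λ _ → 0#))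

    ¬dense⇒generic-¬ : {S : Pred (X → F) p} → ¬ ZariskiDense R S → Generic (λ x → ¬ S x)
    ¬dense⇒generic-¬ {S = S} ¬dense = byContradiction λ ¬gen → ¬dense λ 𝒯 S⊆𝒯 x f f∈𝒯 →
      byContradiction λ fx≉0 → ¬gen (f , (x , fx≉0) , λ {y} fy≉0 y∈S → fy≉0 (S⊆𝒯 y∈S f f∈𝒯))


-- Constructible sets

module QuantifierElimination (em : ∀ {a} → ExcludedMiddle a) {c ℓ₁} (R : CommutativeRing c ℓ₁) (isField : IsField R)
                             (closed : IsAlgebraicallyClosed R) where


  open CommutativeRing R hiding (zero) renaming (Carrier to F)
  open FieldTheory em R isField
  open DifferenceSolver R using (solve; _:=_; :-_) renaming (_:+_ to _⊹_; _:*_ to _⊛_; _:-_ to _⊖′_; con to constant)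
  open UnivariatePolynomials em R isField closed
  open Density em R isField closed
  open SemiringExp semiring using (_^_; ^-homo-*)

  private variable
    X Y : Set
    p q : Level

  infix 3 _⇔_
  _⇔_ : ∀ {a b} → Set a → Set b → Set (a ⊔ b)
  A ⇔ B = (A → B) × (B → A)

  data QuantifierFree (X : Set) : Set c where
    vanishes : Polynomial F X → QuantifierFree X
    negation      : QuantifierFree X → QuantifierFree X
    conjunction : QuantifierFree X → QuantifierFree X → QuantifierFree X

  Holds : QuantifierFree X → Pred (X → F) ℓ₁
  Holds (vanishes f) x = eval R f x ≈ 0#
  Holds (negation φ)      x = ¬ Holds φ x
  Holds (conjunction φ ψ)    x = Holds φ x × Holds ψ x

  -- Only equivalence with a formula is asked for, so a set defined by a quantifier over subspaces,
  -- which lives in a larger universe, can be constructible too.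
  Constructible : Pred (X → F) p → Set _
  Constructible {X} S = ∃[ φ ] (∀ x → S x ⇔ Holds {X} φ x)

  con-cong : {S : Pred (X → F) p} {T : Pred (X → F) q} → (∀ x → S x ⇔ T x) → Constructible S → Constructible T
  con-cong S⇔T (φ , φ⇔) = φ , λ x → proj₁ (φ⇔ x) ∘ proj₂ (S⇔T x) , proj₁ (S⇔T x) ∘ proj₂ (φ⇔ x)

  con-vanishes : (f : Polynomial F X) → Constructible (λ x → eval R f x ≈ 0#)
  con-vanishes f = vanishes f , λ x → id , id

  con-¬ : {S : Pred (X → F) p} → Constructible S → Constructible (λ x → ¬ S x)
  con-¬ (φ , φ⇔) = negation φ , λ x → _∘ proj₂ (φ⇔ x) , _∘ proj₁ (φ⇔ x)

  con-∩ : {S : Pred (X → F) p} {T : Pred (X → F) q} → Constructible S → Constructible T → Constructible (λ x → S x × T x)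
  con-∩ (φ , φ⇔) (ψ , ψ⇔) = conjunction φ ψ , λ x →
    (λ (s , t) → proj₁ (φ⇔ x) s , proj₁ (ψ⇔ x) t) , (λ (s , t) → proj₂ (φ⇔ x) s , proj₂ (ψ⇔ x) t)

  con-⊎ : {S : Pred (X → F) p} {T : Pred (X → F) q} → Constructible S → Constructible T → Constructible (λ x → S x ⊎ T x)
  con-⊎ s t = con-cong (λ x →
      (λ ¬both → byContradiction λ none → ¬both ((λ s → none (inj₁ s)) , (λ t → none (inj₂ t)))) ,
      (λ { (inj₁ s) (¬s , _) → ¬s s ; (inj₂ t) (_ , ¬t) → ¬t t }))
    (con-¬ (con-∩ (con-¬ s) (con-¬ t)))

  con-→ : {S : Pred (X → F) p} {T : Pred (X → F) q} → Constructible S → Constructible T → Constructible (λ x → S x → T x)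
  con-→ s t = con-cong (λ x →
      (λ ¬bad s → byContradiction λ ¬t → ¬bad (s , ¬t)) , (λ f (s , ¬t) → ¬t (f s)))
    (con-¬ (con-∩ s (con-¬ t)))

  con-true : Constructible {X} (λ _ → ⊤ {0ℓ})
  con-true = con-cong (λ x → (λ _ → tt) , (λ _ → refl)) (con-vanishes (con 0#))

  con-constant : ∀ {a} (A : Set a) → Constructible {X} (λ _ → A)
  con-constant A with em {P = A}
  ... | yes a = con-cong (λ x → (λ _ → a) , (λ _ → tt)) con-true
  ... | no ¬a = con-cong (λ x → (λ ¬t → ⊥-elim (¬t tt)) , (λ a → ⊥-elim (¬a a))) (con-¬ con-true)

  con-All : ∀ {a} {A : Set a} {S : A → Pred (X → F) p} → (∀ i → Constructible (S i)) → ∀ is →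
            Constructible (λ x → All (λ i → S i x) is)
  con-All s []       = con-cong (λ x → (λ _ → []) , (λ _ → tt)) con-true
  con-All s (i ∷ is) = con-cong (λ x → (λ (s , ss) → s ∷ ss) , (λ { (s ∷ ss) → s , ss })) (con-∩ (s i) (con-All s is))

  con-Any : ∀ {a} {A : Set a} {S : A → Pred (X → F) p} → (∀ i → Constructible (S i)) → ∀ is →
            Constructible (λ x → Any (λ i → S i x) is)
  con-Any s []       = con-cong (λ x → (λ ¬t → ⊥-elim (¬t tt)) , (λ ())) (con-¬ con-true)
  con-Any s (i ∷ is) = con-cong (λ x → (λ { (inj₁ s) → here s ; (inj₂ ss) → there ss })
                                     , (λ { (here s) → inj₁ s ; (there ss) → inj₂ ss })) (con-⊎ (s i) (con-Any s is))

  con-substitute : {S : Pred (Y → F) p} (σ : Y → Polynomial F X) → Constructible S →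
                   Constructible (λ x → S (λ i → eval R (σ i) x))
  con-substitute {Y = Y} {X = X} σ (φ , φ⇔) = σ* φ , λ x →
      (λ s → proj₁ (σ*-holds φ x) (proj₁ (φ⇔ _) s)) , (λ h → proj₂ (φ⇔ _) (proj₂ (σ*-holds φ x) h))
    where
    σ* : QuantifierFree Y → QuantifierFree X
    σ* (vanishes f) = vanishes (substitute f σ)
    σ* (negation φ)      = negation (σ* φ)
    σ* (conjunction φ ψ)    = conjunction (σ* φ) (σ* ψ)

    σ*-holds : ∀ φ x → Holds φ (λ i → eval R (σ i) x) ⇔ Holds (σ* φ) x
    σ*-holds (vanishes f) x = trans (eval-substitute f σ x) , trans (sym (eval-substitute f σ x))
    σ*-holds (negation φ)      x = _∘ proj₂ (σ*-holds φ x) , _∘ proj₁ (σ*-holds φ x)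
    σ*-holds (conjunction φ ψ)    x = (λ (s , t) → proj₁ (σ*-holds φ x) s , proj₁ (σ*-holds ψ x) t)
                            , (λ (s , t) → proj₂ (σ*-holds φ x) s , proj₂ (σ*-holds ψ x) t)

  -- Points are functions, compared pointwise, and a formula reads only their values; this takes the
  -- place of function extensionality.
  con-resp : {S : Pred (X → F) p} → Constructible S → ∀ {x y} → (∀ i → x i ≈ y i) → S x → S y
  con-resp {X = X} (φ , φ⇔) {x} {y} x≈y s = proj₂ (φ⇔ y) (proj₁ (go φ x≈y) (proj₁ (φ⇔ x) s))
    where
    go : ∀ φ {x y : X → F} → (∀ i → x i ≈ y i) → Holds φ x ⇔ Holds φ y
    go (vanishes f) x≈y = trans (sym (eval-cong f x≈y)) , trans (eval-cong f x≈y)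
    go (negation φ)      x≈y = _∘ proj₂ (go φ x≈y) , _∘ proj₁ (go φ x≈y)
    go (conjunction φ ψ)    x≈y = (λ (s , t) → proj₁ (go φ x≈y) s , proj₁ (go ψ x≈y) t)
                        , (λ (s , t) → proj₂ (go φ x≈y) s , proj₂ (go ψ x≈y) t)

  abstract
    -- By induction on the formula: a polynomial either vanishes identically or is nonzero on a
    -- nonempty open set, and irreducibility of affine space handles the conjunction.
    con-generic : {S : Pred (X → F) p} → Constructible S → Generic S ⊎ Generic (λ x → ¬ S x)
    con-generic {X = X} (φ , φ⇔) = Sum.map (generic-mono λ {x} → proj₂ (φ⇔ x)) (generic-mono λ {x} → _∘ proj₁ (φ⇔ x)) (go φ)
      where
      go : ∀ (φ : QuantifierFree X) → Generic (Holds φ) ⊎ Generic (λ x → ¬ Holds φ x)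
      go (vanishes f) with em {P = ∃ (Nonzero f)}
      ... | yes f≉0 = inj₂ (f , f≉0 , id)
      ... | no  f≈0 = inj₁ (generic-always λ x → byContradiction λ ≉0 → f≈0 (x , ≉0))
      go (negation φ) with go φ
      ... | inj₁ gen = inj₂ (generic-mono (λ h ¬h → ¬h h) gen)
      ... | inj₂ gen = inj₁ gen
      go (conjunction φ ψ) with go φ | go ψ
      ... | inj₁ gen | inj₁ gen′ = inj₁ (generic-∩ gen gen′)
      ... | inj₂ gen | _         = inj₂ (generic-mono (λ ¬h (h , _) → ¬h h) gen)
      ... | inj₁ _   | inj₂ gen  = inj₂ (generic-mono (λ ¬h (_ , h) → ¬h h) gen)

    con-dense⇒generic : {S : Pred (X → F) p} → Constructible S → ZariskiDense R S → Generic S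
    con-dense⇒generic s dense with con-generic s
    ... | inj₁ gen = gen
    ... | inj₂ gen with dense-meets-generic dense gen
    ...   | x , s∈ , s∉ = ⊥-elim (s∉ s∈)

  -- Elimination of one variable by pseudo-division

  private
    at : (X → F) → List (Polynomial F X) → List F
    at x = map (λ f → eval R f x)

    length-at : ∀ (x : X → F) as → length (at x as) ≡ length as
    length-at x as = List.length-map _ as

    -- b * as - a * bs, with bs shifted to the degree of as.
    cancelLeading : Polynomial F X → Polynomial F X → List (Polynomial F X) → List (Polynomial F X) → List (Polynomial F X)
    cancelLeading a b as        []        = map (b :*_) as
    cancelLeading a b []        (b′ ∷ bs) = []
    cancelLeading a b (a′ ∷ as) (b′ ∷ bs) = (b :* a′) :+ (con (- 1#) :* (a :* b′)) ∷ cancelLeading a b as bs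

    length-cancelLeading : ∀ (a b : Polynomial F X) as bs → length (cancelLeading a b as bs) ≡ length as
    length-cancelLeading a b as        []        = List.length-map _ as
    length-cancelLeading a b []        (b′ ∷ bs) = ≡.refl
    length-cancelLeading a b (a′ ∷ as) (b′ ∷ bs) = ≡.cong suc (length-cancelLeading a b as bs)

    horner-cancelLeading : ∀ (a b : Polynomial F X) as bs → length bs ℕ.≤ length as → ∀ x y →
      horner (at x (cancelLeading a b as bs)) y ≈
        eval R b x * horner (at x as) y - eval R a x * (y ^ (length as ∸ length bs) * horner (at x bs) y)
    horner-cancelLeading a b []        [] _ x y =
      solve 3 (λ a b t → constant (0 , 0) := b ⊛ constant (0 , 0) ⊖′ a ⊛ (t ⊛ constant (0 , 0))) refl _ _ (y ^ 0)
    horner-cancelLeading a b (a′ ∷ as) [] _ x y rewrite length-at x (map (b :*_) as) | List.length-map (b :*_) as | length-at x as =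
      trans (+-congˡ (horner-cancelLeading a b as [] z≤n x y))
        (solve 7 (λ a b a′ p t t′ h → (b ⊛ a′) ⊛ p ⊹ (b ⊛ h ⊖′ a ⊛ (t ⊛ constant (0 , 0)))
                   := b ⊛ (a′ ⊛ p ⊹ h) ⊖′ a ⊛ (t′ ⊛ constant (0 , 0))) refl
           (eval R a x) (eval R b x) (eval R a′ x) (y ^ length as) (y ^ length as) (y ^ suc (length as)) (horner (at x as) y))
    horner-cancelLeading a b (a′ ∷ as) (b′ ∷ bs) (s≤s bs≤as) x y
      rewrite length-at x (cancelLeading a b as bs) | length-cancelLeading a b as bs | length-at x as | length-at x bs =
      trans (+-congˡ (horner-cancelLeading a b as bs bs≤as x y))
      (trans (+-congʳ (*-congˡ splitting))
      (trans (solve 8 (λ a b a′ b′ d m h h′ → (b ⊛ a′ ⊹ :- constant (1 , 0) ⊛ (a ⊛ b′)) ⊛ (d ⊛ m) ⊹ (b ⊛ h ⊖′ a ⊛ (d ⊛ h′))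
                 := b ⊛ (a′ ⊛ (d ⊛ m) ⊹ h) ⊖′ a ⊛ (d ⊛ (b′ ⊛ m ⊹ h′))) refl
              (eval R a x) (eval R b x) (eval R a′ x) (eval R b′ x) (y ^ (length as ∸ length bs)) (y ^ length bs)
              (horner (at x as) y) (horner (at x bs) y))
        (+-congʳ (*-congˡ (+-congʳ (*-congˡ (sym splitting)))))))
      where
      splitting : y ^ length as ≈ y ^ (length as ∸ length bs) * y ^ length bs
      splitting = trans (reflexive (≡.cong (y ^_) (≡.sym (ℕ.m∸n+n≡m bs≤as)))) (^-homo-* y (length as ∸ length bs) (length bs))

    abstract
     -- With the leading coefficients put back on both sides, the two top terms cancel; so the
     -- shorter list still represents the whole combination.
     cancelLeading-spec : ∀ (a b : Polynomial F X) as bs → length bs ℕ.≤ length as → ∀ x y →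
      horner (at x (cancelLeading a b as bs)) y ≈
        eval R b x * horner (at x (a ∷ as)) y - eval R a x * (y ^ (length as ∸ length bs) * horner (at x (b ∷ bs)) y)
     cancelLeading-spec a b as bs bs≤as x y rewrite length-at x as | length-at x bs =
      trans (horner-cancelLeading a b as bs bs≤as x y)
      (trans (solve 6 (λ a b d m h h′ → b ⊛ h ⊖′ a ⊛ (d ⊛ h′) := b ⊛ (a ⊛ (d ⊛ m) ⊹ h) ⊖′ a ⊛ (d ⊛ (b ⊛ m ⊹ h′))) refl
                (eval R a x) (eval R b x) (y ^ (length as ∸ length bs)) (y ^ length bs) (horner (at x as) y) (horner (at x bs) y))
        (+-congʳ (*-congˡ (+-congʳ (*-congˡ (trans (sym (^-homo-* y (length as ∸ length bs) (length bs)))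
          (reflexive (≡.cong (y ^_) (ℕ.m∸n+n≡m bs≤as)))))))))

    abstract
      division-step : ∀ b bk C c d f {h q r} → bk * h ≈ f * q + r → h ≈ b * C - c * (d * f) →
                      (b * bk) * C ≈ f * (bk * (c * d) + q) + r
      division-step b bk C c d f {h} {q} {r} eq eq′ = trans
        (solve 6 (λ b bk C c d f → (b ⊛ bk) ⊛ C := bk ⊛ (b ⊛ C ⊖′ c ⊛ (d ⊛ f)) ⊹ f ⊛ (bk ⊛ (c ⊛ d))) refl b bk C c d f)
        (trans (+-congʳ (trans (*-congˡ (sym eq′)) eq))
          (solve 4 (λ f q r t → (f ⊛ q ⊹ r) ⊹ f ⊛ t := f ⊛ (t ⊹ q) ⊹ r) refl f q r (bk * (c * d))))

    -- Multiplying by a power of the leading coefficient avoids division by it. Thus one list `r` of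
    -- polynomials can serve all points `x`, whereas `k` and `q` may depend on the point.
    IsPseudoRemainder : Polynomial F X → (bs cs r : List (Polynomial F X)) → (X → F) → Set _
    IsPseudoRemainder b bs cs r x = ∃[ k ] ∃[ q ] (IsPolynomial q ×
      (∀ y → eval R b x ^ k * horner (at x cs) y ≈ horner (at x (b ∷ bs)) y * q y + horner (at x r) y))

    reduce : ∀ (b c : Polynomial F X) bs cs {r} x → length bs ℕ.≤ length cs →
             IsPseudoRemainder b bs (cancelLeading c b cs bs) r x → IsPseudoRemainder b bs (c ∷ cs) r x
    reduce b c bs cs x bs≤cs (k , q , q-poly , eq) =
        suc k
      , (λ y → eval R b x ^ k * (eval R c x * y ^ (length cs ∸ length bs)) + q y)
      , isPolynomial-+ (λ y → eval R b x ^ k * (eval R c x * y ^ (length cs ∸ length bs))) q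
          (isPolynomial-* (λ _ → eval R b x ^ k) (λ y → eval R c x * y ^ (length cs ∸ length bs))
            (con (eval R b x ^ k) , λ y → refl) (isPolynomial-monomial (eval R c x) (length cs ∸ length bs))) q-poly
      , λ y → division-step (eval R b x) (eval R b x ^ k) (horner (at x (c ∷ cs)) y) (eval R c x)
                (y ^ (length cs ∸ length bs)) (horner (at x (b ∷ bs)) y) (eq y) (cancelLeading-spec c b cs bs bs≤cs x y)

    abstract
      pseudoRemainder : ∀ n (b : Polynomial F X) bs cs → length cs ℕ.≤ n →
        ∃[ r ] (length r ℕ.≤ length bs × (∀ x → IsPseudoRemainder b bs cs r x))
      pseudoRemainder n b bs cs cs≤n with length cs ℕ.≤? length bs
      ... | yes short = cs , short , λ x → 0 , (λ _ → 0#) , (con 0# , λ y → refl) , λ y →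
            trans (*-identityˡ _) (sym (trans (+-congʳ (zeroʳ _)) (+-identityˡ _)))
      pseudoRemainder n b bs [] cs≤n | no long = ⊥-elim (long z≤n)
      pseudoRemainder (suc n) b bs (c ∷ cs) (s≤s cs≤n) | no long =
        let r , short , spec = pseudoRemainder n b bs (cancelLeading c b cs bs)
                                 (≡.subst (ℕ._≤ n) (≡.sym (length-cancelLeading c b cs bs)) cs≤n)
        in  r , short , λ x → reduce b c bs cs {r} x (ℕ.≤-pred (ℕ.≰⇒> long)) (spec x)

    ^-≉0 : ∀ {a} n → ¬ (a ≈ 0#) → ¬ (a ^ n ≈ 0#)
    ^-≉0 zero    a≉0 = 1≉0
    ^-≉0 (suc n) a≉0 = *-≉0 a≉0 (^-≉0 n a≉0)

    -- A single inequation is general enough, since inequations can be multiplied. The equations are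
    -- coefficient lists, because the recursion runs over their lengths and not over actual degrees.
    Solvable : List (List (Polynomial F X)) → Polynomial F (Maybe X) → Pred (X → F) (c ⊔ ℓ₁)
    Solvable fs g x = ∃[ y ] (All (λ f → horner (at x f) y ≈ 0#) fs × Nonzero g (extend x y))

    ZeroPolynomial : List (Polynomial F X) → Pred (X → F) (c ⊔ ℓ₁)
    ZeroPolynomial f x = All (λ p → eval R p x ≈ 0#) f

    con-zero : ∀ (f : List (Polynomial F X)) → Constructible (ZeroPolynomial f)
    con-zero = con-All con-vanishes

    zero-horner : ∀ {f : List (Polynomial F X)} {x} → ZeroPolynomial f x → ∀ y → horner (at x f) y ≈ 0#
    zero-horner z = horner-zeros (All.map⁺ z)

    horner-zero : ∀ (f : List (Polynomial F X)) {x} → (∀ y → horner (at x f) y ≈ 0#) → ZeroPolynomial f x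
    horner-zero f v = All.map⁻ (vanishing-zeros _ v)

    con-solvable-[] : ∀ (g : Polynomial F (Maybe X)) → Constructible (Solvable [] g)
    con-solvable-[] g = con-cong
      (λ x → (λ ¬z → byContradiction λ none → ¬z (horner-zero (coefficients g) λ y →
                trans (horner-coefficients g x y) (byContradiction λ ≉0 → none (y , [] , ≉0))))
           , (λ (y , _ , ≉0) z → ≉0 (trans (sym (horner-coefficients g x y)) (zero-horner z y))))
      (con-¬ (con-zero (coefficients g)))

    -- A nonzero f of degree n has a root outside the zero set of g iff f does not divide g ^ n.
    module _ (a : Polynomial F X) (as : List (Polynomial F X)) (g : Polynomial F (Maybe X)) where

      private
        gⁿ = power g (length as)
        remainder = pseudoRemainder (length (coefficients gⁿ)) a as (coefficients gⁿ) ℕ.≤-refl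
        r = proj₁ remainder

      horner-gⁿ : ∀ x y → horner (at x (coefficients gⁿ)) y ≈ eval R g (extend x y) ^ length as
      horner-gⁿ x y = trans (horner-coefficients gⁿ x y) (eval-power g (length as) (extend x y))

      abstract
        -- At a root of the first polynomial the division identity says that the remainder equals a
        -- power of `a` times a power of `g`, and both are nonzero there.
        solvable⇒remainder : ∀ {x} → ¬ (eval R a x ≈ 0#) → Solvable ((a ∷ as) ∷ []) g x → ¬ ZeroPolynomial r x
        solvable⇒remainder {x} a≉0 (y , f≈0 ∷ [] , g≉0) z with proj₂ (proj₂ remainder) x
        ... | k , q , _ , eq = *-≉0 (^-≉0 k a≉0) (λ ≈0 → ^-≉0 (length as) g≉0 (trans (sym (horner-gⁿ x y)) ≈0))
              (trans (eq y) (trans (+-cong (trans (*-congʳ f≈0) (zeroˡ (q y))) (zero-horner z y)) (+-identityˡ 0#)))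

        remainder⇒solvable : ∀ {x} → ¬ (eval R a x ≈ 0#) → ¬ ZeroPolynomial r x → Solvable ((a ∷ as) ∷ []) g x
        remainder⇒solvable {x} a≉0 ¬z = byContradiction λ none →
          let αs , len , fac = factorise (eval R a x) (at x as) a≉0
              length-αs : length αs ≡ length as
              length-αs = ≡.trans len (length-at x as)
              vanish : ∀ y → Π αs y ≈ 0# → eval R g (extend x y) ≈ 0#
              vanish y Π≈0 = byContradiction λ g≉0 →
                none (y , trans (fac y) (trans (*-congˡ Π≈0) (zeroʳ (eval R a x))) ∷ [] , g≉0)
              h , h-poly , gⁿ≈ = root-divides-power αs (λ y → eval R g (extend x y)) (isPolynomial-eval g x) vanish
              k , q , q-poly , eq = proj₂ (proj₂ remainder) x
              aᵏ = eval R a x ^ k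
              -- The division identity aᵏ gⁿ = f q + r is combined with f = a Π and gⁿ = Π h: this
              -- gives r = Π (aᵏ h - a q). Since `r` has at most as many coefficients as there are
              -- factors in Π, it vanishes.
              multiple : F → F
              multiple y = aᵏ * h y - eval R a x * q y
              multiple-poly : IsPolynomial multiple
              multiple-poly = isPolynomial-- (λ y → aᵏ * h y) (λ y → eval R a x * q y)
                (isPolynomial-* (λ _ → aᵏ) h (con aᵏ , λ y → refl) h-poly)
                (isPolynomial-* (λ _ → eval R a x) q (con (eval R a x) , λ y → refl) q-poly)
              r≈ : ∀ y → horner (at x r) y ≈ Π αs y * multiple y
              r≈ y = rearrange aᵏ (eval R a x) (Π αs y) (h y) (q y)
                (trans (*-congˡ (trans (sym (gⁿ≈ y)) (trans (reflexive (≡.cong (eval R g (extend x y) ^_) length-αs)) (sym (horner-gⁿ x y)))))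
                  (trans (eq y) (+-congʳ (*-congʳ (fac y)))))
          in  ¬z (horner-zero r (multiple-vanishes αs (at x r) multiple multiple-poly
                (≡.subst₂ ℕ._≤_ (≡.sym (length-at x r)) (≡.sym length-αs) (proj₁ (proj₂ remainder))) r≈))
          where
          rearrange : ∀ b a P h q {t} → b * (P * h) ≈ a * P * q + t → t ≈ P * (b * h - a * q)
          rearrange b a P h q {t} eq = trans
            (solve 2 (λ t s → t := (s ⊹ t) ⊖′ s) refl t (a * P * q))
            (trans (+-congʳ (sym eq))
              (solve 5 (λ b a P h q → b ⊛ (P ⊛ h) ⊖′ a ⊛ P ⊛ q := P ⊛ (b ⊛ h ⊖′ a ⊛ q)) refl b a P h q))

      con-solvable-single : Constructible (Solvable (as ∷ []) g) → Constructible (Solvable ((a ∷ as) ∷ []) g)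
      con-solvable-single tail = con-cong
        (λ x → (λ { (inj₁ (a≈0 , y , t ∷ [] , g≉0)) → y , trans (horner-drop (at x as) y a≈0) t ∷ [] , g≉0
                  ; (inj₂ (a≉0 , ¬z)) → remainder⇒solvable a≉0 ¬z })
             , (λ s → split s (em {P = eval R a x ≈ 0#})))
        (con-⊎ (con-∩ (con-vanishes a) tail) (con-∩ (con-¬ (con-vanishes a)) (con-¬ (con-zero r))))
        where
        split : ∀ {x} → Solvable ((a ∷ as) ∷ []) g x → Dec (eval R a x ≈ 0#) →
                (eval R a x ≈ 0# × Solvable (as ∷ []) g x) ⊎ (¬ (eval R a x ≈ 0#) × ¬ ZeroPolynomial r x)
        split {x} (y , t ∷ [] , g≉0) (yes a≈0) = inj₁ (a≈0 , y , trans (sym (horner-drop (at x as) y a≈0)) t ∷ [] , g≉0)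
        split     s                  (no  a≉0) = inj₂ (a≉0 , solvable⇒remainder a≉0 s)

    -- Every list counts one more than its length, so that discarding an empty list, the zero
    -- polynomial, is also progress.
    size : List (List (Polynomial F X)) → ℕ
    size = sum ∘ map (suc ∘ length)

    -- A step of the Euclidean algorithm on formulas. Where `b` vanishes, the second polynomial is
    -- replaced by the shorter `bs`; elsewhere, modulo the second equation, the first may be
    -- multiplied by `b` and replaced by the shorter `cancelLeading`.
    con-solvable-pair : ∀ (a b : Polynomial F X) as bs fs g → length bs ℕ.≤ length as →
                        Constructible (Solvable ((a ∷ as) ∷ bs ∷ fs) g) →
                        Constructible (Solvable (cancelLeading a b as bs ∷ (b ∷ bs) ∷ fs) g) →
                        Constructible (Solvable ((a ∷ as) ∷ (b ∷ bs) ∷ fs) g)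
    con-solvable-pair a b as bs fs g bs≤as tail cancelled = con-cong
      (λ x → (λ { (inj₁ (b≈0 , y , s ∷ t ∷ ts , g≉0)) → y , s ∷ trans (horner-drop (at x bs) y b≈0) t ∷ ts , g≉0
                ; (inj₂ (b≉0 , y , s ∷ t ∷ ts , g≉0)) → y , backward x y b≉0 t s ∷ t ∷ ts , g≉0 })
           , (λ s → split s (em {P = eval R b x ≈ 0#})))
      (con-⊎ (con-∩ (con-vanishes b) tail) (con-∩ (con-¬ (con-vanishes b)) cancelled))
      where
      spec : ∀ x y → horner (at x (b ∷ bs)) y ≈ 0# →
             horner (at x (cancelLeading a b as bs)) y ≈ eval R b x * horner (at x (a ∷ as)) y
      spec x y t = trans (cancelLeading-spec a b as bs bs≤as x y)
        (trans (+-congˡ (trans (-‿cong (trans (*-congˡ (trans (*-congˡ t) (zeroʳ (y ^ (length as ∸ length bs))))) (zeroʳ (eval R a x)))) -0#≈0#))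
          (+-identityʳ (eval R b x * horner (at x (a ∷ as)) y)))
        where open RingProperties ring using (-0#≈0#)

      forward : ∀ x y → horner (at x (b ∷ bs)) y ≈ 0# → horner (at x (a ∷ as)) y ≈ 0# →
                horner (at x (cancelLeading a b as bs)) y ≈ 0#
      forward x y t s = trans (spec x y t) (trans (*-congˡ s) (zeroʳ (eval R b x)))

      backward : ∀ x y → ¬ (eval R b x ≈ 0#) → horner (at x (b ∷ bs)) y ≈ 0# →
                 horner (at x (cancelLeading a b as bs)) y ≈ 0# → horner (at x (a ∷ as)) y ≈ 0#
      backward x y b≉0 t s = byContradiction λ ≉0 → *-≉0 b≉0 ≉0 (trans (sym (spec x y t)) s)

      split : ∀ {x} → Solvable ((a ∷ as) ∷ (b ∷ bs) ∷ fs) g x → Dec (eval R b x ≈ 0#) →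
              (eval R b x ≈ 0# × Solvable ((a ∷ as) ∷ bs ∷ fs) g x) ⊎
              (¬ (eval R b x ≈ 0#) × Solvable (cancelLeading a b as bs ∷ (b ∷ bs) ∷ fs) g x)
      split {x} (y , s ∷ t ∷ ts , g≉0) (yes b≈0) =
        inj₁ (b≈0 , y , s ∷ trans (sym (horner-drop (at x bs) y b≈0)) t ∷ ts , g≉0)
      split {x} (y , s ∷ t ∷ ts , g≉0) (no b≉0)  = inj₂ (b≉0 , y , forward x y t s ∷ t ∷ ts , g≉0)

    con-solvable : ∀ n (fs : List (List (Polynomial F X))) g → size fs ℕ.≤ n → Constructible (Solvable fs g)
    con-solvable n [] g _ = con-solvable-[] g
    con-solvable (suc n) ([] ∷ fs) g (s≤s size≤n) = con-cong
      (λ x → (λ (y , ts , g≉0) → y , refl ∷ ts , g≉0) , (λ { (y , _ ∷ ts , g≉0) → y , ts , g≉0 })) (con-solvable n fs g size≤n)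
    con-solvable (suc n) ((a ∷ as) ∷ []) g (s≤s size≤n) = con-solvable-single a as g (con-solvable n (as ∷ []) g size≤n)
    con-solvable (suc n) ((a ∷ as) ∷ [] ∷ fs) g (s≤s size≤n) = con-cong
      (λ x → (λ { (y , s ∷ ts , g≉0) → y , s ∷ refl ∷ ts , g≉0 }) , (λ { (y , s ∷ _ ∷ ts , g≉0) → y , s ∷ ts , g≉0 }))
      (con-solvable n ((a ∷ as) ∷ fs) g (≡.subst (ℕ._≤ n) (ℕ.+-suc (suc (length as)) (size fs)) size≤n))
    con-solvable (suc n) ((a ∷ as) ∷ (b ∷ bs) ∷ fs) g (s≤s size≤n) with ℕ.≤-total (length bs) (length as)
    ... | inj₁ bs≤as = con-solvable-pair a b as bs fs g bs≤as
          (con-solvable n ((a ∷ as) ∷ bs ∷ fs) g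
            (≡.subst (ℕ._≤ n) (ℕ.+-suc (suc (length as)) (suc (length bs) ℕ.+ size fs)) size≤n))
          (con-solvable n (cancelLeading a b as bs ∷ (b ∷ bs) ∷ fs) g
            (≡.subst (λ l → suc l ℕ.+ size ((b ∷ bs) ∷ fs) ℕ.≤ n) (≡.sym (length-cancelLeading a b as bs)) size≤n))
    ... | inj₂ as≤bs = con-cong
          (λ x → (λ { (y , t ∷ s ∷ ts , g≉0) → y , s ∷ t ∷ ts , g≉0 }) , (λ { (y , s ∷ t ∷ ts , g≉0) → y , t ∷ s ∷ ts , g≉0 }))
          (con-solvable-pair b a bs as fs g as≤bs
            (con-solvable n ((b ∷ bs) ∷ as ∷ fs) g (≡.subst (ℕ._≤ n) swap₁ size≤n))
            (con-solvable n (cancelLeading b a bs as ∷ (a ∷ as) ∷ fs) g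
              (≡.subst (λ l → suc l ℕ.+ size ((a ∷ as) ∷ fs) ℕ.≤ n) (≡.sym (length-cancelLeading b a bs as))
                (≡.subst (ℕ._≤ n) swap₂ size≤n))))
      where
      open import Data.Nat.Solver using (module +-*-Solver)
      open +-*-Solver using () renaming (solve to solveℕ; _:+_ to _⊕ℕ_; _:=_ to _⊜ℕ_; con to conℕ)
      swap₁ : suc (length as) ℕ.+ (suc (suc (length bs)) ℕ.+ size fs) ≡ suc (suc (length bs)) ℕ.+ (suc (length as) ℕ.+ size fs)
      swap₁ = solveℕ 3 (λ a b s → (conℕ 1 ⊕ℕ a) ⊕ℕ ((conℕ 2 ⊕ℕ b) ⊕ℕ s) ⊜ℕ (conℕ 2 ⊕ℕ b) ⊕ℕ ((conℕ 1 ⊕ℕ a) ⊕ℕ s)) ≡.refl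
                (length as) (length bs) (size fs)
      swap₂ : suc (length as) ℕ.+ (suc (suc (length bs)) ℕ.+ size fs) ≡ suc (length bs) ℕ.+ (suc (suc (length as)) ℕ.+ size fs)
      swap₂ = solveℕ 3 (λ a b s → (conℕ 1 ⊕ℕ a) ⊕ℕ ((conℕ 2 ⊕ℕ b) ⊕ℕ s) ⊜ℕ (conℕ 1 ⊕ℕ b) ⊕ℕ ((conℕ 2 ⊕ℕ a) ⊕ℕ s)) ≡.refl
                (length as) (length bs) (size fs)

    Clause : Set → Set c
    Clause X = List (Polynomial F X) × Polynomial F X

    Satisfies : (X → F) → Pred (Clause X) (c ⊔ ℓ₁)
    Satisfies x (fs , g) = All (λ f → eval R f x ≈ 0#) fs × Nonzero g x

    merge : Clause X → Clause X → Clause X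
    merge (fs , g) (fs′ , g′) = fs ++ fs′ , g :* g′

    -- An existential quantifier passes through disjunctions but not through conjunctions, so each
    -- disjunct has to be a complete system of equations with one inequation, as treated by
    -- `con-solvable`.
    DisjunctiveNormalForm : Pred (X → F) p → Set _
    DisjunctiveNormalForm S = ∃[ cs ] (∀ x → S x ⇔ Any (Satisfies x) cs)

    dnf-∪ : {S : Pred (X → F) p} {T : Pred (X → F) q} → DisjunctiveNormalForm S → DisjunctiveNormalForm T →
            DisjunctiveNormalForm (λ x → S x ⊎ T x)
    dnf-∪ (cs , s) (ds , t) = cs ++ ds , λ x →
        (λ { (inj₁ sx) → Any.++⁺ˡ (proj₁ (s x) sx) ; (inj₂ tx) → Any.++⁺ʳ cs (proj₁ (t x) tx) })
      , Sum.map (proj₂ (s x)) (proj₂ (t x)) ∘ Any.++⁻ cs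

    dnf-∩ : {S : Pred (X → F) p} {T : Pred (X → F) q} → DisjunctiveNormalForm S → DisjunctiveNormalForm T →
            DisjunctiveNormalForm (λ x → S x × T x)
    dnf-∩ (cs , s) (ds , t) = List.cartesianProductWith merge cs ds , λ x →
        (λ (sx , tx) → Any.cartesianProductWith⁺ merge
           (λ (a , ≉0) (b , ≉0′) → All.++⁺ a b , *-≉0 ≉0 ≉0′) (proj₁ (s x) sx) (proj₁ (t x) tx))
      , (λ both → case Any.cartesianProductWith⁻ merge (λ {a} {b} → unmerge x {a} {b}) cs ds both of λ (a , b) → proj₂ (s x) a , proj₂ (t x) b)
      where
      unmerge : ∀ x {a b} → Satisfies x (merge a b) → Satisfies x a × Satisfies x b
      unmerge x {fs , _} (ab , ≉0) =
        (All.++⁻ˡ fs ab , λ ≈0 → ≉0 (trans (*-congʳ ≈0) (zeroˡ _))) ,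
        (All.++⁻ʳ fs ab , λ ≈0 → ≉0 (trans (*-congˡ ≈0) (zeroʳ _)))

    dnf-cong : {S : Pred (X → F) p} {T : Pred (X → F) q} → (∀ x → S x ⇔ T x) →
               DisjunctiveNormalForm S → DisjunctiveNormalForm T
    dnf-cong S⇔T (cs , s) = cs , λ x → proj₁ (s x) ∘ proj₂ (S⇔T x) , proj₁ (S⇔T x) ∘ proj₂ (s x)

    dnf-holds : ∀ (φ : QuantifierFree X) → DisjunctiveNormalForm (Holds φ)
    dnf-fails : ∀ (φ : QuantifierFree X) → DisjunctiveNormalForm (λ x → ¬ Holds φ x)
    dnf-holds (vanishes f) = (f ∷ [] , con 1#) ∷ [] , λ x →
      (λ ≈0 → here (≈0 ∷ [] , 1≉0)) , (λ { (here (≈0 ∷ [] , _)) → ≈0 })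
    dnf-holds (negation φ)      = dnf-fails φ
    dnf-holds (conjunction φ ψ)    = dnf-∩ (dnf-holds φ) (dnf-holds ψ)
    dnf-fails (vanishes f) = ([] , f) ∷ [] , λ x → (λ ≉0 → here ([] , ≉0)) , (λ { (here (_ , ≉0)) → ≉0 })
    dnf-fails (negation φ)      = dnf-cong (λ x → (λ h ¬h → ¬h h) , byContradiction) (dnf-holds φ)
    dnf-fails (conjunction φ ψ)    = dnf-cong
      (λ x → (λ { (inj₁ ¬h) (h , _) → ¬h h ; (inj₂ ¬h) (_ , h) → ¬h h })
           , (λ ¬both → byContradiction λ none → none (inj₁ λ h → none (inj₂ λ h′ → ¬both (h , h′)))))
      (dnf-∪ (dnf-fails φ) (dnf-fails ψ))

    satisfiable : ∀ {x : X → F} {y} cs → Any (Satisfies (extend x y)) cs →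
                  Any (λ (fs , g) → Solvable (map coefficients fs) g x) cs
    satisfiable {x = x} {y} cs = Any.map λ { {fs , g} (≈0s , ≉0) →
      y , All.map⁺ (All.map (λ {f} ≈0 → trans (horner-coefficients f x y) ≈0) ≈0s) , ≉0 }

    satisfying : ∀ {x : X → F} cs → Any (λ (fs , g) → Solvable (map coefficients fs) g x) cs →
                 ∃[ y ] Any (Satisfies (extend x y)) cs
    satisfying {x = x} (_ ∷ cs) (here (y , ≈0s , ≉0)) =
      y , here (All.map (λ {f} ≈0 → trans (sym (horner-coefficients f x y)) ≈0) (All.map⁻ ≈0s) , ≉0)
    satisfying (_ ∷ cs) (there any) = case satisfying cs any of λ (y , any′) → y , there any′

  abstract
    con-∃ : {S : (X → F) → F → Set p} → Constructible {Maybe X} (λ z → S (z ∘ just) (z nothing)) →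
            Constructible (λ x → ∃[ y ] S x y)
    con-∃ {X = X} {S = S} (φ , φ⇔) with dnf-holds φ
    ... | cs , dnf = con-cong (λ x →
            (λ any → case satisfying cs any of λ (y , any′) → y , proj₂ (φ⇔ (extend x y)) (proj₂ (dnf (extend x y)) any′))
          , (λ (y , s) → satisfiable cs (proj₁ (dnf (extend x y)) (proj₁ (φ⇔ (extend x y)) s))))
        (con-Any (λ (fs , g) → con-solvable (size (map coefficients fs)) (map coefficients fs) g ℕ.≤-refl) cs)

  con-rename : {S : Pred (Y → F) p} (σ : Y → X) → Constructible S → Constructible (λ x → S (x ∘ σ))
  con-rename σ = con-substitute (var ∘ σ)

  private
    -- Coordinates are eliminated one at a time: `zero` moves from the bound block to the variable
    -- `nothing`, and the others are eliminated before it.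
    con-∃-Fin : ∀ {n} {S : Pred (X ⊎ Fin n → F) p} → Constructible S →
                Constructible {X} (λ x → ∃[ w ] S [ x , w ]′)
    con-∃-Fin {X = X} {n = zero} s = con-cong
      (λ x → (λ s′ → (λ ()) , con-resp s (λ { (inj₁ i) → refl ; (inj₂ ()) }) s′)
           , (λ (w , s′) → con-resp s (λ { (inj₁ i) → refl ; (inj₂ ()) }) s′))
      (con-rename σ s)
      where
      σ : X ⊎ Fin 0 → X
      σ (inj₁ i) = i
    con-∃-Fin {X = X} {n = suc n} {S} s = con-cong
      (λ x → (λ (y , w , s′) → (λ { zero → y ; (suc j) → w j }) ,
                con-resp s (λ { (inj₁ i) → refl ; (inj₂ zero) → refl ; (inj₂ (suc j)) → refl }) s′)
           , (λ (w , s′) → w zero , w ∘ suc ,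
                con-resp s (λ { (inj₁ i) → refl ; (inj₂ zero) → refl ; (inj₂ (suc j)) → refl }) s′))
      (con-∃ {S = λ x y → ∃[ w ] S ([ extend x y , w ]′ ∘ σ)}
        (con-cong (λ z → (λ (w , s′) → w , con-resp s (λ { (inj₁ i) → refl ; (inj₂ zero) → refl ; (inj₂ (suc j)) → refl }) s′)
                       , (λ (w , s′) → w , con-resp s (λ { (inj₁ i) → refl ; (inj₂ zero) → refl ; (inj₂ (suc j)) → refl }) s′))
          (con-∃-Fin (con-rename σ s))))
      where
      σ : X ⊎ Fin (suc n) → Maybe X ⊎ Fin n
      σ (inj₁ i)       = inj₁ (just i)
      σ (inj₂ zero)    = inj₁ nothing
      σ (inj₂ (suc j)) = inj₂ j

  abstract
    con-∃-finite : Finite Y → {S : (X → F) → (Y → F) → Set p} →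
                   Constructible {X ⊎ Y} (λ z → S (z ∘ inj₁) (z ∘ inj₂)) → Constructible (λ x → ∃[ w ] S x w)
    con-∃-finite {Y = Y} {X = X} (n , bij) {S} s = con-cong
      (λ x → (λ (w , s′) → w ∘ to , s′)
           , (λ (w , s′) → w ∘ from , con-resp s {[ x , w ]′} {[ x , w ∘ from ∘ to ]′}
               (λ { (inj₁ i) → refl ; (inj₂ j) → reflexive (≡.cong w (≡.sym (strictlyInverseʳ j))) }) s′))
      (con-∃-Fin (con-rename (Sum.map₂ to) s))
      where open Inverse bij using (to; from; strictlyInverseʳ)

    con-∀-finite : Finite Y → {S : (X → F) → (Y → F) → Set p} →
                   Constructible {X ⊎ Y} (λ z → S (z ∘ inj₁) (z ∘ inj₂)) → Constructible (λ x → ∀ w → S x w)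
    con-∀-finite fin s = con-cong
      (λ x → (λ none w → byContradiction λ ¬s → none (w , ¬s)) , (λ all (w , ¬s) → ¬s (all w)))
      (con-¬ (con-∃-finite fin (con-¬ s)))

    con-∀-index : Finite Y → {S : Y → Pred (X → F) p} → (∀ i → Constructible (S i)) → Constructible (λ x → ∀ i → S i x)
    con-∀-index (n , bij) {S} s = con-cong
      (λ x → (λ all i → ≡.subst (λ j → S j x) (strictlyInverseʳ i) (All.lookup all (∈ˡ.∈-allFin (to i))))
           , (λ all → All.tabulate λ {j} _ → all (from j)))
      (con-All (s ∘ from) (allFin n))
      where open Inverse bij using (to; from; strictlyInverseʳ)

    con-∃-index : Finite Y → {S : Y → Pred (X → F) p} → (∀ i → Constructible (S i)) → Constructible (λ x → ∃[ i ] S i x)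
    con-∃-index fin s = con-cong
      (λ x → (λ ¬all → byContradiction λ none → ¬all λ i si → none (i , si)) , (λ (i , si) all → all i si))
      (con-¬ (con-∀-index fin (con-¬ ∘ s)))


-- Extrema of sets of integers

module Extremum (em : ∀ {a} → ExcludedMiddle a) where

  open import Data.Nat.Induction using (<-rec)

  ⊖-≤⁺ : ∀ p q p′ q′ → p ℕ.+ q′ ℕ.≤ p′ ℕ.+ q → p ⊖ q ℤ.≤ p′ ⊖ q′
  ⊖-≤⁺ p q p′ q′ le = ≡.subst₂ ℤ._≤_ left right (ℤ.⊖-monoˡ-≤ (q ℕ.+ q′) le)
    where
    left : (p ℕ.+ q′) ⊖ (q ℕ.+ q′) ≡ p ⊖ q
    left = ≡.trans (≡.cong₂ _⊖_ (ℕ.+-comm p q′) (ℕ.+-comm q q′)) (ℤ.+-cancelˡ-⊖ q′ p q)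
    right : (p′ ℕ.+ q) ⊖ (q ℕ.+ q′) ≡ p′ ⊖ q′
    right = ≡.trans (≡.cong (_⊖ (q ℕ.+ q′)) (ℕ.+-comm p′ q)) (ℤ.+-cancelˡ-⊖ q p′ q′)

  ⊖-≤⁻ : ∀ p q p′ q′ → p ⊖ q ℤ.≤ p′ ⊖ q′ → p ℕ.+ q′ ℕ.≤ p′ ℕ.+ q
  ⊖-≤⁻ p q p′ q′ le = ℕ.≮⇒≥ λ lt → ℤ.<⇒≱
    (≡.subst₂ ℤ._<_
      (≡.trans (≡.cong (_⊖ (q ℕ.+ q′)) (ℕ.+-comm p′ q)) (ℤ.+-cancelˡ-⊖ q p′ q′))
      (≡.trans (≡.cong₂ _⊖_ (ℕ.+-comm p q′) (ℕ.+-comm q q′)) (ℤ.+-cancelˡ-⊖ q′ p q))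
      (ℤ.⊖-monoˡ-< (q ℕ.+ q′) lt)) le

  largest-exists : ∀ {p} {P : Pred ℤ p} B → (∀ n → P n → n ℤ.≤ B) → ∃ P → ∃ (IsLargest P)
  -- The fuel is the distance from the starting value to the bound; every strictly larger member
  -- uses up at least one unit.
  largest-exists {P = P} B bound (n₀ , Pn₀) = go ℤ.∣ B ℤ.- n₀ ∣ n₀ Pn₀ enough
    where
    enough : B ℤ.≤ n₀ ℤ.+ ℤ.+ ℤ.∣ B ℤ.- n₀ ∣
    enough = ℤ.≤-reflexive (≡.sym (≡.trans (≡.cong (λ z → n₀ ℤ.+ z) (ℤ.0≤i⇒+∣i∣≡i (ℤ.i≤j⇒0≤j-i (bound n₀ Pn₀))))
      (≡.trans (ℤ.+-comm n₀ _) (≡.trans (ℤ.+-assoc B (ℤ.- n₀) n₀) (≡.trans (≡.cong (λ z → B ℤ.+ z) (ℤ.+-inverseˡ n₀)) (ℤ.+-identityʳ B))))))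

    go : ∀ fuel n → P n → B ℤ.≤ n ℤ.+ ℤ.+ fuel → ∃ (IsLargest P)
    go fuel n Pn B≤ with em {P = ∃[ n′ ] (P n′ × n ℤ.< n′)}
    ... | no none = n , Pn , λ n′ Pn′ → ℤ.≮⇒≥ λ n<n′ → none (n′ , Pn′ , n<n′)
    go zero n Pn B≤ | yes (n′ , Pn′ , n<n′) =
      ⊥-elim (ℤ.<⇒≱ n<n′ (ℤ.≤-trans (bound n′ Pn′) (≡.subst (B ℤ.≤_) (ℤ.+-identityʳ n) B≤)))
    go (suc fuel) n Pn B≤ | yes (n′ , Pn′ , n<n′) = go fuel n′ Pn′
      (ℤ.≤-trans B≤ (≡.subst (ℤ._≤ n′ ℤ.+ ℤ.+ fuel) shift (ℤ.+-monoˡ-≤ (ℤ.+ fuel) (ℤ.i<j⇒suc[i]≤j n<n′))))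
      where
      shift : ℤ.suc n ℤ.+ ℤ.+ fuel ≡ n ℤ.+ ℤ.+ suc fuel
      shift = ≡.trans (≡.cong (λ z → z ℤ.+ ℤ.+ fuel) (ℤ.+-comm (ℤ.+ 1) n)) (ℤ.+-assoc n (ℤ.+ 1) (ℤ.+ fuel))

  least-exists : ∀ {p} {P : Pred ℕ p} → ∃ P → ∃[ n ] (P n × (∀ n′ → P n′ → n ℕ.≤ n′))
  least-exists {p} {P} (n , Pn) = <-rec (λ n → P n → ∃[ n ] (P n × (∀ n′ → P n′ → n ℕ.≤ n′))) step n Pn
    where
    step : ∀ n → (∀ {m} → m ℕ.< n → P m → ∃[ n ] (P n × (∀ n′ → P n′ → n ℕ.≤ n′))) →
           P n → ∃[ n ] (P n × (∀ n′ → P n′ → n ℕ.≤ n′))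
    step n rec Pn with em {P = ∃[ m ] (P m × m ℕ.< n)}
    ... | yes (m , Pm , m<n) = rec m<n Pm
    ... | no none = n , Pn , λ m Pm → ℕ.≮⇒≥ λ m<n → none (m , Pm , m<n)

-- Sums over lists and finite types

module ListSums {a} {A : Set a} where

  sum-map-mono : ∀ {f g : A → ℕ} xs → (∀ x → f x ℕ.≤ g x) → sum (map f xs) ℕ.≤ sum (map g xs)
  sum-map-mono []       f≤g = z≤n
  sum-map-mono (x ∷ xs) f≤g = ℕ.+-mono-≤ (f≤g x) (sum-map-mono xs f≤g)

  sum-map-+ : ∀ (f g : A → ℕ) xs → sum (map (λ x → f x ℕ.+ g x) xs) ≡ sum (map f xs) ℕ.+ sum (map g xs)
  sum-map-+ f g []       = ≡.refl
  sum-map-+ f g (x ∷ xs) = ≡.trans (≡.cong (f x ℕ.+ g x ℕ.+_) (sum-map-+ f g xs))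
    (interchange (f x) (g x) (sum (map f xs)) (sum (map g xs)))
    where open import Algebra.Properties.CommutativeSemigroup ℕ.+-commutativeSemigroup using (interchange)

  -- Turns a comparison of total dimensions into one at each vertex, where it decides equality of
  -- nested subspaces.
  sum-map-tight : ∀ {f g : A → ℕ} xs → (∀ x → f x ℕ.≤ g x) → sum (map g xs) ℕ.≤ sum (map f xs) →
                  ∀ {x} → x ∈ˡ xs → g x ℕ.≤ f x
  sum-map-tight {f} {g} (x ∷ xs) f≤g Σg≤Σf (here ≡.refl) = ℕ.≮⇒≥ λ fx<gx →
    ℕ.<⇒≱ (ℕ.+-mono-<-≤ fx<gx (sum-map-mono xs f≤g)) Σg≤Σf
  sum-map-tight {f} {g} (x ∷ xs) f≤g Σg≤Σf (there y∈) = sum-map-tight xs f≤g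
    (ℕ.≮⇒≥ λ lt → ℕ.<⇒≱ (ℕ.+-mono-≤-< (f≤g x) lt) Σg≤Σf) y∈

  sum-map-const : ∀ {f : A → ℕ} n xs → (∀ x → f x ≡ n) → sum (map f xs) ≡ length xs ℕ.* n
  sum-map-const n []       f≡n = ≡.refl
  sum-map-const n (x ∷ xs) f≡n = ≡.cong₂ ℕ._+_ (f≡n x) (sum-map-const n xs f≡n)

module FiniteTypes where

  open import Data.Product.Function.NonDependent.Propositional using (_×-↔_)
  open import Function.Construct.Composition using (_↔-∘_)
  open import Function.Construct.Identity using (↔-id)
  open import Function.Construct.Symmetry using (↔-sym)
  open import Data.List.Relation.Unary.Unique.Propositional.Properties using (map⁺; allFin⁺)

  finite-× : {A B : Set} → Finite A → Finite B → Finite (A × B)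
  finite-× (_ , f) (_ , g) = _ , ↔-sym Fin.*↔× ↔-∘ (f ×-↔ g)

  finite-Fin : ∀ n → Finite (Fin n)
  finite-Fin n = n , ↔-id (Fin n)

  module _ {A : Set} (fin : Finite A) where

    open Inverse (proj₂ fin) using (to; from; strictlyInverseˡ; strictlyInverseʳ)

    elements-unique : Unique (elements fin)
    elements-unique = map⁺ (λ {i} {j} eq → ≡.trans (≡.sym (strictlyInverseˡ i)) (≡.trans (≡.cong to eq) (strictlyInverseˡ j)))
      (allFin⁺ (proj₁ fin))

    elements-complete : ∀ a → a ∈ˡ elements fin
    elements-complete a = ≡.subst (_∈ˡ elements fin) (strictlyInverseʳ a) (∈ˡ.∈-map⁺ from (∈ˡ.∈-allFin (to a)))

-- Excess of families of subspaces of 𝔽^𝒢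

module ExcessTheory (em : ∀ {a} → ExcludedMiddle a) {c ℓ₁} (R : CommutativeRing c ℓ₁) (isField : IsField R)
                    (𝒢 : FiniteGroup) (gen : Fin 2 → FiniteGroup.Carrier 𝒢) where


  open CommutativeRing R using (0#; 1#; _≈_; _+_; _*_; zeroʳ; +-identityˡ; +-cong; *-congˡ; +-identityʳ; *-identityʳ)
    renaming (Carrier to F; refl to ≈-refl; sym to ≈-sym; trans to ≈-trans)
  open FieldTheory em R isField
  open FiniteGroup 𝒢 using (finite) renaming (Carrier to Elt)
  open Graph (cayleyBigraph 𝒢 gen) using (V; E; head; tail)
  open FiniteTypes
  open ListSums
  open Extremum em
  open Subspace

  private
    Scalars : VectorSpace R c ℓ₁
    Scalars = TensorUnit.leftModule

    Everything : Subspace R Scalars 0ℓ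
    Everything = record
      { Member = λ _ → ⊤ ; resp = λ _ _ → tt ; 0-mem = tt ; +-mem = λ _ _ → tt ; *ₗ-mem = λ _ _ → tt }

    module S = LinearAlgebra em R isField Scalars
    module D = DirectSum em R isField {I = Elt} (decEq finite) (λ _ → Scalars) (λ _ → Everything)

    unit-basis : S.IsBasis (Member S.Zero) (Member Everything) (1# ∷ [])
    unit-basis = (λ { (S.base 1≈0) → 1≉0 1≈0 }) S.∷ S.[]
      , tt ∷ []
      , λ {w} _ → S.step w (S.base ≈-refl) (≈-sym (≈-trans (+-identityʳ _) (*-identityʳ w)))

  𝔸 : VectorSpace R c ℓ₁
  𝔸 = ⨁ R Elt (λ _ → Scalars)

  open LinearAlgebra em R isField 𝔸 public

  abstract
    units : List (Elt → F)
    units = D.concatenated (λ _ → 1# ∷ []) (λ _ → unit-basis) (elements finite)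

    units-generate : ∀ w → Spanned (Member Zero) units w
    units-generate w = proj₂ (proj₂ (D.basis-sum (λ _ → 1# ∷ []) (λ _ → unit-basis) (elements-unique finite) (elements-complete finite)))
      (λ _ → tt)

  open Dimension units units-generate public

  abstract
    dim-bounded : ∀ {p} (S : Subspace R 𝔸 p) → dim S ℕ.≤ length units
    dim-bounded S = dim-≤-span {vs = units} S (λ {w} _ → units-generate w)

  Family : Set _
  Family = V → Subspace R 𝔸 (c ⊔ ℓ₁)

  infix 4 _⊑_
  _⊑_ : ∀ {p q} → (V → Subspace R 𝔸 p) → (V → Subspace R 𝔸 q) → Set _
  U ⊑ U′ = ∀ v → Member (U v) ⊆ Member (U′ v)

  ΣV : (V → ℕ) → ℕ
  ΣV u = sum (map u (elements finite))

  ΣE : (E → ℕ) → ℕ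
  ΣE g = ΣV (λ v → g (v , zero)) ℕ.+ ΣV (λ v → g (v , suc zero))

  ΣV-+ : ∀ (u u′ : V → ℕ) → ΣV (λ v → u v ℕ.+ u′ v) ≡ ΣV u ℕ.+ ΣV u′
  ΣV-+ u u′ = sum-map-+ u u′ (elements finite)

  ΣV-mono : ∀ {u u′ : V → ℕ} → (∀ v → u v ℕ.≤ u′ v) → ΣV u ℕ.≤ ΣV u′
  ΣV-mono u≤u′ = sum-map-mono (elements finite) u≤u′

  ΣE-mono : ∀ {g g′ : E → ℕ} → (∀ e → g e ℕ.≤ g′ e) → ΣE g ℕ.≤ ΣE g′
  ΣE-mono g≤g′ = ℕ.+-mono-≤ (ΣV-mono λ v → g≤g′ (v , zero)) (ΣV-mono λ v → g≤g′ (v , suc zero))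

  ΣE-+ : ∀ (g g′ : E → ℕ) → ΣE (λ e → g e ℕ.+ g′ e) ≡ ΣE g ℕ.+ ΣE g′
  ΣE-+ g g′ = ≡.trans
    (≡.cong₂ ℕ._+_ (ΣV-+ (λ v → g (v , zero)) (λ v → g′ (v , zero))) (ΣV-+ (λ v → g (v , suc zero)) (λ v → g′ (v , suc zero))))
    (interchange (ΣV (λ v → g (v , zero))) (ΣV (λ v → g′ (v , zero))) (ΣV (λ v → g (v , suc zero))) (ΣV (λ v → g′ (v , suc zero))))
    where open import Algebra.Properties.CommutativeSemigroup ℕ.+-commutativeSemigroup using (interchange)

  module _ (L : Subgraph (cayleyBigraph 𝒢 gen)) where

    supported : V ⊎ E → Subspace R 𝔸 ℓ₁
    supported P = record
      { Member = SupportedAt R 𝒢 gen L P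
      ; resp   = λ a≈b s x x∉ → ≈-trans (≈-sym (a≈b x)) (s x x∉)
      ; 0-mem  = λ _ _ → ≈-refl
      ; +-mem  = λ s t x x∉ → ≈-trans (+-cong (s x x∉) (t x x∉)) (+-identityˡ 0#)
      ; *ₗ-mem = λ r s x x∉ → ≈-trans (*-congˡ (s x x∉)) (zeroʳ r)
      }

    -- The restriction maps are inclusions, so the summand of Γ_ht at an edge is an intersection
    -- inside 𝔽^𝒢. The matrix does not occur: when `U` consists of relations between the columns,
    -- membership at the head already supplies them.
    Γ : ∀ {p} → (V → Subspace R 𝔸 p) → E → Subspace R 𝔸 (ℓ₁ ⊔ p)
    Γ U e = supported (inj₂ e) ∩ˢ U (head e) ∩ˢ U (tail e)

    pos neg : Family → ℕ
    pos U = ΣE (λ e → dim (Γ U e))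
    neg U = ΣV (λ v → dim (U v))

    excess : Family → ℤ
    excess U = pos U ⊖ neg U

    _∩ᶠ_ _+ᶠ_ : Family → Family → Family
    (U ∩ᶠ U′) v = U v ∩ˢ U′ v
    (U +ᶠ U′) v = U v +ˢ U′ v

    Γ-mono : ∀ {U U′ : Family} → U ⊑ U′ → ∀ e → Member (Γ U e) ⊆ Member (Γ U′ e)
    Γ-mono U⊑U′ e (s , h , t) = s , U⊑U′ _ h , U⊑U′ _ t

    abstract
      -- At each edge the sum and the intersection of the two spaces `Γ` lie in the spaces `Γ` of
      -- the sum and of the intersection of the families; the modular law for dimensions does the
      -- rest.
      supermodular : ∀ U U′ → pos U ℕ.+ pos U′ ℕ.≤ pos (U +ᶠ U′) ℕ.+ pos (U ∩ᶠ U′)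
      supermodular U U′ = ≡.subst₂ ℕ._≤_ (ΣE-+ (λ e → dim (Γ U e)) (λ e → dim (Γ U′ e)))
        (ΣE-+ (λ e → dim (Γ (U +ᶠ U′) e)) (λ e → dim (Γ (U ∩ᶠ U′) e))) (ΣE-mono local)
        where
        local : ∀ e → dim (Γ U e) ℕ.+ dim (Γ U′ e) ℕ.≤ dim (Γ (U +ᶠ U′) e) ℕ.+ dim (Γ (U ∩ᶠ U′) e)
        local e = ≡.subst (ℕ._≤ dim (Γ (U +ᶠ U′) e) ℕ.+ dim (Γ (U ∩ᶠ U′) e)) (dim-modular (Γ U e) (Γ U′ e)) (ℕ.+-mono-≤
          (dim-mono (Γ U e +ˢ Γ U′ e) (Γ (U +ᶠ U′) e)
            λ (a , b , (s , h , t) , (s′ , h′ , t′) , eq) →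
              resp (supported (inj₂ e)) (λ x → ≈-sym (eq x)) (+-mem (supported (inj₂ e)) s s′)
              , (a , b , h , h′ , eq) , (a , b , t , t′ , eq))
          (dim-mono (Γ U e ∩ˢ Γ U′ e) (Γ (U ∩ᶠ U′) e)
            λ ((s , h , t) , (_ , h′ , t′)) → s , (h , h′) , (t , t′)))

      modular : ∀ U U′ → neg (U +ᶠ U′) ℕ.+ neg (U ∩ᶠ U′) ≡ neg U ℕ.+ neg U′
      modular U U′ = ≡.trans (≡.sym (ΣV-+ (λ v → dim ((U +ᶠ U′) v)) (λ v → dim ((U ∩ᶠ U′) v))))
        (≡.trans (≡.cong sum (List.map-cong (λ v → dim-modular (U v) (U′ v)) (elements finite)))
          (ΣV-+ (λ v → dim (U v)) (λ v → dim (U′ v))))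

    module _ {p} (K : V → Subspace R 𝔸 p) where

      IsMaximizer : Family → Set _
      IsMaximizer U = U ⊑ K × (∀ U′ → U′ ⊑ K → excess U′ ℤ.≤ excess U)

      IsMinimalMaximizer : Family → Set _
      IsMinimalMaximizer U = IsMaximizer U × (∀ U′ → IsMaximizer U′ → neg U ℕ.≤ neg U′)

      -- `Span Zero []` is `Zero` in the universe that `Family` prescribes.
      zeroFamily : Family
      zeroFamily v = Span Zero []

      zeroFamily-⊑ : ∀ {q} (U : V → Subspace R 𝔸 q) → zeroFamily ⊑ U
      zeroFamily-⊑ U v (base w≈0) = Zero-least (U v) w≈0

      excess-bounded : ∀ U → excess U ℤ.≤ ΣE (λ _ → length units) ⊖ 0
      excess-bounded U = ⊖-≤⁺ (pos U) (neg U) _ 0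
        (≡.subst (ℕ._≤ ΣE (λ _ → length units) ℕ.+ neg U) (≡.sym (ℕ.+-identityʳ (pos U)))
          (ℕ.m≤n⇒m≤n+o (neg U) (ΣE-mono λ e → dim-bounded (Γ U e))))

      abstract
        maximizer : ∃ IsMaximizer
        maximizer = extract (largest-exists (ΣE (λ _ → length units) ⊖ 0)
          (λ { n (U , _ , n≡) → ≡.subst (ℤ._≤ (ΣE (λ _ → length units) ⊖ 0)) (≡.sym n≡) (excess-bounded U) })
          (excess zeroFamily , zeroFamily , zeroFamily-⊑ K , ≡.refl))
          where
          extract : ∃ (IsLargest λ n → ∃[ U ] (U ⊑ K × n ≡ excess U)) → ∃ IsMaximizer
          extract (n , (U , U⊑K , n≡) , max) =
            U , U⊑K , λ U′ U′⊑K → ≡.subst (excess U′ ℤ.≤_) n≡ (max (excess U′) (U′ , U′⊑K , ≡.refl))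

        minimalMaximizer : ∃ IsMinimalMaximizer
        minimalMaximizer = extract (least-exists {P = Attained} (neg (proj₁ maximizer) , proj₁ maximizer , proj₂ maximizer , ≡.refl))
          where
          Attained : ℕ → Set (lsuc (c ⊔ ℓ₁) ⊔ p)
          Attained n = ∃[ U ] (IsMaximizer U × n ≡ neg U)

          extract : ∃[ n ] (Attained n × (∀ n′ → Attained n′ → n ℕ.≤ n′)) → ∃ IsMinimalMaximizer
          extract (n , (U , U-max , n≡) , min) =
            U , U-max , λ U′ U′-max → ≡.subst (ℕ._≤ neg U′) n≡ (min (neg U′) (U′ , U′-max , ≡.refl))

        -- By supermodularity the intersection of two maximizers is again one.
        minimalMaximizer-⊑ : ∀ {U U′} → IsMinimalMaximizer U → IsMaximizer U′ → U ⊑ U′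
        minimalMaximizer-⊑ {U} {U′} (U-max@(U⊑K , U≥) , U-min) U′-max@(U′⊑K , U′≥) v w∈ =
          -- The minimality of `U` leaves the intersection no smaller total dimension, hence the
          -- same dimension at every vertex, so it equals `U` there.
          proj₂ (equal-dim ((U ∩ᶠ U′) v) (U v) proj₁
            (sum-map-tight {f = λ v → dim ((U ∩ᶠ U′) v)} {λ v → dim (U v)} (elements finite) (λ v → dim-mono ((U ∩ᶠ U′) v) (U v) proj₁)
              (U-min (U ∩ᶠ U′) ∩-max) (elements-complete finite v)) w∈)
          where
          +⊑K : (U +ᶠ U′) ⊑ K
          +⊑K v (a , b , a∈ , b∈ , eq) = resp (K v) (λ x → ≈-sym (eq x)) (+-mem (K v) (U⊑K v a∈) (U′⊑K v b∈))

          excess-∩ : excess U ℤ.≤ excess (U ∩ᶠ U′)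
          -- The excess of the sum is at most that of the maximizer `U′`; by supermodularity the
          -- intersection then has at least the excess of `U`.
          excess-∩ = ⊖-≤⁺ (pos U) (neg U) (pos (U ∩ᶠ U′)) (neg (U ∩ᶠ U′))
            (arith (pos U) (neg U) (pos U′) (neg U′) (pos (U +ᶠ U′)) (neg (U +ᶠ U′)) _ _
              (supermodular U U′) (modular U U′) (⊖-≤⁻ (pos (U +ᶠ U′)) _ (pos U′) _ (U′≥ (U +ᶠ U′) +⊑K)))
            where
            open import Data.Nat.Solver using (module +-*-Solver)
            open +-*-Solver using (solve; _:=_) renaming (_:+_ to _⊕_)

            arith : ∀ p n p′ n′ p₊ n₊ p∩ n∩ → p ℕ.+ p′ ℕ.≤ p₊ ℕ.+ p∩ → n₊ ℕ.+ n∩ ≡ n ℕ.+ n′ →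
                    p₊ ℕ.+ n′ ℕ.≤ p′ ℕ.+ n₊ → p ℕ.+ n∩ ℕ.≤ p∩ ℕ.+ n
            arith p n p′ n′ p₊ n₊ p∩ n∩ sup mod max = ℕ.+-cancelʳ-≤ (p′ ℕ.+ p₊ ℕ.+ n₊ ℕ.+ n′) _ _ (begin
              (p ℕ.+ n∩) ℕ.+ (p′ ℕ.+ p₊ ℕ.+ n₊ ℕ.+ n′)
                ≡⟨ solve 6 (λ p n∩ p′ p₊ n₊ n′ → (p ⊕ n∩) ⊕ (p′ ⊕ p₊ ⊕ n₊ ⊕ n′) := (p ⊕ p′) ⊕ (n₊ ⊕ n∩) ⊕ (p₊ ⊕ n′)) ≡.refl p n∩ p′ p₊ n₊ n′ ⟩
              (p ℕ.+ p′) ℕ.+ (n₊ ℕ.+ n∩) ℕ.+ (p₊ ℕ.+ n′)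
                ≤⟨ ℕ.+-mono-≤ (ℕ.+-mono-≤ sup (ℕ.≤-reflexive mod)) max ⟩
              (p₊ ℕ.+ p∩) ℕ.+ (n ℕ.+ n′) ℕ.+ (p′ ℕ.+ n₊)
                ≡⟨ solve 6 (λ p₊ p∩ n n′ p′ n₊ → (p₊ ⊕ p∩) ⊕ (n ⊕ n′) ⊕ (p′ ⊕ n₊) := (p∩ ⊕ n) ⊕ (p′ ⊕ p₊ ⊕ n₊ ⊕ n′)) ≡.refl p₊ p∩ n n′ p′ n₊ ⟩
              (p∩ ℕ.+ n) ℕ.+ (p′ ℕ.+ p₊ ℕ.+ n₊ ℕ.+ n′) ∎)
              where open ℕ.≤-Reasoning

          ∩-max : IsMaximizer (U ∩ᶠ U′)
          ∩-max = (λ v (a , _) → U⊑K v a) , λ W W⊑K → ℤ.≤-trans (U≥ W W⊑K) excess-∩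


-- Bases under injective maps and in subspaces

module InjectiveImage (em : ∀ {a} → ExcludedMiddle a) {c ℓ₁} (R : CommutativeRing c ℓ₁) (isField : IsField R)
  {m ℓm n ℓn} (W : VectorSpace R m ℓm) (W′ : VectorSpace R n ℓn)
  (T : LeftModule.Carrierᴹ W → LeftModule.Carrierᴹ W′)
  (T-cong : ∀ {v w} → LeftModule._≈ᴹ_ W v w → LeftModule._≈ᴹ_ W′ (T v) (T w))
  (T-injective : ∀ {v w} → LeftModule._≈ᴹ_ W′ (T v) (T w) → LeftModule._≈ᴹ_ W v w)
  (T-0 : LeftModule._≈ᴹ_ W′ (T (LeftModule.0ᴹ W)) (LeftModule.0ᴹ W′))
  (T-+ : ∀ v w → LeftModule._≈ᴹ_ W′ (T (LeftModule._+ᴹ_ W v w)) (LeftModule._+ᴹ_ W′ (T v) (T w)))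
  (T-* : ∀ a v → LeftModule._≈ᴹ_ W′ (T (LeftModule._*ₗ_ W a v)) (LeftModule._*ₗ_ W′ a (T v)))
  where

  private
    module W = LeftModule W
    module W′ = LeftModule W′
    module S = LinearAlgebra em R isField W
    module S′ = LinearAlgebra em R isField W′
  open CommutativeRing R using (-_)
  open Subspace

  spanned-image : ∀ {vs w} → S.Spanned (Member S.Zero) vs w → S′.Spanned (Member S′.Zero) (map T vs) (T w)
  spanned-image (S.base w≈0)    = S′.base (W′.≈ᴹ-trans (T-cong w≈0) T-0)
  spanned-image (S.step a s eq) = S′.step a (spanned-image s)
    (W′.≈ᴹ-trans (T-cong eq) (W′.≈ᴹ-trans (T-+ _ _) (W′.+ᴹ-congʳ (T-* a _))))

  spanned-reflect : ∀ vs {w w′} → T w W′.≈ᴹ w′ → S′.Spanned (Member S′.Zero) (map T vs) w′ → S.Spanned (Member S.Zero) vs w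
  spanned-reflect []       eq (S′.base w≈0)         = S.base (T-injective (W′.≈ᴹ-trans eq (W′.≈ᴹ-trans w≈0 (W′.≈ᴹ-sym T-0))))
  spanned-reflect (v ∷ vs) {w} {w′} eq (S′.step a {u} s eq′) = S.step a {w W.+ᴹ (- a) W.*ₗ v}
    (spanned-reflect vs
      (W′.≈ᴹ-trans (T-+ w _) (W′.≈ᴹ-trans (W′.+ᴹ-cong (W′.≈ᴹ-trans eq eq′) (T-* (- a) v))
        (W′.≈ᴹ-trans (W′.+ᴹ-assoc _ u _) (S′.*ₗ-cancel a (T v) u)))) s)
    (W.≈ᴹ-sym (S.*ₗ-cancel a v w))

  independent-image : ∀ {vs} → S.Independent (Member S.Zero) vs → S′.Independent (Member S′.Zero) (map T vs)
  independent-image S.[]         = S′.[]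
  independent-image (v∉ S.∷ ind) = (λ s → v∉ (spanned-reflect _ W′.≈ᴹ-refl s)) S′.∷ independent-image ind

  independent-reflect : ∀ vs → S′.Independent (Member S′.Zero) (map T vs) → S.Independent (Member S.Zero) vs
  independent-reflect []       S′.[]         = S.[]
  independent-reflect (v ∷ vs) (v∉ S′.∷ ind) = (λ s → v∉ (spanned-image s)) S.∷ independent-reflect vs ind

module Restriction (em : ∀ {a} → ExcludedMiddle a) {c ℓ₁} (R : CommutativeRing c ℓ₁) (isField : IsField R)
  {m ℓm p} (W : VectorSpace R m ℓm) (K : Subspace R W p) where

  private
    module W = LeftModule W
    module S = LinearAlgebra em R isField W
    module S′ = LinearAlgebra em R isField (asSpace R K)
    module I = InjectiveImage em R isField (asSpace R K) W proj₁ id id W.≈ᴹ-refl (λ _ _ → W.≈ᴹ-refl) (λ _ _ → W.≈ᴹ-refl)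
  open Subspace

  restrict : ∀ {q} → Subspace R W q → Subspace R (asSpace R K) q
  restrict U = record
    { Member = Member U ∘ proj₁
    ; resp   = λ v≈w → resp U v≈w
    ; 0-mem  = 0-mem U
    ; +-mem  = λ v∈ w∈ → +-mem U v∈ w∈
    ; *ₗ-mem = λ a v∈ → *ₗ-mem U a v∈
    }

  attach : ∀ {vs} → All (Member K) vs → List (∃ (Member K))
  attach []        = []
  attach (k ∷ ks) = (_ , k) ∷ attach ks

  map-attach : ∀ {vs} (ks : All (Member K) vs) → map proj₁ (attach ks) ≡ vs
  map-attach []       = ≡.refl
  map-attach (k ∷ ks) = ≡.cong (_ ∷_) (map-attach ks)

  restrict-basis : ∀ {q} (U : Subspace R W q) → Member U ⊆ Member K → ∀ {vs} → S.IsBasis (Member S.Zero) (Member U) vs →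
                   ∃[ vs′ ] (S′.IsBasis (Member S′.Zero) (Member (restrict U)) vs′ × length vs′ ≡ length vs)
  restrict-basis U U⊆K {vs} (ind , vs∈ , spans) = attach ks
    , ( I.independent-reflect (attach ks) (≡.subst (S.Independent (Member S.Zero)) (≡.sym (map-attach ks)) ind)
      , All.map⁻ (≡.subst (All (Member U)) (≡.sym (map-attach ks)) vs∈)
      , λ {w} w∈ → I.spanned-reflect (attach ks) W.≈ᴹ-refl
          (≡.subst (λ us → S.Spanned (Member S.Zero) us (proj₁ w)) (≡.sym (map-attach ks)) (spans w∈)))
    , ≡.trans (≡.sym (List.length-map proj₁ (attach ks))) (≡.cong length (map-attach ks))
    where ks = All.map U⊆K vs∈

-- Maximum excess of the sheaf in terms of families

module SheafBridge (em : ∀ {a} → ExcludedMiddle a) {c ℓ₁} (R : CommutativeRing c ℓ₁) (isField : IsField R)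
                   (𝒢 : FiniteGroup) (gen : Fin 2 → FiniteGroup.Carrier 𝒢)
                   (L : Subgraph (cayleyBigraph 𝒢 gen)) {k : ℕ}
                   (M : Fin k → FiniteGroup.Carrier 𝒢 → CommutativeRing.Carrier R) where

  open ExcessTheory em R isField 𝒢 gen
  open FiniteTypes
  open Extremum em
  open FiniteGroup 𝒢 using (finite)
  open Graph (cayleyBigraph 𝒢 gen)
  open Subspace

  private
    ℱ = 𝒦 R 𝒢 gen L M
    open Sheaf ℱ using (stalk; resHead; resTail)
    module Vs = LinearAlgebra em R isField (vertexSpace ℱ)
    module Es = LinearAlgebra em R isField (edgeSpace ℱ)

  K : V ⊎ E → Subspace R 𝔸 ℓ₁
  K = relations R 𝒢 gen L M

  private
    module At (P : V ⊎ E) = Restriction em R isField 𝔸 (K P)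

    edges : List E
    edges = map (_, zero) (elements finite) ++ map (_, suc zero) (elements finite)

    edges-complete : ∀ e → e ∈ˡ edges
    edges-complete (v , zero)     = ∈ˡ.∈-++⁺ˡ (∈ˡ.∈-map⁺ _ (elements-complete finite v))
    edges-complete (v , suc zero) = ∈ˡ.∈-++⁺ʳ _ (∈ˡ.∈-map⁺ _ (elements-complete finite v))

    edges-unique : Unique edges
    edges-unique = ++⁺ (map⁺ (≡.cong proj₁) (elements-unique finite)) (map⁺ (≡.cong proj₁) (elements-unique finite))
      λ (∈₀ , ∈₁) → case ∈ˡ.∈-map⁻ _ ∈₀ , ∈ˡ.∈-map⁻ _ ∈₁ of λ { ((_ , _ , ≡.refl) , (_ , _ , ())) }
      where open import Data.List.Relation.Unary.Unique.Propositional.Properties using (map⁺; ++⁺)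

    sum-edges : ∀ (g : E → ℕ) → sum (map g edges) ≡ ΣE g
    sum-edges g = ≡.trans (≡.cong sum (List.map-++ g (map (_, zero) (elements finite)) _))
      (≡.trans (sum-++ (map g (map (_, zero) (elements finite))) _)
      (≡.cong₂ ℕ._+_ (≡.cong sum (≡.sym (List.map-∘ (elements finite)))) (≡.cong sum (≡.sym (List.map-∘ (elements finite))))))
      where open import Data.Nat.ListAction.Properties using (sum-++)

    Witness : Subspace R (vertexSpace ℱ) (c ⊔ ℓ₁) → ℕ → ℕ → ℤ → Set _
    Witness Û d₁ d₀ n = HasDimension R (asSpace R (Γht ℱ Û)) d₁ × HasDimension R (asSpace R Û) d₀ × n ≡ d₁ ⊖ d₀

  module _ (U : Family) (U⊑K : U ⊑ (K ∘ inj₁)) where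

    private
      vertexStalks : ∀ v → Subspace R (stalk (inj₁ v)) (c ⊔ ℓ₁)
      vertexStalks v = At.restrict (inj₁ v) (U v)

      edgeStalks : ∀ e → Subspace R (stalk (inj₂ e)) (c ⊔ ℓ₁)
      edgeStalks e = At.restrict (inj₂ e) (Γ L U e)

      module DV = DirectSum em R isField (decEq V-finite) (stalk ∘ inj₁) vertexStalks
      module DE = DirectSum em R isField (decEq E-finite) (stalk ∘ inj₂) edgeStalks

      Γ⊑K : ∀ e → Member (Γ L U e) ⊆ Member (K (inj₂ e))
      Γ⊑K e (s , h , _) = s , proj₂ (U⊑K (head e) h)

      vertexBasis : ∀ v → _
      vertexBasis v = At.restrict-basis (inj₁ v) (U v) (U⊑K v) (proj₂ (basis (U v)))

      edgeBasis : ∀ e → _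
      edgeBasis e = At.restrict-basis (inj₂ e) (Γ L U e) (Γ⊑K e) (proj₂ (basis (Γ L U e)))

    vertexSum : Subspace R (vertexSpace ℱ) (c ⊔ ℓ₁)
    vertexSum = DV.sumSubspace

    edgeSum : Subspace R (edgeSpace ℱ) (c ⊔ ℓ₁)
    edgeSum = DE.sumSubspace

    vertexList : List (LeftModule.Carrierᴹ (vertexSpace ℱ))
    vertexList = DV.concatenated (proj₁ ∘ vertexBasis) (proj₁ ∘ proj₂ ∘ vertexBasis) (elements finite)

    edgeList : List (LeftModule.Carrierᴹ (edgeSpace ℱ))
    edgeList = DE.concatenated (proj₁ ∘ edgeBasis) (proj₁ ∘ proj₂ ∘ edgeBasis) edges

    abstract
      vertexList-basis : Vs.IsBasis (Member Vs.Zero) (Member vertexSum) vertexList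
      vertexList-basis = DV.basis-sum (proj₁ ∘ vertexBasis) (proj₁ ∘ proj₂ ∘ vertexBasis) (elements-unique finite) (elements-complete finite)

      edgeList-basis : Es.IsBasis (Member Es.Zero) (Member edgeSum) edgeList
      edgeList-basis = DE.basis-sum (proj₁ ∘ edgeBasis) (proj₁ ∘ proj₂ ∘ edgeBasis) edges-unique edges-complete

      vertexList-All : (Û : Subspace R (vertexSpace ℱ) (c ⊔ ℓ₁)) →
                       (∀ v {s} → Member (U v) (proj₁ s) → Member Û (inject R (decEq V-finite) (stalk ∘ inj₁) v s)) →
                       All (Member Û) vertexList
      vertexList-All Û inj∈ = DV.concatenated-All (proj₁ ∘ vertexBasis) (proj₁ ∘ proj₂ ∘ vertexBasis) Û inj∈ (elements finite)

      length-vertexList : length vertexList ≡ neg L U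
      length-vertexList = ≡.trans (DV.length-concatenated (proj₁ ∘ vertexBasis) (proj₁ ∘ proj₂ ∘ vertexBasis) (elements finite))
        (≡.cong sum (List.map-cong (proj₂ ∘ proj₂ ∘ vertexBasis) (elements finite)))

      length-edgeList : length edgeList ≡ pos L U
      length-edgeList = ≡.trans (DE.length-concatenated (proj₁ ∘ edgeBasis) (proj₁ ∘ proj₂ ∘ edgeBasis) edges)
        (≡.trans (≡.cong sum (List.map-cong (proj₂ ∘ proj₂ ∘ edgeBasis) edges)) (sum-edges (λ e → dim (Γ L U e))))

      inject-vertexSum⁻ : ∀ v {s} → Member vertexSum (inject R (decEq V-finite) (stalk ∘ inj₁) v s) → Member (U v) (proj₁ s)
      inject-vertexSum⁻ v {s} ι∈ = resp (U v) (DV.inject-same v s) (ι∈ v)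

      Γht⊆edgeSum : Member (Γht ℱ vertexSum) ⊆ Member edgeSum
      Γht⊆edgeSum {w} w∈ e = proj₁ (proj₂ (w e)) , inject-vertexSum⁻ (head e) (proj₁ (w∈ e)) , inject-vertexSum⁻ (tail e) (proj₂ (w∈ e))

      edgeSum⊆Γht : Member edgeSum ⊆ Member (Γht ℱ vertexSum)
      edgeSum⊆Γht {w} w∈ e = case w∈ e of λ (_ , h , t) → DV.inject-member (head e) h , DV.inject-member (tail e) t

      Γht-basis : Es.IsBasis (Member Es.Zero) (Member (Γht ℱ vertexSum)) edgeList
      Γht-basis = proj₁ edgeList-basis , All.map (λ {w} → edgeSum⊆Γht {w}) (proj₁ (proj₂ edgeList-basis))
        , λ {w} w∈ → proj₂ (proj₂ edgeList-basis) {w} (Γht⊆edgeSum {w} w∈)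

      Γht-dimension : HasDimension R (asSpace R (Γht ℱ vertexSum)) (pos L U)
      Γht-dimension = ≡.subst (HasDimension R (asSpace R (Γht ℱ vertexSum))) length-edgeList (Es.basis⇒dimension (Γht ℱ vertexSum) Γht-basis)

      vertexSum-dimension : HasDimension R (asSpace R vertexSum) (neg L U)
      vertexSum-dimension = ≡.subst (HasDimension R (asSpace R vertexSum)) length-vertexList (Vs.basis⇒dimension vertexSum vertexList-basis)

    private
      witness : Witness vertexSum (pos L U) (neg L U) (excess L U)
      witness = Γht-dimension , vertexSum-dimension , ≡.refl

    excess-isExcess : IsExcess ℱ (excess L U)
    excess-isExcess = vertexSum , pos L U , neg L U , witness

  module _ (Û : Subspace R (vertexSpace ℱ) (c ⊔ ℓ₁)) where

    -- d_h and d_t send the space of an edge into a single summand, so Γ_ht depends only on the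
    -- parts of `Û` inside the summands. The direct sum of these parts lies in `Û`, so passing to it
    -- keeps Γ_ht and can only lower the dimension.
    slices : Family
    slices v = record
      { Member = λ a → Σ (Member (K (inj₁ v)) a) λ a∈ → Member Û (ι ℱ v (a , a∈))
      ; resp   = λ a≈b (a∈ , ι∈) → resp (K (inj₁ v)) a≈b a∈ , resp Û (inject-cong R (decEq V-finite) (stalk ∘ inj₁) v a≈b) ι∈
      ; 0-mem  = 0-mem (K (inj₁ v)) , resp Û (inject-0 R (decEq V-finite) (stalk ∘ inj₁) v) (0-mem Û)
      ; +-mem  = λ (a∈ , ιa) (b∈ , ιb) → +-mem (K (inj₁ v)) a∈ b∈
          , resp Û (inject-+ R (decEq V-finite) (stalk ∘ inj₁) v _ _) (+-mem Û ιa ιb)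
      ; *ₗ-mem = λ r (a∈ , ιa) → *ₗ-mem (K (inj₁ v)) r a∈
          , resp Û (inject-*ₗ R (decEq V-finite) (stalk ∘ inj₁) v r _) (*ₗ-mem Û r ιa)
      }

    slices-⊑ : slices ⊑ (K ∘ inj₁)
    slices-⊑ v = proj₁

    abstract
      neg-slices : ∀ {d₀} → HasDimension R (asSpace R Û) d₀ → neg L slices ℕ.≤ d₀
      neg-slices {d₀} dimension = case Vs.dimension⇒basis Û dimension of λ (vs , vs-basis , length≡) →
        ≡.subst₂ ℕ._≤_ (length-vertexList slices slices-⊑) length≡
          (Vs.independent-≤-basis Vs.Zero Û vs-basis (proj₁ (vertexList-basis slices slices-⊑))
            (vertexList-All slices slices-⊑ Û λ v {s} (a∈ , ι∈) →
              resp Û (inject-cong R (decEq V-finite) (stalk ∘ inj₁) v {proj₁ s , a∈} {s} (λ _ → CommutativeRing.refl R)) ι∈))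

      Γht-slices : ∀ {w} → Member (Γht ℱ Û) w → Member (edgeSum slices slices-⊑) w
      Γht-slices {w} w∈ e = proj₁ (proj₂ (w e)) , (proj₂ (LinearMap.apply (resHead e) (w e)) , proj₁ (w∈ e))
        , (proj₂ (LinearMap.apply (resTail e) (w e)) , proj₂ (w∈ e))

      pos-slices : ∀ {d₁} → HasDimension R (asSpace R (Γht ℱ Û)) d₁ → d₁ ℕ.≤ pos L slices
      pos-slices {d₁} dimension = case Es.dimension⇒basis (Γht ℱ Û) dimension of λ (es , es-basis , length≡) →
        ≡.subst₂ ℕ._≤_ length≡ (length-edgeList slices slices-⊑)
          (Es.basis-≤-span Es.Zero (Γht ℱ Û) es-basis λ {w} w∈ →
            proj₂ (proj₂ (edgeList-basis slices slices-⊑)) {w} (Γht-slices {w} w∈))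

  isExcess⇒family : ∀ n → IsExcess ℱ n → ∃[ U ] (U ⊑ (K ∘ inj₁) × n ℤ.≤ excess L U)
  isExcess⇒family n (Û , d₁ , d₀ , w) = slices Û , slices-⊑ Û , slices-excess w
    where
    slices-excess : Witness Û d₁ d₀ n → n ℤ.≤ excess L (slices Û)
    slices-excess (dimΓ , dimÛ , n≡) = ≡.subst (ℤ._≤ excess L (slices Û)) (≡.sym n≡)
      (⊖-≤⁺ d₁ d₀ (pos L (slices Û)) (neg L (slices Û)) (ℕ.+-mono-≤ (pos-slices Û dimΓ) (neg-slices Û dimÛ)))

  -- Expresses that the maximum excess is at least `n`, as the two conversions below show, in terms
  -- of subspaces of 𝔽^𝒢 itself; in this form the dependence on `M` becomes polynomial.
  Excessive : ℤ → Set _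
  Excessive n = Σ Family λ U → U ⊑ (K ∘ inj₁) × n ℤ.≤ excess L U

  private
    excess-≤-maximizer : ∀ {Uₘ} → IsMaximizer L (K ∘ inj₁) Uₘ → ∀ n → IsExcess ℱ n → n ℤ.≤ excess L Uₘ
    excess-≤-maximizer {Uₘ} (_ , max) n n-excess = bound (isExcess⇒family n n-excess)
      where
      bound : Excessive n → n ℤ.≤ excess L Uₘ
      bound (U , U⊑K , n≤) = ℤ.≤-trans n≤ (max U U⊑K)

    maximizer⇒maximum : ∀ {Uₘ} → IsMaximizer L (K ∘ inj₁) Uₘ → IsMaximumExcess ℱ (excess L Uₘ)
    maximizer⇒maximum {Uₘ} Uₘ-max = excess-isExcess Uₘ (proj₁ Uₘ-max) , excess-≤-maximizer {Uₘ} Uₘ-max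

  excessive⇒maximum : ∀ n → Excessive n → ∃[ e ] (IsMaximumExcess (𝒦 R 𝒢 gen L M) e × n ℤ.≤ e)
  excessive⇒maximum n (U , U⊑K , n≤) = found (maximizer L (K ∘ inj₁))
    where
    found : ∃ (IsMaximizer L (K ∘ inj₁)) → ∃[ e ] (IsMaximumExcess ℱ e × n ℤ.≤ e)
    found (Uₘ , Uₘ-max) = excess L Uₘ , maximizer⇒maximum {Uₘ} Uₘ-max , ℤ.≤-trans n≤ (proj₂ Uₘ-max U U⊑K)

  maximum⇒excessive : ∀ n → ∃[ e ] (IsMaximumExcess (𝒦 R 𝒢 gen L M) e × n ℤ.≤ e) → Excessive n
  maximum⇒excessive n (e , (e-excess , _) , n≤e) = found (isExcess⇒family e e-excess)
    where
    found : Excessive e → Excessive n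
    found (U , U⊑K , e≤) = U , U⊑K , ℤ.≤-trans n≤e e≤


-- Families of prescribed dimensions as a constructible condition

module Realisation (em : ∀ {a} → ExcludedMiddle a) {c ℓ₁} (R : CommutativeRing c ℓ₁) (isField : IsField R)
                   (closed : IsAlgebraicallyClosed R)
                   (𝒢 : FiniteGroup) (gen : Fin 2 → FiniteGroup.Carrier 𝒢)
                   (L : Subgraph (cayleyBigraph 𝒢 gen)) where

  open ExcessTheory em R isField 𝒢 gen
  open QuantifierElimination em R isField closed
  open FiniteTypes
  open CommutativeRing R hiding (zero) renaming (Carrier to F)
  open DifferenceSolver R using (solve; _:=_) renaming (_:+_ to _⊹_; _:*_ to _⊛_; :-_ to ⊝_; con to constant)
  open SemiringSum semiring using () renaming (sum to ∑)
  open FiniteGroup 𝒢 using (finite) renaming (Carrier to Elt)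
  open Graph (cayleyBigraph 𝒢 gen)
  open Subspace

  private variable
    X : Set
    k : ℕ

  -- The dimension of 𝔽^𝒢: enough vectors for any subspace at any vertex or edge, independently of
  -- the family.
  capacity : ℕ
  capacity = length units

  indices : ℕ → List (Fin capacity)
  indices n = take n (allFin capacity)

  -- l independent vectors in the edge space of e, with m and n vectors spanning the subspaces at its head and tail.
  EdgeWitness : (V × Fin capacity × Elt → F) → E → (m n l : ℕ) → Set (c ⊔ ℓ₁)
  EdgeWitness B e m n l = Σ (Fin capacity × Elt → F) λ C →
      Independent (Member Zero) (map (λ j x → C (j , x)) (indices l))
    × All (λ j → SupportedAt R 𝒢 gen L (inj₂ e) (λ x → C (j , x))
        × Spanned (Member Zero) (map (λ j x → B (head e , j , x)) (indices m)) (λ x → C (j , x))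
        × Spanned (Member Zero) (map (λ j x → B (tail e , j , x)) (indices n)) (λ x → C (j , x)))
      (indices l)

  -- Dimensions enter as bounds: the listed vectors at a vertex may be dependent, so `u` bounds from
  -- above, while independent vectors at an edge make `g` a bound from below. Both bounds favour a
  -- large excess, and only finitely many field elements are quantified.
  Realises : (Fin k → Elt → F) → (V → ℕ) → (E → ℕ) → Set (c ⊔ ℓ₁)
  Realises M u g = Σ (V × Fin capacity × Elt → F) λ B →
      (∀ v → All (λ j → Member (relations R 𝒢 gen L M (inj₁ v)) (λ x → B (v , j , x))) (indices (u v)))
    × (∀ e → EdgeWitness B e (u (head e)) (u (tail e)) (g e))

  SurjectiveAt : (Fin k → Elt → F) → V ⊎ E → Set (c ⊔ ℓ₁)
  SurjectiveAt {k = k} M P = ∀ (b : Fin k → F) → ∃[ a ] (SupportedAt R 𝒢 gen L P a × (∀ i → columnComb R 𝒢 gen L M a i ≈ b i))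

  con-equal : (f g : Polynomial F X) → Constructible (λ z → eval R f z ≈ eval R g z)
  con-equal f g = con-cong
    (λ z → (λ eq → trans (solve 2 (λ a b → a := (a ⊹ ⊝ constant (1 , 0) ⊛ b) ⊹ b) refl (eval R f z) (eval R g z))
                     (trans (+-congʳ eq) (+-identityˡ (eval R g z))))
         , (λ eq → trans (+-congʳ eq) (solve 1 (λ b → b ⊹ ⊝ constant (1 , 0) ⊛ b := constant (0 , 0)) refl (eval R g z))))
    (con-vanishes (f :+ (con (- 1#) :* g)))

  abstract
    con-spanned : ∀ {I : Set} (J : List I) (s : I → Elt → X) (w : Elt → X) →
                  Constructible (λ z → Spanned (Member Zero) (map (λ j x → z (s j x)) J) (λ x → z (w x)))
    con-spanned [] s w = con-cong (λ z → (λ w≈0 → base w≈0) , (λ { (base w≈0) → w≈0 }))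
      (con-∀-index finite λ x → con-vanishes (var (w x)))
    con-spanned (j ∷ J) s w = con-cong
      (λ z → (λ (a , u , span , eq) → step a {u} span eq) , (λ { (step a {u} span eq) → a , u , span , eq }))
      (con-∃ {S = λ z a → ∃[ u ] (Spanned (Member Zero) (map (λ j x → z (s j x)) J) u × (∀ x → z (w x) ≈ a * z (s j x) + u x))}
        (con-∃-finite finite
          {S = λ z u → Spanned (Member Zero) (map (λ j x → z (just (s j x))) J) u × (∀ x → z (just (w x)) ≈ z nothing * z (just (s j x)) + u x)}
          (con-∩ (con-spanned J (λ j x → inj₁ (just (s j x))) inj₂)
            (con-∀-index finite λ x → con-equal (var (inj₁ (just (w x))))
              ((var (inj₁ nothing) :* var (inj₁ (just (s j x)))) :+ var (inj₂ x))))))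

    con-independent : ∀ {I : Set} (J : List I) (s : I → Elt → X) →
                      Constructible (λ z → Independent (Member Zero) (map (λ j x → z (s j x)) J))
    con-independent []      s = con-cong (λ z → (λ _ → []) , (λ _ → tt)) con-true
    con-independent (j ∷ J) s = con-cong (λ z → (λ (v∉ , ind) → v∉ ∷ ind) , (λ { (v∉ ∷ ind) → v∉ , ind }))
      (con-∩ (con-¬ (con-spanned J s (s j))) (con-independent J s))

    con-supported : ∀ P (a : Elt → X) → Constructible (λ z → SupportedAt R 𝒢 gen L P (λ x → z (a x)))
    con-supported P a = con-∀-index finite λ x → con-→ (con-constant (x ∉ Translators 𝒢 gen L P)) (con-vanishes (var (a x)))

  private
    sumPolynomial : ∀ {n} → (Fin n → Polynomial F X) → Polynomial F X
    sumPolynomial {n = zero}  f = con 0#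
    sumPolynomial {n = suc n} f = f zero :+ sumPolynomial (f ∘ suc)

    eval-sum : ∀ {n} (f : Fin n → Polynomial F X) z → eval R (sumPolynomial f) z ≈ ∑ (λ i → eval R (f i) z)
    eval-sum {n = zero}  f z = refl
    eval-sum {n = suc n} f z = +-congˡ (eval-sum (f ∘ suc) z)

    columnPolynomial : (Fin k → Elt → X) → (Elt → X) → Fin k → Polynomial F X
    columnPolynomial μ a i = sumPolynomial λ j → var (a (element finite j)) :* var (μ i (element finite j))

    eval-column : ∀ (μ : Fin k → Elt → X) a i z →
                  eval R (columnPolynomial μ a i) z ≈ columnComb R 𝒢 gen L (λ i g → z (μ i g)) (λ x → z (a x)) i
    eval-column μ a i z = eval-sum (λ j → var (a (element finite j)) :* var (μ i (element finite j))) z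

  abstract
    con-relations : ∀ (μ : Fin k → Elt → X) P (a : Elt → X) →
                    Constructible (λ z → Member (relations R 𝒢 gen L (λ i g → z (μ i g)) P) (λ x → z (a x)))
    con-relations {k = k} μ P a = con-∩ (con-supported P a) (con-∀-index (finite-Fin k) λ i → con-cong
      (λ z → trans (sym (eval-column μ a i z)) , trans (eval-column μ a i z))
      (con-vanishes (columnPolynomial μ a i)))

    con-realises : ∀ u g → Constructible {Fin k × Elt} (λ x → Realises (λ i y → x (i , y)) u g)
    con-realises {k = k} u g = con-∃-finite (finite-× finite (finite-× (finite-Fin capacity) finite))
      (con-∩
        (con-∀-index finite λ v → con-All (λ j → con-relations (λ i y → inj₁ (i , y)) (inj₁ v) (λ x → inj₂ (v , j , x))) (indices (u v)))
        (con-∀-index E-finite λ e → con-∃-finite (finite-× (finite-Fin capacity) finite)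
          (con-∩ (con-independent (indices (g e)) (λ j x → inj₂ (j , x)))
            (con-All (λ j → con-∩ (con-supported (inj₂ e) (λ x → inj₂ (j , x)))
              (con-∩ (con-spanned (indices (u (head e))) (λ j x → inj₁ (inj₂ (head e , j , x))) (λ x → inj₂ (j , x)))
                     (con-spanned (indices (u (tail e))) (λ j x → inj₁ (inj₂ (tail e , j , x))) (λ x → inj₂ (j , x)))))
              (indices (g e))))))

    con-surjectiveAt : ∀ P → Constructible {Fin k × Elt} (λ x → SurjectiveAt (λ i y → x (i , y)) P)
    con-surjectiveAt {k = k} P = con-∀-finite (finite-Fin k) (con-∃-finite finite
      (con-∩ (con-supported P inj₂)
        (con-∀-index (finite-Fin k) λ i → con-cong
          (λ z → trans (sym (eval-column (λ i y → inj₁ (inj₁ (i , y))) inj₂ i z))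
               , trans (eval-column (λ i y → inj₁ (inj₁ (i , y))) inj₂ i z))
          (con-equal (columnPolynomial (λ i y → inj₁ (inj₁ (i , y))) inj₂ i) (var (inj₁ (inj₂ i)))))))

    con-surjective : Constructible {Fin k × Elt} (λ x → IsSurjective R 𝒢 gen L (λ i y → x (i , y)))
    con-surjective = con-cong
      (λ x → (λ (onV , onE) → λ { (inj₁ v) → onV v ; (inj₂ e) → onE e }) , (λ on → (λ v → on (inj₁ v)) , (λ e → on (inj₂ e))))
      (con-∩ (con-∀-index finite λ v → con-surjectiveAt (inj₁ v)) (con-∀-index E-finite λ e → con-surjectiveAt (inj₂ e)))


-- Families of subspaces and their dimension vectors

module FunctionCodes {Y : Set} (fin : Finite Y) (b : ℕ) where

  open Inverse (proj₂ fin) using (to; from; strictlyInverseʳ)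

  -- A finite enumeration of the functions bounded by `b`. It makes a quantifier over dimension
  -- vectors a finite disjunction or a finite intersection of generic conditions.
  Code : Set
  Code = Fin (suc b ℕ.^ proj₁ fin)

  decode : Code → Y → ℕ
  decode n y = toℕ (Fin.finToFun {suc b} {proj₁ fin} n (to y))

  decode-≤ : ∀ n y → decode n y ℕ.≤ b
  decode-≤ n y = ℕ.≤-pred (Fin.toℕ<n (Fin.finToFun {suc b} {proj₁ fin} n (to y)))

  encode : ∀ (h : Y → ℕ) → (∀ y → h y ℕ.≤ b) → ∃[ n ] (∀ y → decode n y ≡ h y)
  encode h h≤ = Fin.funToFin bounded , λ y → ≡.trans (≡.cong toℕ (Fin.finToFun-funToFin bounded (to y)))
      (≡.trans (Fin.toℕ-fromℕ< (s≤s (h≤ (from (to y))))) (≡.cong h (strictlyInverseʳ y)))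
    where
    bounded : Fin (proj₁ fin) → Fin (suc b)
    bounded i = Fin.fromℕ< (s≤s (h≤ (from i)))

module Families (em : ∀ {a} → ExcludedMiddle a) {c ℓ₁} (R : CommutativeRing c ℓ₁) (isField : IsField R)
                (closed : IsAlgebraicallyClosed R)
                (𝒢 : FiniteGroup) (gen : Fin 2 → FiniteGroup.Carrier 𝒢)
                (L : Subgraph (cayleyBigraph 𝒢 gen)) where

  open ExcessTheory em R isField 𝒢 gen
  open QuantifierElimination em R isField closed
  open Realisation em R isField closed 𝒢 gen L
  open Extremum em
  open FiniteTypes
  open CommutativeRing R hiding (zero) renaming (Carrier to F)
  open FiniteGroup 𝒢 using (finite) renaming (Carrier to Elt)
  open Graph (cayleyBigraph 𝒢 gen)
  open Subspace

  private variable
    k : ℕ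

  private
    pad : ∀ {n} → List (Elt → F) → Fin n → Elt → F
    -- A default for the positions beyond the list, which `indices` of its length does not reach.
    pad []       j       = λ _ → 0#
    pad (v ∷ vs) zero    = v
    pad (v ∷ vs) (suc j) = pad vs j

    map-take-allFin : ∀ n {b} (f : Fin b → Elt → F) → map f (take n (allFin b)) ≡ take n (tabulate f)
    map-take-allFin n {b} f = ≡.trans (≡.sym (List.take-map n (allFin b))) (≡.cong (take n) (List.map-tabulate id f))

    take-pad : ∀ {b} vs → length vs ℕ.≤ b → take (length vs) (tabulate {n = b} (pad vs)) ≡ vs
    take-pad {zero}  []       _       = ≡.refl
    take-pad {suc b} []       _       = ≡.refl
    take-pad {suc b} (v ∷ vs) (s≤s ≤b) = ≡.cong (v ∷_) (take-pad vs ≤b)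

    map-pad : ∀ vs → length vs ℕ.≤ capacity → map (pad vs) (indices (length vs)) ≡ vs
    map-pad vs ≤capacity = ≡.trans (map-take-allFin (length vs) (pad vs)) (take-pad vs ≤capacity)

    length-indices : ∀ n → n ℕ.≤ capacity → length (indices n) ≡ n
    length-indices n n≤ = ≡.trans (List.length-take n (allFin capacity))
      (≡.trans (≡.cong (n ℕ.⊓_) (List.length-tabulate id)) (ℕ.m≤n⇒m⊓n≡m n≤))

    length-indices-≤ : ∀ n → length (indices n) ℕ.≤ n
    length-indices-≤ n = ≡.subst (ℕ._≤ n) (≡.sym (List.length-take n (allFin capacity))) (ℕ.m⊓n≤m n _)

    basisOf : ∀ {p} → Subspace R 𝔸 p → List (Elt → F)
    basisOf S = proj₁ (basis S)

    map-basis : ∀ {p} (S : Subspace R 𝔸 p) → map (pad (basisOf S)) (indices (dim S)) ≡ basisOf S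
    map-basis S = map-pad (basisOf S) (dim-bounded S)

    all-unmap : ∀ {p} (P : Pred (Elt → F) p) (f : Fin capacity → Elt → F) js → All P (map f js) → All (λ j → P (f j)) js
    all-unmap P f js = All.map⁻

  Kernel : (Fin k → Elt → F) → V → Subspace R 𝔸 ℓ₁
  Kernel M v = relations R 𝒢 gen L M (inj₁ v)

  abstract
    family⇒realises : ∀ (M : Fin k → Elt → F) (U : Family) → U ⊑ Kernel M → Realises M (λ v → dim (U v)) (λ e → dim (Γ L U e))
    family⇒realises M U U⊑K =
        (λ (v , j , x) → pad (basisOf (U v)) j x)
      , (λ v → all-unmap (Member (Kernel M v)) (pad (basisOf (U v))) (indices (dim (U v)))
          (≡.subst (All (Member (Kernel M v))) (≡.sym (map-basis (U v)))
            (All.map (U⊑K v) (proj₁ (proj₂ (proj₂ (basis (U v))))))))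
      , λ e → (λ (j , x) → pad (basisOf (Γ L U e)) j x)
        , ≡.subst (Independent (Member Zero)) (≡.sym (map-basis (Γ L U e))) (proj₁ (proj₂ (basis (Γ L U e))))
        , all-unmap (Good e) (pad (basisOf (Γ L U e))) (indices (dim (Γ L U e)))
            (≡.subst (All (Good e)) (≡.sym (map-basis (Γ L U e)))
              (All.map (λ {w} → good e {w}) (proj₁ (proj₂ (proj₂ (basis (Γ L U e)))))))
      where
      In : V → Pred (Elt → F) (c ⊔ ℓ₁)
      In v = Spanned (Member Zero) (map (pad (basisOf (U v))) (indices (dim (U v))))

      Good : E → Pred (Elt → F) (c ⊔ ℓ₁)
      Good e w = SupportedAt R 𝒢 gen L (inj₂ e) w × In (head e) w × In (tail e) w

      inside : ∀ v {w} → Member (U v) w → In v w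
      inside v {w} w∈ = ≡.subst (λ vs → Spanned (Member Zero) vs w) (≡.sym (map-basis (U v))) (proj₂ (proj₂ (proj₂ (basis (U v)))) w∈)

      good : ∀ e {w} → Member (Γ L U e) w → Good e w
      good e {w} (s , h , t) = s , inside (head e) {w} h , inside (tail e) {w} t

    -- Equalities of dimension cannot be recovered, since the spanning vectors may be dependent and
    -- the edge spaces may be larger than witnessed; but both inequalities point in the direction
    -- that does not lower the excess.
    realises⇒family : ∀ (M : Fin k → Elt → F) u g → (∀ e → g e ℕ.≤ capacity) → Realises M u g →
      Σ Family λ U → U ⊑ Kernel M × (∀ v → dim (U v) ℕ.≤ u v) × (∀ e → g e ℕ.≤ dim (Γ L U e))
    realises⇒family M u g g≤ (B , B∈ , C) = U
      , (λ v → span-least Zero (Kernel M v) (Zero-least (Kernel M v)) (All.map⁺ (B∈ v)))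
      , (λ v → ℕ.≤-trans (dim-≤-span (U v) id) (ℕ.≤-trans (ℕ.≤-reflexive (List.length-map _ (indices (u v)))) (length-indices-≤ (u v))))
      , λ e → edge e (C e)
      where
      U : Family
      U v = Span Zero (map (λ j x → B (v , j , x)) (indices (u v)))

      edge : ∀ e → EdgeWitness B e (u (head e)) (u (tail e)) (g e) → g e ℕ.≤ dim (Γ L U e)
      edge e (Cₑ , ind , Cₑ∈) = ≡.subst (ℕ._≤ dim (Γ L U e))
        (≡.trans (List.length-map (λ j x → Cₑ (j , x)) (indices (g e))) (length-indices (g e) (g≤ e)))
        (independent-≤-dim (Γ L U e) ind (All.map⁺ Cₑ∈))

    realises-resp : ∀ (M : Fin k → Elt → F) {u u′ g g′} → (∀ v → u v ≡ u′ v) → (∀ e → g e ≡ g′ e) → Realises M u g → Realises M u′ g′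
    realises-resp M {u} {u′} {g} {g′} u≡ g≡ (B , B∈ , C) = B
      , (λ v → ≡.subst (λ n → All (λ j → Member (Kernel M v) (λ x → B (v , j , x))) (indices n)) (u≡ v) (B∈ v))
      , λ e → ≡.subst (EdgeWitness B e (u′ (head e)) (u′ (tail e))) (g≡ e)
          (≡.subst₂ (λ m n → EdgeWitness B e m n (g e)) (u≡ (head e)) (u≡ (tail e)) (C e))

  module Cv = FunctionCodes {V} finite capacity
  module Ce = FunctionCodes {E} E-finite capacity

  Excessive : (Fin k → Elt → F) → ℤ → Set (lsuc (c ⊔ ℓ₁))
  Excessive M n = SheafBridge.Excessive em R isField 𝒢 gen L M n

  abstract
    -- Only finitely many dimension vectors occur, so the quantifier over families is a finite
    -- disjunction of the conditions `Realises` with large enough excess.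
    con-excessive : ∀ n → Constructible {Fin k × Elt} (λ x → Excessive (λ i y → x (i , y)) n)
    con-excessive {k = k} n = con-cong (λ x → to x , from x)
      (con-∃-index (finite-Fin _) λ cv → con-∃-index (finite-Fin _) λ ce →
        con-∩ (con-realises (Cv.decode cv) (Ce.decode ce)) (con-constant (n ℤ.≤ ΣE (Ce.decode ce) ⊖ ΣV (Cv.decode cv))))
      where
      Coded : (Fin k × Elt → F) → Set (c ⊔ ℓ₁)
      Coded x = Σ Cv.Code λ cv → Σ Ce.Code λ ce →
        Realises (λ i y → x (i , y)) (Cv.decode cv) (Ce.decode ce) × n ℤ.≤ ΣE (Ce.decode ce) ⊖ ΣV (Cv.decode cv)

      to : ∀ x → Coded x → Excessive (λ i y → x (i , y)) n
      to x (cv , ce , real , n≤) = extract (realises⇒family (λ i y → x (i , y)) (Cv.decode cv) (Ce.decode ce) (Ce.decode-≤ ce) real)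
        where
        extract : (Σ Family λ U → U ⊑ Kernel (λ i y → x (i , y)) × (∀ v → dim (U v) ℕ.≤ Cv.decode cv v) × (∀ e → Ce.decode ce e ℕ.≤ dim (Γ L U e))) →
                  Excessive (λ i y → x (i , y)) n
        extract (U , U⊑K , u≤ , g≤) = U , U⊑K , ℤ.≤-trans n≤
          (⊖-≤⁺ (ΣE (Ce.decode ce)) (ΣV (Cv.decode cv)) (pos L U) (neg L U) (ℕ.+-mono-≤ (ΣE-mono g≤) (ΣV-mono u≤)))

      from : ∀ x → Excessive (λ i y → x (i , y)) n → Coded x
      from x (U , U⊑K , n≤) = cv , ce
        , realises-resp (λ i y → x (i , y)) (λ v → ≡.sym (u≡ v)) (λ e → ≡.sym (g≡ e)) (family⇒realises (λ i y → x (i , y)) U U⊑K)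
        , ℤ.≤-trans n≤ (⊖-≤⁺ (pos L U) (neg L U) (ΣE (Ce.decode ce)) (ΣV (Cv.decode cv))
            (ℕ.+-mono-≤ (ΣE-mono λ e → ℕ.≤-reflexive (≡.sym (g≡ e))) (ΣV-mono λ v → ℕ.≤-reflexive (u≡ v))))
        where
        codedV : ∃[ code ] (∀ v → Cv.decode code v ≡ dim (U v))
        codedV = Cv.encode (λ v → dim (U v)) (λ v → dim-bounded (U v))

        codedE : ∃[ code ] (∀ e → Ce.decode code e ≡ dim (Γ L U e))
        codedE = Ce.encode (λ e → dim (Γ L U e)) (λ e → dim-bounded (Γ L U e))

        cv : Cv.Code
        cv = proj₁ codedV

        ce : Ce.Code
        ce = proj₁ codedE

        u≡ : ∀ v → Cv.decode cv v ≡ dim (U v)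
        u≡ = proj₂ codedV

        g≡ : ∀ e → Ce.decode ce e ≡ dim (Γ L U e)
        g≡ = proj₂ codedE

-- Right translation by the group

module Translation (em : ∀ {a} → ExcludedMiddle a) {c ℓ₁} (R : CommutativeRing c ℓ₁) (isField : IsField R)
                   (closed : IsAlgebraicallyClosed R)
                   (𝒢 : FiniteGroup) (gen : Fin 2 → FiniteGroup.Carrier 𝒢)
                   (L : Subgraph (cayleyBigraph 𝒢 gen)) where

  open ExcessTheory em R isField 𝒢 gen
  open Realisation em R isField closed 𝒢 gen L
  open Families em R isField closed 𝒢 gen L
  open CommutativeRing R hiding (zero) renaming (Carrier to F)
  open SemiringSum semiring using (sum-permute; sum-cong-≗) renaming (sum to ∑)
  open FiniteGroup 𝒢 using (finite; _∙_; _⁻¹; identityʳ; inverseˡ; inverseʳ) renaming (Carrier to Elt; assoc to ∙-assoc)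
  open Graph (cayleyBigraph 𝒢 gen)
  open Subspace

  private variable
    k : ℕ

  open import Data.Sum.Properties using (inj₁-injective; inj₂-injective)

  ∙-cancel : ∀ x h → (x ∙ h) ∙ h ⁻¹ ≡ x
  ∙-cancel x h = ≡.trans (∙-assoc x h (h ⁻¹)) (≡.trans (≡.cong (x ∙_) (inverseʳ h)) (identityʳ x))

  ∙-cancel′ : ∀ x h → (x ∙ h ⁻¹) ∙ h ≡ x
  ∙-cancel′ x h = ≡.trans (∙-assoc x (h ⁻¹) h) (≡.trans (≡.cong (x ∙_) (inverseˡ h)) (identityʳ x))

  module _ (h : Elt) where

    -- Edges multiply by the generators from the left, so right multiplication is an automorphism of
    -- the graph and preserves the shape of the supports. Precomposition with it carries vectors at
    -- `v ∙ h` to vectors at `v`.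
    shift : (Elt → F) → Elt → F
    shift a x = a (x ∙ h)

    shiftMatrix : (Fin k → Elt → F) → Fin k → Elt → F
    shiftMatrix M i = shift (M i)

    shiftV : V → V
    shiftV v = v ∙ h

    shiftE : E → E
    shiftE (v , j) = v ∙ h , j

    private
      module Shift = InjectiveImage em R isField 𝔸 𝔸 shift (λ v≈w x → v≈w (x ∙ h))
        (λ {v} {w} v≈w x → ≡.subst (λ y → v y ≈ w y) (∙-cancel′ x h) (v≈w (x ∙ h ⁻¹)))
        (λ x → refl) (λ v w x → refl) (λ a v x → refl)

      open Inverse (proj₂ finite) using (to; from; strictlyInverseˡ; strictlyInverseʳ)

      permutation : Fin (proj₁ finite) ↔ Fin (proj₁ finite)
      permutation = mk↔ₛ′ (λ j → to (from j ∙ h)) (λ j → to (from j ∙ h ⁻¹))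
        (λ j → ≡.trans (≡.cong (λ x → to (x ∙ h)) (strictlyInverseʳ (from j ∙ h ⁻¹)))
                 (≡.trans (≡.cong to (∙-cancel′ (from j) h)) (strictlyInverseˡ j)))
        (λ j → ≡.trans (≡.cong (λ x → to (x ∙ h ⁻¹)) (strictlyInverseʳ (from j ∙ h)))
                 (≡.trans (≡.cong to (∙-cancel (from j) h)) (strictlyInverseˡ j)))

      shift-sum : ∀ (f : Elt → F) → ∑ (λ j → f (element finite j ∙ h)) ≈ ∑ (λ j → f (element finite j))
      shift-sum f = sym (trans (sum-permute (λ j → f (element finite j)) permutation)
        (reflexive (sum-cong-≗ λ j → ≡.cong f (strictlyInverseʳ (element finite j ∙ h)))))

      module ℕ∑ = CommutativeMonoidSum ℕ.+-0-commutativeMonoid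

      sum-tabulate : ∀ {n} (f : Fin n → ℕ) → sum (tabulate f) ≡ ℕ∑.sum f
      sum-tabulate {zero}  f = ≡.refl
      sum-tabulate {suc n} f = ≡.cong (f zero ℕ.+_) (sum-tabulate (f ∘ suc))

      ΣV-∑ : ∀ u → ΣV u ≡ ℕ∑.sum (u ∘ element finite)
      ΣV-∑ u = ≡.trans (≡.cong sum (≡.trans (≡.sym (List.map-∘ (allFin (proj₁ finite)))) (List.map-tabulate id (u ∘ element finite))))
        (sum-tabulate (u ∘ element finite))

      unshift : ∀ g x v → g ∙ (x ∙ h) ≡ v ∙ h → g ∙ x ≡ v
      unshift g x v eq = ≡.trans (≡.sym (∙-cancel (g ∙ x) h))
        (≡.trans (≡.cong (_∙ h ⁻¹) (≡.trans (∙-assoc g x h) eq)) (∙-cancel v h))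

      shift-supportedV : ∀ v {a} → SupportedAt R 𝒢 gen L (inj₁ (v ∙ h)) a → SupportedAt R 𝒢 gen L (inj₁ v) (shift a)
      shift-supportedV v s x x∉ = s (x ∙ h) λ where
        (inj₁ g , g∈ , eq) → x∉ (inj₁ g , g∈ , ≡.cong inj₁ (unshift g x v (inj₁-injective eq)))

      shift-supportedE : ∀ v j {a} → SupportedAt R 𝒢 gen L (inj₂ (v ∙ h , j)) a → SupportedAt R 𝒢 gen L (inj₂ (v , j)) (shift a)
      shift-supportedE v j s x x∉ = s (x ∙ h) λ where
        (inj₂ (g , i) , g∈ , eq) → x∉ (inj₂ (g , i) , g∈ ,
          ≡.cong₂ (λ w i → inj₂ (w , i)) (unshift g x v (≡.cong proj₁ (inj₂-injective eq))) (≡.cong proj₂ (inj₂-injective eq)))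

      shift-kernel : ∀ (M : Fin k → Elt → F) v {a} → Member (Kernel M (v ∙ h)) a → Member (Kernel (shiftMatrix M) v) (shift a)
      shift-kernel M v {a} (s , z) = shift-supportedV v {a} s , λ i → trans (shift-sum (λ x → a x * M i x)) (z i)

    abstract
      ΣV-shift : ∀ u → ΣV (u ∘ shiftV) ≡ ΣV u
      ΣV-shift u = ≡.trans (ΣV-∑ (u ∘ shiftV)) (≡.sym (≡.trans (ΣV-∑ u)
        (≡.trans (ℕ∑.sum-permute (u ∘ element finite) permutation)
          (ℕ∑.sum-cong-≗ λ j → ≡.cong u (strictlyInverseʳ (element finite j ∙ h))))))

      ΣE-shift : ∀ g → ΣE (g ∘ shiftE) ≡ ΣE g
      ΣE-shift g = ≡.cong₂ ℕ._+_ (ΣV-shift (λ v → g (v , zero))) (ΣV-shift (λ v → g (v , suc zero)))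

      shift-realises : ∀ (M : Fin k → Elt → F) u g → Realises M u g → Realises (shiftMatrix M) (u ∘ shiftV) (g ∘ shiftE)
      shift-realises M u g (B , B∈ , C) = B′
        , (λ v → All.map (λ {j} → shift-kernel M v {λ x → B (v ∙ h , j , x)}) (B∈ (v ∙ h)))
        , λ (v , j) → shift-edge v j (C (v ∙ h , j))
        where
        B′ : V × Fin capacity × Elt → F
        B′ (v , j , x) = B (v ∙ h , j , x ∙ h)

        -- The vertex is generalised along an equation, because the head of the translated edge is
        -- `gen j ∙ (v ∙ h)`, which agrees with the translated head `(gen j ∙ v) ∙ h` only by
        -- associativity.
        spanned : ∀ v {w} → Spanned (Member Zero) (map (λ j x → B (v , j , x)) (indices (u v))) w →
                  ∀ v′ → v ≡ v′ ∙ h → Spanned (Member Zero) (map (λ j x → B′ (v′ , j , x)) (indices (u (v′ ∙ h)))) (shift w)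
        spanned v {w} s v′ ≡.refl = ≡.subst (λ vs → Spanned (Member Zero) vs (shift w)) (≡.sym (List.map-∘ (indices (u v)))) (Shift.spanned-image s)

        shift-edge : ∀ v j → EdgeWitness B (v ∙ h , j) (u (gen j ∙ (v ∙ h))) (u (v ∙ h)) (g (v ∙ h , j)) →
                     EdgeWitness B′ (v , j) (u ((gen j ∙ v) ∙ h)) (u (v ∙ h)) (g (v ∙ h , j))
        shift-edge v j (Cₑ , ind , Cₑ∈) = (λ (i , x) → Cₑ (i , x ∙ h))
          , ≡.subst (Independent (Member Zero)) (≡.sym (List.map-∘ (indices (g (v ∙ h , j))))) (Shift.independent-image ind)
          , All.map (λ {i} (s , hd , tl) → shift-supportedE v j {λ x → Cₑ (i , x)} s
              , spanned (gen j ∙ (v ∙ h)) {λ x → Cₑ (i , x)} hd (gen j ∙ v) (≡.sym (∙-assoc (gen j) v h))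
              , spanned (v ∙ h) {λ x → Cₑ (i , x)} tl v ≡.refl) Cₑ∈


-- Symmetry of generic matrices and divisibility of the excess

module GenericMatrices (em : ∀ {a} → ExcludedMiddle a) {c ℓ₁} (R : CommutativeRing c ℓ₁) (isField : IsField R)
                       (closed : IsAlgebraicallyClosed R)
                       (𝒢 : FiniteGroup) (gen : Fin 2 → FiniteGroup.Carrier 𝒢)
                       (L : Subgraph (cayleyBigraph 𝒢 gen)) where

  open ExcessTheory em R isField 𝒢 gen
  open Density em R isField closed
  open QuantifierElimination em R isField closed
  open Realisation em R isField closed 𝒢 gen L
  open Families em R isField closed 𝒢 gen L
  open Translation em R isField closed 𝒢 gen L
  open Extremum em
  open FiniteTypes
  open ListSums
  open CommutativeRing R hiding (zero) renaming (Carrier to F)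
  open FiniteGroup 𝒢 using (finite; _∙_; _⁻¹; ε; identityˡ; inverseʳ) renaming (Carrier to Elt)
  open Graph (cayleyBigraph 𝒢 gen)

  private variable
    k : ℕ

  matrix : (Fin k × Elt → F) → Fin k → Elt → F
  matrix x i y = x (i , y)

  generic-index : ∀ {p} {X Y : Set} → Finite Y → {S : Y → Pred (X → F) p} → (∀ i → Generic (S i)) → Generic (λ x → ∀ i → S i x)
  generic-index (n , bij) {S} gens = generic-mono (λ {x} all i → ≡.subst (λ j → S j x) (strictlyInverseʳ i) (all (to i)))
    (generic-Fin {S = S ∘ from} (gens ∘ from))
    where open Inverse bij using (to; from; strictlyInverseʳ)

  -- Translation replaces `M` by another matrix, so this is a genuine condition on `M`. It holds
  -- generically because each pair of codes is realised either generically, and then so is its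
  -- translate, or generically not at all.
  Symmetric : (Fin k → Elt → F) → Set (c ⊔ ℓ₁)
  Symmetric M = ∀ cv ce h → Realises M (Cv.decode cv) (Ce.decode ce) →
                Realises M (Cv.decode cv ∘ shiftV h) (Ce.decode ce ∘ shiftE h)

  abstract
    generic-shift : ∀ h u g → Generic {Fin k × Elt} (λ x → Realises (matrix x) u g) →
                    Generic {Fin k × Elt} (λ x → Realises (matrix x) (u ∘ shiftV h) (g ∘ shiftE h))
    generic-shift {k = k} h u g gen = generic-mono
      (λ {x} real → con-resp (con-realises (u ∘ shiftV h) (g ∘ shiftE h))
        {λ (i , y) → x (i , (y ∙ h) ∙ h ⁻¹)} {x} (λ (i , y) → reflexive (≡.cong (λ z → x (i , z)) (∙-cancel y h)))
        (shift-realises h (λ i y → x (i , y ∙ h ⁻¹)) u g real))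
      -- The inverse translate of `x` is the matrix required to be generic, so that `shift-realises`
      -- leads back to `x` itself, up to cancellation of `h`.
      (generic-pullback {S = λ x → Realises (matrix x) u g} (λ (i , y) → var (i , y ∙ h ⁻¹))
        (λ y → (λ (i , z) → y (i , z ∙ h)) , λ (i , z) → reflexive (≡.cong (λ w → y (i , w)) (∙-cancel′ z h))) gen)

    generic-symmetric : Generic {Fin k × Elt} (λ x → Symmetric (matrix x))
    generic-symmetric {k = k} = generic-index (finite-Fin _) λ cv → generic-index (finite-Fin _) λ ce → generic-index finite λ h →
      at cv ce h (con-generic (con-realises (Cv.decode cv) (Ce.decode ce)))
      where
      at : ∀ cv ce h →
           Generic {Fin k × Elt} (λ x → Realises (matrix x) (Cv.decode cv) (Ce.decode ce)) ⊎
           Generic {Fin k × Elt} (λ x → ¬ Realises (matrix x) (Cv.decode cv) (Ce.decode ce)) →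
           Generic {Fin k × Elt} (λ x → Realises (matrix x) (Cv.decode cv) (Ce.decode ce) →
             Realises (matrix x) (Cv.decode cv ∘ shiftV h) (Ce.decode ce ∘ shiftE h))
      at cv ce h (inj₁ gen) = generic-mono (λ real _ → real) (generic-shift h (Cv.decode cv) (Ce.decode ce) gen)
      at cv ce h (inj₂ gen) = generic-mono (λ ¬real real → ⊥-elim (¬real real)) gen

  order : ℕ
  order = length (elements finite)

  -- The translates of the minimal maximizer are minimal maximizers, so its dimensions are invariant under 𝒢.
  module _ (M : Fin k → Elt → F) (symmetric : Symmetric M) (U : Family) (U-min : IsMinimalMaximizer L (Kernel M) U) where

    private
      u : V → ℕ
      u v = dim (U v)

      g : E → ℕ
      g e = dim (Γ L U e)

      U-max : IsMaximizer L (Kernel M) U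
      U-max = proj₁ U-min

      translated : ∀ h → Realises M (u ∘ shiftV h) (g ∘ shiftE h)
      translated h = realises-resp M (λ v → proj₂ codedV (shiftV h v)) (λ e → proj₂ codedE (shiftE h e))
        (symmetric (proj₁ codedV) (proj₁ codedE) h
          (realises-resp M (λ v → ≡.sym (proj₂ codedV v)) (λ e → ≡.sym (proj₂ codedE e)) (family⇒realises M U (proj₁ U-max))))
        where
        codedV : ∃[ code ] (∀ v → Cv.decode code v ≡ u v)
        codedV = Cv.encode u (λ v → dim-bounded (U v))

        codedE : ∃[ code ] (∀ e → Ce.decode code e ≡ g e)
        codedE = Ce.encode g (λ e → dim-bounded (Γ L U e))

      module _ (h : Elt) (U′ : Family) (U′⊑K : U′ ⊑ Kernel M)
               (u≤ : ∀ v → dim (U′ v) ℕ.≤ u (shiftV h v)) (g≤ : ∀ e → g (shiftE h e) ℕ.≤ dim (Γ L U′ e)) where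

        neg≤ : neg L U′ ℕ.≤ neg L U
        neg≤ = ℕ.≤-trans (ΣV-mono u≤) (ℕ.≤-reflexive (ΣV-shift h u))

        pos≤ : pos L U ℕ.≤ pos L U′
        pos≤ = ℕ.≤-trans (ℕ.≤-reflexive (≡.sym (ΣE-shift h g))) (ΣE-mono g≤)

        U′-max : IsMaximizer L (Kernel M) U′
        U′-max = U′⊑K , λ W W⊑K → ℤ.≤-trans (proj₂ U-max W W⊑K)
          (⊖-≤⁺ (pos L U) (neg L U) (pos L U′) (neg L U′) (ℕ.+-mono-≤ pos≤ neg≤))

        U⊑U′ : U ⊑ U′
        U⊑U′ = minimalMaximizer-⊑ L (Kernel M) {U} {U′} U-min U′-max

        U′⊑U : U′ ⊑ U
        -- `U` is contained in the maximizer `U′`, and the translate has no larger total dimension;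
        -- so the two families agree.
        U′⊑U v = equal-dim (U v) (U′ v) (U⊑U′ v)
          (sum-map-tight {f = u} {λ v → dim (U′ v)} (elements finite) (λ v → dim-mono (U v) (U′ v) (U⊑U′ v)) neg≤ (elements-complete finite v))

        u-shift : ∀ v → u v ℕ.≤ u (shiftV h v)
        u-shift v = ℕ.≤-trans (dim-mono (U v) (U′ v) (U⊑U′ v)) (u≤ v)

        g-shift : ∀ e → g (shiftE h e) ℕ.≤ g e
        g-shift e = ℕ.≤-trans (g≤ e) (dim-mono (Γ L U′ e) (Γ L U e) (Γ-mono L {U′} {U} U′⊑U e))

      invariant : ∀ h → (∀ v → u v ℕ.≤ u (v ∙ h)) × (∀ e → g (shiftE h e) ℕ.≤ g e)
      invariant h = extract (realises⇒family M (u ∘ shiftV h) (g ∘ shiftE h) (λ e → dim-bounded (Γ L U (shiftE h e))) (translated h))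
        where
        extract : (Σ Family λ U′ → U′ ⊑ Kernel M × (∀ v → dim (U′ v) ℕ.≤ u (shiftV h v)) × (∀ e → g (shiftE h e) ℕ.≤ dim (Γ L U′ e))) →
                  (∀ v → u v ℕ.≤ u (v ∙ h)) × (∀ e → g (shiftE h e) ℕ.≤ g e)
        extract (U′ , U′⊑K , u≤ , g≤) = u-shift h U′ U′⊑K u≤ g≤ , g-shift h U′ U′⊑K u≤ g≤

      u-constant : ∀ v → u v ≡ u ε
      -- Translation by `v ⁻¹` leads from `v` to `ε`, and translation by `v` leads back.
      u-constant v = ℕ.≤-antisym
        (≡.subst (λ w → u v ℕ.≤ u w) (inverseʳ v) (proj₁ (invariant (v ⁻¹)) v))
        (≡.subst (λ w → u ε ℕ.≤ u w) (identityˡ v) (proj₁ (invariant v) ε))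

      g-constant : ∀ v j → g (v , j) ≡ g (ε , j)
      g-constant v j = ℕ.≤-antisym
        (≡.subst (λ w → g (w , j) ℕ.≤ g (ε , j)) (identityˡ v) (proj₂ (invariant v) (ε , j)))
        (≡.subst (λ w → g (w , j) ℕ.≤ g (v , j)) (inverseʳ v) (proj₂ (invariant (v ⁻¹)) (v , j)))

    abstract
      minimalMaximizer-divisible : ∃[ a ] ∃[ b ] (pos L U ≡ order ℕ.* a × neg L U ≡ order ℕ.* b)
      minimalMaximizer-divisible = g (ε , zero) ℕ.+ g (ε , suc zero) , u ε
        , ≡.trans (≡.cong₂ ℕ._+_ (sum-map-const (g (ε , zero)) (elements finite) (λ v → g-constant v zero))
                                 (sum-map-const (g (ε , suc zero)) (elements finite) (λ v → g-constant v (suc zero))))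
                  (≡.sym (ℕ.*-distribˡ-+ order (g (ε , zero)) (g (ε , suc zero))))
        , sum-map-const (u ε) (elements finite) u-constant


-- Removal of an edge: loss of excess and surjectivity

module EdgeRemoval (em : ∀ {a} → ExcludedMiddle a) {c ℓ₁} (R : CommutativeRing c ℓ₁) (isField : IsField R)
                   (closed : IsAlgebraicallyClosed R)
                   (𝒢 : FiniteGroup) (gen : Fin 2 → FiniteGroup.Carrier 𝒢)
                   (L : Subgraph (cayleyBigraph 𝒢 gen)) (e₀ : Graph.E (cayleyBigraph 𝒢 gen)) where

  open ExcessTheory em R isField 𝒢 gen
  open Density em R isField closed
  open QuantifierElimination em R isField closed
  open UnivariatePolynomials em R isField closed using (off-point; isPolynomial-eval; extend)
  open FieldTheory em R isField
  open DifferenceSolver R using (solve; _:=_) renaming (_:+_ to _⊹_; _:*_ to _⊛_; :-_ to ⊝_; _:-_ to _⊖′_; con to constant)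
  open Extremum em
  open ListSums
  open CommutativeRing R hiding (zero) renaming (Carrier to F)
  open SemiringSum semiring using (sum-cong-≋; ∑-distrib-+; *-distribˡ-sum) renaming (sum to ∑)
  open FiniteGroup 𝒢 using (finite; _∙_; _⁻¹; identityˡ; inverseˡ) renaming (Carrier to Elt; assoc to ∙-assoc)
  open Graph (cayleyBigraph 𝒢 gen)
  open Subspace

  private
    L′ = removeEdge L e₀

    module On = GenericMatrices em R isField closed 𝒢 gen L
    module On′ = GenericMatrices em R isField closed 𝒢 gen L′
    module Fam = Families em R isField closed 𝒢 gen L
    module Fam′ = Families em R isField closed 𝒢 gen L′
    module Real = Realisation em R isField closed 𝒢 gen L
    module Real′ = Realisation em R isField closed 𝒢 gen L′

    variable
      k : ℕ

  open On using (matrix; order; Symmetric; generic-symmetric; minimalMaximizer-divisible; generic-index)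

  -- The only translator of a translate (v , i) of e₀ that removing e₀ destroys.
  lost : V → Elt
  lost v = proj₁ e₀ ⁻¹ ∙ v

  private
    Tr Tr′ : V ⊎ E → Pred Elt 0ℓ
    Tr = Translators 𝒢 gen L
    Tr′ = Translators 𝒢 gen L′

    kept : ∀ f → T (Subgraph.hasE L f) → ¬ f ≡ e₀ → T (Subgraph.hasE L′ f)
    kept f f∈ f≢e₀ with decEq E-finite f e₀
    ... | yes f≡e₀ = ⊥-elim (f≢e₀ f≡e₀)
    ... | no  _    = Equivalence.from T-∧ (f∈ , _)

    translators-vertex : ∀ v → Tr (inj₁ v) ⊆ Tr′ (inj₁ v)
    translators-vertex v (inj₁ w , w∈ , eq) = inj₁ w , w∈ , eq

    translators-edge : ∀ v j {x} → ¬ (x ≡ lost v × j ≡ proj₂ e₀) → Tr (inj₂ (v , j)) x → Tr′ (inj₂ (v , j)) x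
    translators-edge v j {x} other (inj₂ (w , i) , f∈ , ≡.refl) = inj₂ (w , i) , kept (w , i) f∈ (λ { ≡.refl → other (x≡ , ≡.refl) }) , ≡.refl
      where
      x≡ : x ≡ w ⁻¹ ∙ (w ∙ x)
      x≡ = ≡.sym (≡.trans (≡.sym (∙-assoc (w ⁻¹) w x)) (≡.trans (≡.cong (_∙ x) (inverseˡ w)) (identityˡ x)))

    lostAt : V ⊎ E → Elt
    -- No translator is lost at a vertex; the value is an arbitrary choice that lets the projection
    -- below treat vertices and edges alike.
    lostAt (inj₁ v)       = v
    lostAt (inj₂ (v , _)) = lost v

    translators-off : ∀ P {x} → ¬ x ≡ lostAt P → Tr P x → Tr′ P x
    translators-off (inj₁ v)       _       = translators-vertex v
    translators-off (inj₂ (v , j)) x≢lost  = translators-edge v j (x≢lost ∘ proj₁)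

    supported-vertex : ∀ v {a} → SupportedAt R 𝒢 gen L (inj₁ v) a → SupportedAt R 𝒢 gen L′ (inj₁ v) a
    supported-vertex v s x x∉ = s x (x∉ ∘ translators-vertex v)

    supported-edge : ∀ v j {a} → (j ≡ proj₂ e₀ → a (lost v) ≈ 0#) →
                     SupportedAt R 𝒢 gen L (inj₂ (v , j)) a → SupportedAt R 𝒢 gen L′ (inj₂ (v , j)) a
    supported-edge v j {a} vanish s x x∉ with em {P = x ≡ lost v × j ≡ proj₂ e₀}
    ... | yes (≡.refl , j≡) = vanish j≡
    ... | no other          = s x (x∉ ∘ translators-edge v j other)

  private
    indicator : Fin 2 → Fin 2 → ℕ
    indicator i j with j Fin.≟ i
    ... | yes _ = 1
    ... | no  _ = 0

    indicator-sum : ∀ i → indicator i zero ℕ.+ indicator i (suc zero) ≡ 1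
    indicator-sum zero       = ≡.refl
    indicator-sum (suc zero) = ≡.refl

  -- The dimension that an edge with label `j` may lose. Of the edges with a given tail exactly one
  -- has the label of `e₀`, so the total loss is at most `order`.
  weight : Fin 2 → ℕ
  weight = indicator (proj₂ e₀)

  ΣE-weight : ΣE (λ (v , j) → weight j) ≡ order
  ΣE-weight = ≡.trans (≡.cong₂ ℕ._+_ (sum-map-const (weight zero) (elements finite) (λ _ → ≡.refl))
                                     (sum-map-const (weight (suc zero)) (elements finite) (λ _ → ≡.refl)))
    (≡.trans (≡.sym (ℕ.*-distribˡ-+ order (weight zero) (weight (suc zero))))
      (≡.trans (≡.cong (order ℕ.*_) (indicator-sum (proj₂ e₀))) (ℕ.*-identityʳ order)))

  -- Losing a translator imposes the single linear condition that the coordinate at `lost v` be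
  -- zero. If `a₀` violates it, every other vector is corrected by a multiple of `a₀`.
  dim-loss : ∀ (U : Family) v j → dim (Γ L U (v , j)) ℕ.≤ weight j ℕ.+ dim (Γ L′ U (v , j))
  dim-loss U v j with j Fin.≟ proj₂ e₀
  ... | no  j≢ = dim-mono (Γ L U (v , j)) (Γ L′ U (v , j)) λ {a} (s , ht) → supported-edge v j {a} (⊥-elim ∘ j≢) s , ht
  ... | yes _  with em {P = ∃[ a ] (Member (Γ L U (v , j)) a × ¬ (a (lost v) ≈ 0#))}
  ...   | no none = ℕ.m≤n⇒m≤1+n (dim-mono (Γ L U (v , j)) (Γ L′ U (v , j)) λ {a} a∈@(s , ht) →
            supported-edge v j {a} (λ _ → byContradiction λ ≉0 → none (a , a∈ , ≉0)) s , ht)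
  ...   | yes (a₀ , a₀∈ , ≉0) = dim-hyperplane (Γ L U (v , j)) (Γ L′ U (v , j)) a₀ λ {a} a∈ →
            b * a (lost v) , rest a
            , (supported-edge v j {rest a} (λ _ → rest-lost a) (proj₁ (rest∈ a a∈)) , proj₂ (rest∈ a a∈))
            , λ x → solve 2 (λ t r → r := t ⊹ (r ⊹ ⊝ t)) refl (b * a (lost v) * a₀ x) (a x)
    where
    b : F
    b = proj₁ (inverse ≉0)

    rest : (Elt → F) → Elt → F
    rest a x = a x + - (b * a (lost v) * a₀ x)

    rest-lost : ∀ a → rest a (lost v) ≈ 0#
    rest-lost a = trans (solve 3 (λ b r r₀ → r ⊹ ⊝ (b ⊛ r ⊛ r₀) := r ⊛ (constant (1 , 0) ⊖′ b ⊛ r₀)) refl b (a (lost v)) (a₀ (lost v)))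
      (trans (*-congˡ (trans (+-congˡ (-‿cong (proj₂ (inverse ≉0)))) (-‿inverseʳ 1#))) (zeroʳ (a (lost v))))

    rest∈ : ∀ a → Member (Γ L U (v , j)) a → Member (Γ L U (v , j)) (rest a)
    rest∈ a a∈ = resp (Γ L U (v , j)) {λ x → a x + - (b * a (lost v)) * a₀ x} {rest a}
      (λ x → solve 3 (λ r t r₀ → r ⊹ ⊝ t ⊛ r₀ := r ⊹ ⊝ (t ⊛ r₀)) refl (a x) (b * a (lost v)) (a₀ x))
      (+-mem (Γ L U (v , j)) {a} {λ x → - (b * a (lost v)) * a₀ x} a∈ (*ₗ-mem (Γ L U (v , j)) (- (b * a (lost v))) {a₀} a₀∈))

  pos-loss : ∀ U → pos L U ℕ.≤ order ℕ.+ pos L′ U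
  pos-loss U = ℕ.≤-trans (ΣE-mono λ (v , j) → dim-loss U v j)
    (ℕ.≤-reflexive (≡.trans (ΣE-+ (λ (v , j) → weight j) (λ f → dim (Γ L′ U f))) (≡.cong (ℕ._+ pos L′ U) ΣE-weight)))

  excess-loss : ∀ U → excess L U ℤ.≤ ℤ.+ order ℤ.+ excess L′ U
  excess-loss U = ℤ.≤-trans (⊖-≤⁺ (pos L U) (neg L U) (order ℕ.+ pos L′ U) (neg L′ U) (ℕ.+-monoˡ-≤ (neg L U) (pos-loss U)))
    (ℤ.≤-reflexive (≡.sym (ℤ.distribʳ-⊖-+-pos order (pos L′ U) (neg L′ U))))

  excessive-loss : ∀ (M : Fin k → Elt → F) n → Fam.Excessive M (ℤ.+ order ℤ.+ n) → Fam′.Excessive M n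
  excessive-loss M n (U , U⊑K , n≤) = U
    , (λ v {a} a∈ → supported-vertex v {a} (proj₁ (U⊑K v {a} a∈)) , proj₂ (U⊑K v {a} a∈))
    , ℤ.≮⇒≥ λ lt → ℤ.<⇒≱ (ℤ.+-monoʳ-< (ℤ.+ order) lt) (ℤ.≤-trans n≤ (excess-loss U))

  generic-tail : ∀ {p} {S : Pred (Fin k × Elt → F) p} → Generic S → Generic {Fin (suc k) × Elt} (λ x → S (λ (i , y) → x (suc i , y)))
  generic-tail = generic-pullback (λ (i , y) → var (suc i , y))
    (λ y → (λ { (zero , _) → 0# ; (suc i , z) → y (i , z) }) , λ _ → refl)

  -- Projecting the columns along the lost one turns an L-surjective matrix into an L′-surjective one;
  -- the projection is dominant because it is onto on the columns that it keeps.
  module _ (P : V ⊎ E) where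

    private
      x₀ = lostAt P

      project : Fin k × Elt → Polynomial F (Fin (suc k) × Elt)
      project (i , y) with decEq finite y x₀
      -- The minor would be zero in the lost column. A free entry keeps the map onto, and it is
      -- invisible to truncated coefficient vectors, which are zero there.
      ... | yes _ = var (suc i , y)
      -- The minor of rows `zero` and `suc i` and columns `y` and `x₀`: the column `y` projected
      -- along the lost column, with the denominator `x (zero , x₀)` cleared.
      ... | no  _ = (var (suc i , y) :* var (zero , x₀)) :+ (con (- 1#) :* (var (zero , y) :* var (suc i , x₀)))

      lift-point : (Fin k × Elt → F) → Fin (suc k) × Elt → F
      lift-point w (suc i , y) = w (i , y)
      lift-point w (zero  , y) with decEq finite y x₀
      ... | yes _ = 1#
      ... | no  _ = 0#

      lift-point-lost : ∀ (w : Fin k × Elt → F) → lift-point w (zero , x₀) ≡ 1#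
      lift-point-lost w with decEq finite x₀ x₀
      ... | yes _  = ≡.refl
      ... | no  x≢ = ⊥-elim (x≢ ≡.refl)

      lift-point-other : ∀ (w : Fin k × Elt → F) y → ¬ y ≡ x₀ → lift-point w (zero , y) ≡ 0#
      lift-point-other w y y≢ with decEq finite y x₀
      ... | yes y≡ = ⊥-elim (y≢ y≡)
      ... | no  _  = ≡.refl

      project-lift : ∀ (w : Fin k × Elt → F) i → eval R (project i) (lift-point w) ≈ w i
      project-lift w (i , y) with decEq finite y x₀
      ... | yes _  = refl
      ... | no  y≢ = trans
        (+-cong (*-congˡ (reflexive (lift-point-lost w))) (*-congˡ (*-congʳ (reflexive (lift-point-other w y y≢)))))
        (solve 2 (λ a b → a ⊛ constant (1 , 0) ⊹ ⊝ constant (1 , 0) ⊛ (constant (0 , 0) ⊛ b) := a) refl (w (i , y)) (w (i , x₀)))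

      truncate : (Elt → F) → Elt → F
      truncate a y with decEq finite y x₀
      ... | yes _ = 0#
      ... | no  _ = a y

      truncate-supported : ∀ {a} → SupportedAt R 𝒢 gen L P a → SupportedAt R 𝒢 gen L′ P (truncate a)
      truncate-supported s y y∉ with decEq finite y x₀
      ... | yes _  = refl
      ... | no  y≢ = s y (y∉ ∘ translators-off P y≢)

      truncate-term : ∀ (x : Fin (suc k) × Elt → F) a i y →
        truncate a y * eval R (project (i , y)) x ≈ x (zero , x₀) * (a y * x (suc i , y)) + - x (suc i , x₀) * (a y * x (zero , y))
      truncate-term x a i y with decEq finite y x₀
      ... | yes ≡.refl = solve 4 (λ a s t r → constant (0 , 0) ⊛ r := t ⊛ (a ⊛ s) ⊹ ⊝ s ⊛ (a ⊛ t)) refl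
                           (a x₀) (x (suc i , x₀)) (x (zero , x₀)) (x (suc i , x₀))
      ... | no _ = solve 5 (λ a m t r s → a ⊛ (m ⊛ t ⊹ ⊝ constant (1 , 0) ⊛ (r ⊛ s)) := t ⊛ (a ⊛ m) ⊹ ⊝ s ⊛ (a ⊛ r)) refl
                     (a y) (x (suc i , y)) (x (zero , x₀)) (x (zero , y)) (x (suc i , x₀))

      truncate-column : ∀ (x : Fin (suc k) × Elt → F) a i →
        columnComb R 𝒢 gen L′ (λ i y → eval R (project (i , y)) x) (truncate a) i ≈
          x (zero , x₀) * columnComb R 𝒢 gen L (matrix x) a (suc i) + - x (suc i , x₀) * columnComb R 𝒢 gen L (matrix x) a zero
      truncate-column x a i = trans (sum-cong-≋ λ j → truncate-term x a i (element finite j))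
        (trans (∑-distrib-+ (λ j → t * term (suc i) j) (λ j → s * term zero j))
          (sym (+-cong (*-distribˡ-sum t (term (suc i))) (*-distribˡ-sum s (term zero)))))
        where
        t = x (zero , x₀)
        s = - x (suc i , x₀)
        term : Fin _ → Fin (proj₁ finite) → F
        term i j = a (element finite j) * x (i , element finite j)

      projected-surjective : ∀ (x : Fin (suc k) × Elt → F) → ¬ (x (zero , x₀) ≈ 0#) → Real.SurjectiveAt (matrix x) P →
                             Real′.SurjectiveAt (λ i y → eval R (project (i , y)) x) P
      projected-surjective {k = k} x t≉0 surj b = extract (surj target)
        where
        t = x (zero , x₀)
        t⁻¹ = proj₁ (inverse t≉0)

        target : Fin (suc k) → F
        -- By `truncate-column` the zeroth coordinate carries the correction along the lost column,
        -- so it is made zero; the factor `t⁻¹` cancels the cleared denominator.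
        target zero    = 0#
        target (suc i) = t⁻¹ * b i

        extract : ∃[ a ] (SupportedAt R 𝒢 gen L P a × (∀ i → columnComb R 𝒢 gen L (matrix x) a i ≈ target i)) →
                  ∃[ a ] (SupportedAt R 𝒢 gen L′ P a × (∀ i → columnComb R 𝒢 gen L′ (λ i y → eval R (project (i , y)) x) a i ≈ b i))
        extract (a , s , eq) = truncate a , truncate-supported s , λ i →
          trans (truncate-column x a i)
          (trans (+-cong (*-congˡ (eq (suc i))) (*-congˡ (eq zero)))
          (trans (solve 4 (λ t t⁻¹ b r → t ⊛ (t⁻¹ ⊛ b) ⊹ r ⊛ constant (0 , 0) := (t⁻¹ ⊛ t) ⊛ b) refl t t⁻¹ (b i) (- x (suc i , x₀)))
          (trans (*-congʳ (proj₂ (inverse t≉0))) (*-identityˡ (b i)))))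

    abstract
      -- By `con-generic` it suffices that failure is not generic: pulled back along `project`, it
      -- would meet the `L`-surjective matrices whose entry `x (zero , x₀)` is nonzero, which
      -- `projected-surjective` forbids.
      generic-surjectiveAt : Generic {Fin (suc k) × Elt} (λ x → Real.SurjectiveAt (matrix x) P) →
                             Generic {Fin k × Elt} (λ x → Real′.SurjectiveAt (matrix x) P)
      generic-surjectiveAt {k = k} gen = decide (con-generic (Real′.con-surjectiveAt P))
        where
        nonzero : Generic {Fin (suc k) × Elt} (λ x → ¬ (x (zero , x₀) ≈ 0#))
        nonzero = var (zero , x₀) , ((λ _ → 1#) , 1≉0) , id

        decide : Generic {Fin k × Elt} (λ x → Real′.SurjectiveAt (matrix x) P) ⊎
                 Generic {Fin k × Elt} (λ x → ¬ Real′.SurjectiveAt (matrix x) P) →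
                 Generic {Fin k × Elt} (λ x → Real′.SurjectiveAt (matrix x) P)
        decide (inj₁ gen′) = gen′
        decide (inj₂ gen′) = contradict (generic-point (generic-∩ (generic-∩ gen nonzero)
          (generic-pullback {S = λ x → ¬ Real′.SurjectiveAt (matrix x) P} project (λ w → lift-point w , project-lift w) gen′)))
          where
          contradict : ∃ (λ x → (Real.SurjectiveAt (matrix x) P × ¬ (x (zero , x₀) ≈ 0#)) ×
                                ¬ Real′.SurjectiveAt (λ i y → eval R (project {k} (i , y)) x) P) →
                       Generic {Fin k × Elt} (λ x → Real′.SurjectiveAt (matrix x) P)
          contradict (x , (surj , t≉0) , ¬surj) = ⊥-elim (¬surj (projected-surjective x t≉0 surj))

  abstract
    generic-surjective : Generic {Fin (suc k) × Elt} (λ x → IsSurjective R 𝒢 gen L (matrix x)) →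
                         Generic {Fin k × Elt} (λ x → IsSurjective R 𝒢 gen L′ (matrix x))
    generic-surjective {k = k} gen = generic-mono (λ (onV , onE) → λ { (inj₁ v) → onV v ; (inj₂ e) → onE e })
      (generic-∩ (generic-index finite λ v → at (inj₁ v)) (generic-index E-finite λ e → at (inj₂ e)))
      where
      at : ∀ P → Generic {Fin k × Elt} (λ x → Real′.SurjectiveAt (matrix x) P)
      at P = generic-surjectiveAt P (generic-mono (λ surj → surj P) gen)

  -- Adding a generic row

  private
    δ : Elt → Elt → F
    δ y z with decEq finite z y
    ... | yes _ = 1#
    ... | no  _ = 0#

    δ-same : ∀ y → δ y y ≡ 1#
    δ-same y with decEq finite y y
    ... | yes _  = ≡.refl
    ... | no  y≢ = ⊥-elim (y≢ ≡.refl)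

    δ-other : ∀ {y z} → ¬ z ≡ y → δ y z ≡ 0#
    δ-other {y} {z} z≢y with decEq finite z y
    ... | yes z≡y = ⊥-elim (z≢y z≡y)
    ... | no  _   = ≡.refl

    sum-zeros : ∀ {n} (f : Fin n → F) → (∀ j → f j ≈ 0#) → ∑ f ≈ 0#
    sum-zeros {zero}  f f≈0 = refl
    sum-zeros {suc n} f f≈0 = trans (+-cong (f≈0 zero) (sum-zeros (f ∘ suc) (f≈0 ∘ suc))) (+-identityˡ 0#)

    sum-single : ∀ {n} (f : Fin n → F) i → (∀ j → ¬ j ≡ i → f j ≈ 0#) → ∑ f ≈ f i
    sum-single f zero    f≈0 = trans (+-congˡ (sum-zeros (f ∘ suc) λ j → f≈0 (suc j) λ ())) (+-identityʳ (f zero))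
    sum-single f (suc i) f≈0 = trans (+-cong (f≈0 zero λ ()) (sum-single (f ∘ suc) i λ j j≢i → f≈0 (suc j) (j≢i ∘ Fin.suc-injective)))
      (+-identityˡ (f (suc i)))

    sum-δ : ∀ (a : Elt → F) y → ∑ (λ j → a (element finite j) * δ y (element finite j)) ≈ a y
    sum-δ a y = trans (sum-single (λ j → a (element finite j) * δ y (element finite j)) (to y) λ j j≢ →
          trans (*-congˡ (reflexive (δ-other λ eq → j≢ (≡.trans (≡.sym (strictlyInverseˡ j)) (≡.cong to eq))))) (zeroʳ (a (from j))))
        (trans (reflexive (≡.cong (λ z → a z * δ y z) (strictlyInverseʳ y)))
          (trans (*-congˡ (reflexive (δ-same y))) (*-identityʳ (a y))))
      where open Inverse (proj₂ finite) using (to; from; strictlyInverseˡ; strictlyInverseʳ)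

  tailPoint : (Fin (suc k) × Elt → F) → Fin k × Elt → F
  tailPoint x (i , y) = x (suc i , y)

  -- If adding a generic row (the one with index zero) does not lower the maximum excess, then the minimal maximizer
  -- lies in the kernel of every generic row; moving one entry of such a row shows that it is zero.
  module _ (m : ℤ) (f : Polynomial F (Fin (suc k) × Elt)) (excessive : ∀ {x} → Nonzero f x → Fam.Excessive (matrix x) m)
           (x₀ : Fin (suc k) × Elt → F) (fx₀ : Nonzero f x₀)
           (U : Family) (U-min : IsMinimalMaximizer L (Fam.Kernel (matrix (tailPoint x₀))) U) (U≤m : excess L U ℤ.≤ m) where

    private
      M′ = matrix (tailPoint x₀)

      perturb : Elt → F → Fin (suc k) × Elt → F
      perturb y t (zero  , z) = x₀ (zero , z) + t * δ y z
      perturb y t (suc i , z) = x₀ (suc i , z)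

      orthogonal : ∀ y t → Nonzero f (perturb y t) → ∀ v {a} → Member (U v) a → columnComb R 𝒢 gen L (matrix (perturb y t)) a zero ≈ 0#
      orthogonal y t ≉0 v {a} a∈ = extract (excessive ≉0)
        where
        extract : Fam.Excessive (matrix (perturb y t)) m → columnComb R 𝒢 gen L (matrix (perturb y t)) a zero ≈ 0#
        extract (W , W⊑K , m≤) = proj₂ (W⊑K v {a} (minimalMaximizer-⊑ L (Fam.Kernel M′) {U} {W} U-min W-max v {a} a∈)) zero
          where
          W-max : IsMaximizer L (Fam.Kernel M′) W
          -- The perturbation changes only the row `zero`, so `W` is also a family for `M′`; its
          -- excess is at least `m`, which is already the maximum there by `U≤m`.
          W-max = (λ v {a} a∈ → let s , z = W⊑K v {a} a∈ in s , λ i → z (suc i))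
            , λ W′ W′⊑K → ℤ.≤-trans (proj₂ (proj₁ U-min) W′ W′⊑K) (ℤ.≤-trans U≤m m≤)

      row : Elt → Fin (suc k) × Elt → Polynomial F (Maybe ⊥)
      row y (zero  , z) = con (x₀ (zero , z)) :+ (var nothing :* con (δ y z))
      row y (suc i , z) = con (x₀ (suc i , z))

      row-perturb : ∀ y t i → eval R (row y i) (extend ⊥-elim t) ≈ perturb y t i
      row-perturb y t (zero  , z) = refl
      row-perturb y t (suc i , z) = refl

      along : ∀ y t → eval R (substitute f (row y)) (extend ⊥-elim t) ≈ eval R f (perturb y t)
      along y t = trans (eval-substitute f (row y) (extend ⊥-elim t)) (eval-cong f (row-perturb y t))

      perturb-0 : ∀ y i → perturb y 0# i ≈ x₀ i
      perturb-0 y (zero  , z) = trans (+-congˡ (zeroˡ (δ y z))) (+-identityʳ (x₀ (zero , z)))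
      perturb-0 y (suc i , z) = refl

      nonzero-0 : ∀ y → Nonzero f (perturb y 0#)
      nonzero-0 y ≈0 = fx₀ (trans (sym (eval-cong f (perturb-0 y))) ≈0)

      column-perturb : ∀ y t a → columnComb R 𝒢 gen L (matrix (perturb y t)) a zero ≈ columnComb R 𝒢 gen L (matrix x₀) a zero + t * a y
      column-perturb y t a = trans
        (sum-cong-≋ {x = λ j → a (el j) * (x₀ (zero , el j) + t * δ y (el j))} λ j →
          solve 4 (λ a x t d → a ⊛ (x ⊹ t ⊛ d) := a ⊛ x ⊹ t ⊛ (a ⊛ d)) refl (a (el j)) (x₀ (zero , el j)) t (δ y (el j)))
        (trans (∑-distrib-+ (λ j → a (el j) * x₀ (zero , el j)) (λ j → t * (a (el j) * δ y (el j))))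
          (+-congˡ (trans (sym (*-distribˡ-sum t (λ j → a (el j) * δ y (el j)))) (*-congˡ (sum-δ a y)))))
        where el = element finite

    abstract
      minimalMaximizer-vanishes : ∀ v {a} → Member (U v) a → ∀ y → a y ≈ 0#
      -- Along the line of perturbations of the entry at `y`, `off-point` finds a nonzero `t` that
      -- stays in the open set. Orthogonality at `t` and at `0#` differ by `t * a y`, which
      -- therefore vanishes.
      minimalMaximizer-vanishes v {a} a∈ y = extract (off-point (λ t → eval R (substitute f (row y)) (extend ⊥-elim t))
          (isPolynomial-eval (substitute f (row y)) ⊥-elim) (0# , λ ≈0 → nonzero-0 y (trans (sym (along y 0#)) ≈0)) 0#)
        where
        r·a : F
        r·a = columnComb R 𝒢 gen L (matrix x₀) a zero

        r·a≈0 : r·a ≈ 0#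
        r·a≈0 = trans (sym (trans (+-congˡ (zeroˡ (a y))) (+-identityʳ r·a)))
          (trans (sym (column-perturb y 0# a)) (orthogonal y 0# (nonzero-0 y) v {a} a∈))

        extract : ∃[ t ] (¬ (eval R (substitute f (row y)) (extend ⊥-elim t) ≈ 0#) × ¬ (t ≈ 0#)) → a y ≈ 0#
        extract (t , ≉0 , t≉0) = [ (λ t≈0 → ⊥-elim (t≉0 t≈0)) , id ]′ (*-≈0 (trans (sym (+-identityˡ (t * a y)))
          (trans (+-congʳ (sym r·a≈0)) (trans (sym (column-perturb y t a))
            (orthogonal y t (λ ≈0 → ≉0 (trans (along y t) ≈0)) v {a} a∈)))))

      minimalMaximizer-excess-0 : excess L U ≡ ℤ.+ 0
      minimalMaximizer-excess-0 = ≡.cong₂ _⊖_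
        (≡.cong₂ ℕ._+_ (zeros λ v → dim-0 (Γ L U (v , zero)) λ {a} (_ , _ , a∈) → minimalMaximizer-vanishes v {a} a∈)
                       (zeros λ v → dim-0 (Γ L U (v , suc zero)) λ {a} (_ , _ , a∈) → minimalMaximizer-vanishes v {a} a∈))
        (zeros λ v → dim-0 (U v) λ {a} a∈ → minimalMaximizer-vanishes v {a} a∈)
        where
        dim-0 : ∀ {p} (S : Subspace R 𝔸 p) → (∀ {a} → Member S a → ∀ y → a y ≈ 0#) → dim S ≡ 0
        dim-0 S S≈0 = ℕ.n≤0⇒n≡0 (dim-≤-span {vs = []} S λ {a} a∈ → base (S≈0 {a} a∈))

        zeros : ∀ {u : V → ℕ} → (∀ v → u v ≡ 0) → ΣV u ≡ 0
        zeros u≡0 = ≡.trans (sum-map-const 0 (elements finite) u≡0) (ℕ.*-zeroʳ order)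

  private
    -- A strict increase from one multiple of `n` to another is at least `n`. The multiples are kept
    -- as differences because positive and negative parts are divisible separately.
    divisible-gap : ∀ n a b a′ b′ → n ℕ.* a ⊖ n ℕ.* b ℤ.≤ n ℕ.* a′ ⊖ n ℕ.* b′ →
                    n ℕ.* a′ ⊖ n ℕ.* b′ ℤ.< ℤ.+ n ℤ.+ (n ℕ.* a ⊖ n ℕ.* b) → n ℕ.* a′ ⊖ n ℕ.* b′ ℤ.≤ n ℕ.* a ⊖ n ℕ.* b
    divisible-gap n a b a′ b′ lower upper = ⊖-≤⁺ (n ℕ.* a′) (n ℕ.* b′) (n ℕ.* a) (n ℕ.* b)
      (≡.subst₂ ℕ._≤_ (ℕ.*-distribˡ-+ n a′ b) (ℕ.*-distribˡ-+ n a b′) (ℕ.*-monoʳ-≤ n (ℕ.≮⇒≥ λ lt → ℤ.<⇒≱ upper (gap lt))))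
      where
      gap : a ℕ.+ b′ ℕ.< a′ ℕ.+ b → ℤ.+ n ℤ.+ (n ℕ.* a ⊖ n ℕ.* b) ℤ.≤ n ℕ.* a′ ⊖ n ℕ.* b′
      gap lt = ℤ.≤-trans (ℤ.≤-reflexive (ℤ.distribʳ-⊖-+-pos n (n ℕ.* a) (n ℕ.* b)))
        (⊖-≤⁺ (n ℕ.+ n ℕ.* a) (n ℕ.* b) (n ℕ.* a′) (n ℕ.* b′)
          (≡.subst₂ ℕ._≤_ left (ℕ.*-distribˡ-+ n a′ b) (ℕ.*-monoʳ-≤ n lt)))
        where
        left : n ℕ.* suc (a ℕ.+ b′) ≡ n ℕ.+ n ℕ.* a ℕ.+ n ℕ.* b′
        left = ≡.trans (ℕ.*-suc n (a ℕ.+ b′)) (≡.trans (≡.cong (n ℕ.+_) (ℕ.*-distribˡ-+ n a b′)) (≡.sym (ℕ.+-assoc n (n ℕ.* a) (n ℕ.* b′))))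

  module _ (m : ℤ) where

    private
      -- The first two conditions make the maximum excess of the full matrix exactly `m`; the fourth
      -- is what remains when the excess of the tail rows is too small to pay for the removed edge.
      Good : (Fin (suc k) × Elt → F) → Set (lsuc (c ⊔ ℓ₁))
      Good x = Fam.Excessive (matrix x) m
             × ¬ Fam.Excessive (matrix x) (ℤ.suc m)
             × Symmetric (matrix x)
             × ¬ Fam.Excessive (matrix (tailPoint x)) (ℤ.+ order ℤ.+ m)
             × Symmetric (matrix (tailPoint x))

      maximizer-excess : ∀ (M : Fin k → Elt → F) U → IsMaximizer L (Fam.Kernel M) U → Fam.Excessive M m → m ℤ.≤ excess L U
      maximizer-excess M U (_ , max) (W , W⊑K , m≤) = ℤ.≤-trans m≤ (max W W⊑K)

      below : ∀ (M : Fin k → Elt → F) U n → IsMaximizer L (Fam.Kernel M) U → ¬ Fam.Excessive M n → excess L U ℤ.< n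
      below M U n (U⊑K , _) ¬exc = ℤ.≰⇒> λ n≤ → ¬exc (U , U⊑K , n≤)

      tail-excessive : ∀ (x : Fin (suc k) × Elt → F) → Fam.Excessive (matrix x) m → Fam.Excessive (matrix (tailPoint x)) m
      tail-excessive x (U , U⊑K , m≤) = U , (λ v {a} a∈ → let s , z = U⊑K v {a} a∈ in s , λ i → z (suc i)) , m≤

    abstract
      -- The conditions are assumed on a whole open set and not at one point, since the row `zero`
      -- is perturbed within it.
      good⇒zero : ∀ (f : Polynomial F (Fin (suc k) × Elt)) → Nonzero f ⊆ Good → ∀ x → Nonzero f x → m ≡ ℤ.+ 0
      good⇒zero f good x fx =
        extract (good fx) (minimalMaximizer L (Fam.Kernel (matrix x))) (minimalMaximizer L (Fam.Kernel (matrix (tailPoint x))))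
        where
        extract : Good x → ∃ (IsMinimalMaximizer L (Fam.Kernel (matrix x))) →
                  ∃ (IsMinimalMaximizer L (Fam.Kernel (matrix (tailPoint x)))) → m ≡ ℤ.+ 0
        extract (exc , ¬exc , sym-x , ¬exc′ , sym-x′) (U , U-min) (U′ , U′-min) =
          ≡.trans (ℤ.≤-antisym m≤U′ U′≤m)
            (minimalMaximizer-excess-0 m f (λ fx → proj₁ (good fx)) x fx U′ U′-min U′≤m)
          where
          m≤U′ : m ℤ.≤ excess L U′
          m≤U′ = maximizer-excess (matrix (tailPoint x)) U′ (proj₁ U′-min) (tail-excessive x exc)

          U≡m : excess L U ≡ m
          U≡m = ℤ.≤-antisym
            (ℤ.≮⇒≥ λ m<U → ℤ.<⇒≱ (below (matrix x) U (ℤ.suc m) (proj₁ U-min) ¬exc) (ℤ.i<j⇒suc[i]≤j m<U))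
            (maximizer-excess (matrix x) U (proj₁ U-min) exc)

          compare : ∃[ a ] ∃[ b ] (pos L U ≡ order ℕ.* a × neg L U ≡ order ℕ.* b) →
                    ∃[ a ] ∃[ b ] (pos L U′ ≡ order ℕ.* a × neg L U′ ≡ order ℕ.* b) → excess L U′ ℤ.≤ excess L U
          compare (a , b , pos≡ , neg≡) (a′ , b′ , pos′≡ , neg′≡) = ≡.subst₂ ℤ._≤_ (≡.sym U′≡) (≡.sym U≡)
            (divisible-gap order a b a′ b′
              (≡.subst₂ ℤ._≤_ (≡.trans (≡.sym U≡m) U≡) U′≡ m≤U′)
              (≡.subst₂ ℤ._<_ U′≡ (≡.cong (λ z → ℤ.+ order ℤ.+ z) (≡.trans (≡.sym U≡m) U≡))
                (below (matrix (tailPoint x)) U′ (ℤ.+ order ℤ.+ m) (proj₁ U′-min) ¬exc′)))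
            where
            U≡ : excess L U ≡ order ℕ.* a ⊖ order ℕ.* b
            U≡ = ≡.cong₂ _⊖_ pos≡ neg≡
            U′≡ : excess L U′ ≡ order ℕ.* a′ ⊖ order ℕ.* b′
            U′≡ = ≡.cong₂ _⊖_ pos′≡ neg′≡

          U′≤m : excess L U′ ℤ.≤ m
          U′≤m = ≡.subst (excess L U′ ℤ.≤_) U≡m
            (compare (minimalMaximizer-divisible (matrix x) sym-x U U-min) (minimalMaximizer-divisible (matrix (tailPoint x)) sym-x′ U′ U′-min))

      excessive-0 : ∀ (M : Fin k → Elt → F) → m ≡ ℤ.+ 0 → Fam′.Excessive M m
      excessive-0 M ≡.refl = zeroFamily L′ (Fam′.Kernel M) , zeroFamily-⊑ L′ (Fam′.Kernel M) (Fam′.Kernel M)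
        , ⊖-≤⁺ 0 0 (pos L′ W) (neg L′ W) (≡.subst (ℕ._≤ pos L′ W ℕ.+ 0) (≡.sym neg≡0) z≤n)
        where
        W : Family
        W = zeroFamily L′ (Fam′.Kernel M)

        neg≡0 : neg L′ W ≡ 0
        neg≡0 = ≡.trans (sum-map-const 0 (elements finite) λ v → ℕ.n≤0⇒n≡0 (dim-≤-span {vs = []} (W v) id)) (ℕ.*-zeroʳ order)

      excessive-dense : Generic {Fin (suc k) × Elt} (λ x → Fam.Excessive (matrix x) m) →
                        Generic {Fin (suc k) × Elt} (λ x → ¬ Fam.Excessive (matrix x) (ℤ.suc m)) →
                        ZariskiDense R {X = Fin k × Elt} (λ x → Fam′.Excessive (matrix x) m)
      excessive-dense {k = k} exc ¬exc = byContradiction λ ¬dense →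
        let ¬exc′ = ¬dense⇒generic-¬ ¬dense
            f , (x , fx) , f⊆ = generic-∩ exc (generic-∩ ¬exc (generic-∩ generic-symmetric (generic-∩
              -- In contraposition, failure of excess `m` for `L′` rules out excess `order` + `m`
              -- for `L` with the same tail rows.
              (generic-tail (generic-mono (λ {x} ¬exc′ → ¬exc′ ∘ excessive-loss (matrix x) m) ¬exc′))
              (generic-tail {S = λ x → Symmetric (matrix x)} generic-symmetric))))
        in  proj₂ (generic-point ¬exc′) (excessive-0 (matrix (proj₁ (generic-point ¬exc′))) (good⇒zero f f⊆ x fx))


-- From dense conditions to generic ones and back

module Attainment (em : ∀ {a} → ExcludedMiddle a) {c ℓ₁} (R : CommutativeRing c ℓ₁) (isField : IsField R)
                  (closed : IsAlgebraicallyClosed R)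
                  (𝒢 : FiniteGroup) (gen : Fin 2 → FiniteGroup.Carrier 𝒢)
                  (L : Subgraph (cayleyBigraph 𝒢 gen)) {k : ℕ} where

  open Density em R isField closed
  open QuantifierElimination em R isField closed using (con-dense⇒generic)
  open FiniteGroup 𝒢 using () renaming (Carrier to Elt)


  Point : Set c
  Point = Fin k × Elt → CommutativeRing.Carrier R

  Surjective : Pred Point (c ⊔ ℓ₁)
  Surjective x = IsSurjective R 𝒢 gen L (λ i g → x (i , g))

  Excessive : ℤ → Pred Point (lsuc (c ⊔ ℓ₁))
  Excessive n x = SheafBridge.Excessive em R isField 𝒢 gen L (λ i g → x (i , g)) n

  Attains : ℤ → Pred Point (lsuc (c ⊔ ℓ₁))
  Attains n x = let M = λ i g → x (i , g) in IsSurjective R 𝒢 gen L M × ∃[ e ] (IsMaximumExcess (𝒦 R 𝒢 gen L M) e × n ℤ.≤ e)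

  attains-surjective : ∀ n → Attains n ⊆ Surjective
  attains-surjective n = proj₁

  attains-excessive : ∀ n → Attains n ⊆ Excessive n
  attains-excessive n {x} (_ , maximum) = SheafBridge.maximum⇒excessive em R isField 𝒢 gen L (λ i g → x (i , g)) n maximum

  excessive-attains : ∀ n {x} → Excessive n x × Surjective x → Attains n x
  excessive-attains n {x} (excessive , surjective) =
    surjective , SheafBridge.excessive⇒maximum em R isField 𝒢 gen L (λ i g → x (i , g)) n excessive

  abstract
    dense⇒generic-surjective : ∀ n → ZariskiDense R (Attains n) → Generic Surjective
    dense⇒generic-surjective n dense = con-dense⇒generic {S = Surjective} (Realisation.con-surjective em R isField closed 𝒢 gen L)
      (dense-mono {S = Attains n} {Surjective} (λ {x} → attains-surjective n {x}) dense)

    dense⇒generic-excessive : ∀ n → ZariskiDense R (Attains n) → Generic (Excessive n)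
    dense⇒generic-excessive n dense = con-dense⇒generic {S = Excessive n} (Families.con-excessive em R isField closed 𝒢 gen L n)
      (dense-mono {S = Attains n} {Excessive n} (λ {x} → attains-excessive n {x}) dense)

    -- Genericity of surjectivity is essential here: two merely dense conditions need not have a
    -- common point.
    dense-attains : ∀ n → ZariskiDense R (Excessive n) → Generic Surjective → ZariskiDense R (Attains n)
    dense-attains n excessive surjective = dense-mono {S = λ x → Excessive n x × Surjective x} {Attains n} (λ {x} → excessive-attains n {x})
      (dense-∩-generic {S = Excessive n} {Surjective} excessive surjective)

    -- Otherwise excess at least `ℤ.suc m` would be dense, and generic surjectivity would make it
    -- attained densely, beyond the greatest value `m`.
    greatest⇒generic-¬excessive : ∀ m → Generic Surjective → (∀ n → ZariskiDense R (Attains n) → n ℤ.≤ m) →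
                                  Generic (λ x → ¬ Excessive (ℤ.suc m) x)
    greatest⇒generic-¬excessive m surjective greatest = ¬dense⇒generic-¬ {S = Excessive (ℤ.suc m)} λ excessive →
      ℤ.<⇒≱ (ℤ.suc[i]≤j⇒i<j ℤ.≤-refl) (greatest (ℤ.suc m) (dense-attains (ℤ.suc m) excessive surjective))

-- The comparison of generic maximum excesses

module _ (em : ∀ {a} → ExcludedMiddle a) {c ℓ₁} (R : CommutativeRing c ℓ₁) (isField : IsField R)
         (closed : IsAlgebraicallyClosed R) (𝒢 : FiniteGroup) (gen : Fin 2 → FiniteGroup.Carrier 𝒢) where

  genericMaximumExcess-removeEdge : ∀ L k e m m′ → IsGenericMaximumExcess R 𝒢 gen L (suc k) m →
                                    IsGenericMaximumExcess R 𝒢 gen (removeEdge L e) k m′ → m ℤ.≤ m′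
  genericMaximumExcess-removeEdge L k e m m′ (dense , greatest) (_ , greatest′) =
    greatest′ m (On′.dense-attains m
      (excessive-dense m (On.dense⇒generic-excessive m dense) (On.greatest⇒generic-¬excessive m surjective greatest))
      (generic-surjective surjective))
    where
    open EdgeRemoval em R isField closed 𝒢 gen L e using (excessive-dense; generic-surjective)
    module On = Attainment em R isField closed 𝒢 gen L {suc k}
    module On′ = Attainment em R isField closed 𝒢 gen (removeEdge L e) {k}

    surjective : Density.Generic em R isField closed On.Surjective
    surjective = On.dense⇒generic-surjective m dense

theorem2 : (em : ∀ {a} → ExcludedMiddle a) →
    ∀ {c ℓ₁ ℓ₂} (𝔽 : HeytingField c ℓ₁ ℓ₂) → IsAlgebraicallyClosed (fieldRing 𝔽) →
    (𝒢 : FiniteGroup) (gen : Fin 2 → FiniteGroup.Carrier 𝒢)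
    (L : Subgraph (cayleyBigraph 𝒢 gen)) (k : ℕ) → 1 ℕ.≤ k → k ℕ.≤ ρ em L →
    (e : Graph.E (cayleyBigraph 𝒢 gen)) → T (Subgraph.hasE L e) →
    (m m′ : ℤ) →
    IsGenericMaximumExcess (fieldRing 𝔽) 𝒢 gen L k m →
    IsGenericMaximumExcess (fieldRing 𝔽) 𝒢 gen (removeEdge L e) (k ∸ 1) m′ →
    m ℤ.≤ m′
theorem2 em 𝔽 closed 𝒢 gen L k 1≤k _ e _ m m′ generic generic′ =
    genericMaximumExcess-removeEdge em (fieldRing 𝔽) (fieldRing-isField em 𝔽) closed 𝒢 gen L (k ∸ 1) e m m′
      (≡.subst (λ j → IsGenericMaximumExcess (fieldRing 𝔽) 𝒢 gen L j m) (≡.sym suc-pred) generic) generic′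
  where
  suc-pred : suc (k ∸ 1) ≡ k
  suc-pred = ℕ.m+[n∸m]≡n 1≤k
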